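{- Let $n\ge 2$ and $s=(2,3,\ldots,n)$ (a sequence of length $n-1$). Then the $s$-derangement polynomial satisfies $d_{n-1}^s(z)=d_n(z)$, the classical derangement polynomial. Moreover, the local $h$-polynomial of the barycentric subdivision of the $(n-1)$-simplex $2^{[n]}$ equals the local $h^\ast$-polynomial $\ell^\ast(P_{n-1}^s;z)$ of the $s$-lecture hall simplex $P_{n-1}^s$.
   Context: $P_{m}^s=\{x\in\mathbb{R}^{m}: 0\le x_1/s_1\le\cdots\le x_{m}/s_{m}\le 1\}$ for $s=(s_1,\ldots,s_m)$; for a lattice $d$-simplex $\Delta=\mathrm{conv}(v^{(0)},\ldots,v^{(d)})\subset\mathbb{R}^m$, $\ell^\ast(\Delta;z)=\sum_{x\in\Pi^\circ_\Delta\cap\mathbb{Z}^{m+1}}z^{x_{m+1}}$ with $\Pi^\circ_\Delta=\{\sum_i\lambda_i(v^{(i)},1): 0<\lambda_i<1\}$; $d_m^s(z):=\ell^\ast(P_m^s;z)$. The derangement polynomial is $d_n(z)=\sum_{\pi\in\mathfrak{D}_n}z^{\mathrm{exc}(\pi)}$, where $\mathfrak{D}_n$ is the set of permutations of $[n]$ without fixed points and $\mathrm{exc}(\pi)=|\{i:\pi_i>i\}|$. For a $(d-1)$-dimensional simplicial complex $\Omega$ with $f_{i-1}$ faces of dimension $i-1$ ($f_{ -1}=1$), $h(\Omega;z)=\sum_{i=0}^d f_{i-1}z^i(1-z)^{d-i}$. If $\Omega$ is a subdivision of the simplex $2^V$, $|V|=n$, and for $F\subseteq V$ $\Omega_F$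 denotes the restriction of $\Omega$ to the face $F$ (the subcomplex subdividing $2^F$; $h(\Omega_\emptyset;z)=1$), the local $h$-polynomial is $\ell_V(\Omega_V;z)=\sum_{F\subseteq V}(-1)^{n-|F|}h(\Omega_F;z)$. -}

module Defs where

open import Algebra.Bundles using (CommutativeRing)
import Algebra.Properties.Monoid.Mult
import Algebra.Properties.Ring
import Algebra.Properties.Semiring.Sum
import Algebra.Properties.CommutativeMonoid.Sum
import Algebra.Solver.Ring.NaturalCoefficients.Default
open import Data.Fin.Base as Fin using (Fin; zero; suc; toℕ)
import Data.Fin.Properties as Fin
open import Data.Fin.Subset using (Subset; inside; outside; ∣_∣; ⋃; _⊆_; ⊥)
open import Data.Fin.Subset.Properties
  using (_⊆?_; nonempty?; p⊆p∪q; q⊆p∪q; x∈p∪q⁻; x∈p∪q⁺; ⊥⊆)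
open import Data.Integer.Base as ℤ using (ℤ; +_; -[1+_]; 0ℤ; 1ℤ; -1ℤ)
import Data.Integer.Properties as ℤ
open import Data.List.Base
  using (List; []; _∷_; [_]; _++_; map; filter; foldr; length; upTo; allFin; cartesianProduct; cartesianProductWith)
open import Data.List.Extrema.Nat using (max)
open import Data.List.Membership.Propositional using (_∈_)
open import Data.List.Membership.Propositional.Properties
  using (∈-cartesianProductWith⁺; ∈-cartesianProduct⁺; ∈-filter⁺; ∈-filter⁻; ∈-++⁺ˡ; ∈-++⁺ʳ; ∈-map⁺; ∈-map⁻; ∈-upTo⁺)
open import Data.List.Relation.Binary.Sublist.Propositional
  using ([]; _∷_; _∷ʳ_) renaming (_⊆_ to _⊑_)
open import Data.List.Relation.Unary.All using ([]; _∷_)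
open import Data.List.Relation.Binary.Sublist.Propositional.Properties using (All-resp-⊆)
open import Data.List.Relation.Unary.AllPairs using (AllPairs; []; _∷_; allPairs?)
open import Data.List.Relation.Unary.Any using (here)
open import Data.List.Relation.Unary.Unique.Propositional using (Unique)
import Data.List.Relation.Unary.Unique.Propositional.Properties as Unique
open import Data.Nat.Base as ℕ using (ℕ; zero; suc; _∸_; NonZero; z≤n; s≤s)
import Data.Nat.Properties as ℕ
open import Data.Product.Base using (∃; _×_; _,_; proj₁; proj₂)
open import Data.Sum.Base as Sum using (_⊎_; inj₁; inj₂)
open import Data.Vec.Base as Vec using (Vec; []; _∷_; lookup)
import Data.Vec.Properties as Vec
open import Data.Vec.Functional using (Vector; tail)
open import Function.Base using (_∘_; case_of_)
open import Function.Bundles using (_⇔_; mk⇔)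
open import Function.Definitions using (Bijective; Injective; Surjective)
open import Level using (Level; _⊔_; 0ℓ) renaming (suc to lsuc)
open import Relation.Binary.Core using (Rel)
open import Relation.Binary.PropositionalEquality as ≡ using (_≡_; _≢_)
import Relation.Binary.Construct.StrictToNonStrict
open import Relation.Binary.Structures using (IsStrictTotalOrder)
open import Relation.Nullary using (¬_; Dec; yes; no; contradiction)
open import Relation.Nullary.Decidable using (map′; ¬?; _×-dec_; _⊎-dec_; _→-dec_)
open import Relation.Unary using (Decidable)

private
  variable
    m n d : ℕ

------------------------------------------------------------------------
-- Polynomials in one variable z over ℤ

-- A polynomial is its list of coefficients, constant term first; trailing
-- zeros are allowed, so polynomials are compared by `_≈ₚ_`, not by `_≡_`.

Poly : Set
Poly = List ℤ

coeff : Poly → ℕ → ℤ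
coeff []      _       = 0ℤ
coeff (a ∷ p) zero    = a
coeff (a ∷ p) (suc k) = coeff p k

infix  4 _≈ₚ_
infixl 6 _+ₚ_
infixl 7 _*ₚ_
infixr 8 _^ₚ_

_≈ₚ_ : Poly → Poly → Set
p ≈ₚ q = ∀ k → coeff p k ≡ coeff q k

constₚ : ℤ → Poly
constₚ a = [ a ]

z 1-z : Poly
z   = 0ℤ ∷ 1ℤ ∷ []
1-z = 1ℤ ∷ -1ℤ ∷ []

_+ₚ_ : Poly → Poly → Poly
[]      +ₚ q       = q
(a ∷ p) +ₚ []      = a ∷ p
(a ∷ p) +ₚ (b ∷ q) = (a ℤ.+ b) ∷ (p +ₚ q)

_*ₚ_ : Poly → Poly → Poly
[]      *ₚ q = []
(a ∷ p) *ₚ q = map (a ℤ.*_) q +ₚ (0ℤ ∷ (p *ₚ q))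

_^ₚ_ : Poly → ℕ → Poly
p ^ₚ zero  = constₚ 1ℤ
p ^ₚ suc k = p *ₚ p ^ₚ k

∑ₚ : {A : Set} → List A → (A → Poly) → Poly
∑ₚ xs f = foldr _+ₚ_ [] (map f xs)

------------------------------------------------------------------------
-- Enumerations of finite sets

choices : {A : Set} → Vec (List A) n → List (Vec A n)
choices []         = [ [] ]
choices (xs ∷ xss) = cartesianProductWith _∷_ xs (choices xss)

∈-choices : {A : Set} (xss : Vec (List A) n) (v : Vec A n) →
            (∀ i → lookup v i ∈ lookup xss i) → v ∈ choices xss
∈-choices []         []      h = here ≡.refl
∈-choices (xs ∷ xss) (x ∷ v) h =
  ∈-cartesianProductWith⁺ _∷_ (h zero) (∈-choices xss v (h ∘ suc))

choices-unique : {A : Set} (xss : Vec (List A) n) →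
                 (∀ i → Unique (lookup xss i)) → Unique (choices xss)
choices-unique []         h = [] ∷ []
choices-unique (xs ∷ xss) h =
  Unique.cartesianProductWith⁺ _∷_ Vec.∷-injective (h zero) (choices-unique xss (h ∘ suc))

subsets : ∀ n → List (Subset n)
subsets n = choices (Vec.replicate n (outside ∷ inside ∷ []))

-- The finite subsets of a duplicate-free list, each one listed in the order
-- of that list.

sublists : {A : Set} → List A → List (List A)
sublists []       = [ [] ]
sublists (x ∷ xs) = map (x ∷_) (sublists xs) ++ sublists xs

------------------------------------------------------------------------
-- Derangement polynomials

-- Permutations of [n] are given in one-line notation: π : Vec (Fin n) n
-- stands for i ↦ lookup π i.

IsDerangement : Vec (Fin n) n → Set
IsDerangement π = Bijective _≡_ _≡_ (lookup π) × (∀ i → lookup π i ≢ i)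

bijective? : (π : Vec (Fin n) n) → Dec (Bijective _≡_ _≡_ (lookup π))
bijective? π = injective? ×-dec surjective?
  where
  injective? : Dec (Injective _≡_ _≡_ (lookup π))
  injective? = map′ (λ h {i} {j} → h i j) (λ h i j → h {i} {j})
    (Fin.all? λ i → Fin.all? λ j → (lookup π i Fin.≟ lookup π j) →-dec (i Fin.≟ j))

  surjective? : Dec (Surjective _≡_ _≡_ (lookup π))
  surjective? = map′
    (λ h y → proj₁ (h y) , λ { ≡.refl → proj₂ (h y) })
    (λ h y → proj₁ (h y) , proj₂ (h y) ≡.refl)
    (Fin.all? λ y → Fin.any? λ i → lookup π i Fin.≟ y)

isDerangement? : Decidable (IsDerangement {n})
isDerangement? π = bijective? π ×-dec Fin.all? λ i → ¬? (lookup π i Fin.≟ i)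

derangements : ∀ n → List (Vec (Fin n) n)
derangements n = filter isDerangement? (choices (Vec.replicate n (allFin n)))

exc : Vec (Fin n) n → ℕ
exc {n} π = length (filter (λ i → i Fin.<? lookup π i) (allFin n))

derangementPoly : ℕ → Poly
derangementPoly n = ∑ₚ (derangements n) λ π → z ^ₚ exc π

------------------------------------------------------------------------
-- Finite simplicial complexes and h-polynomials

-- Faces are finite sets of vertices.  Such a set is represented by the
-- sublist of `vertices` containing its elements; `Face` is only ever
-- consulted on those sublists.

record Complex (A : Set) : Set₁ where
  field
    vertices        : List A
    vertices-unique : Unique vertices
    Face            : List A → Set
    face?           : Decidable Face
    []-face         : Face []
    vertex-face     : ∀ {v} → v ∈ vertices → Face [ v ]
    face-⊑          : ∀ {xs ys} → xs ⊑ ys → Face ys → Face xs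

  faces : List (List A)
  faces = filter face? (sublists vertices)

  -- f i is f_{i-1}, the number of faces with i vertices.
  f : ℕ → ℕ
  f i = length (filter (λ xs → length xs ℕ.≟ i) faces)

  -- The largest number of vertices of a face, so that the complex is
  -- (size - 1)-dimensional.
  size : ℕ
  size = max 0 (map length faces)

h : {A : Set} → Complex A → Poly
h Ω = ∑ₚ (upTo (suc size)) λ i → constₚ (+ f i) *ₚ z ^ₚ i *ₚ 1-z ^ₚ (size ∸ i)
  where open Complex Ω

-- The combinatorial data of a subdivision of the simplex 2^[n]: a complex
-- together with the map sending each face to its carrier, the smallest face
-- of 2^[n] containing it.  The topological requirement that each restriction
-- be a ball is not part of the record: restrictions, h-polynomials and local
-- h-polynomials are determined by the data below.

record CarriedComplex (n : ℕ) (A : Set) : Set₁ where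
  field
    complex : Complex A
  open Complex complex public
  field
    carrier    : List A → Subset n
    carrier-[] : carrier [] ≡ ⊥
    carrier-⊑  : ∀ {xs ys} → xs ⊑ ys → Face ys → carrier xs ⊆ carrier ys

restrict : {A : Set} → CarriedComplex n A → Subset n → Complex A
restrict Ω F = record
  { vertices        = filter (λ v → carrier [ v ] ⊆? F) vertices
  ; vertices-unique = Unique.filter⁺ (λ v → carrier [ v ] ⊆? F) vertices-unique
  ; Face            = λ xs → Face xs × carrier xs ⊆ F
  ; face?           = λ xs → face? xs ×-dec (carrier xs ⊆? F)
  ; []-face         = []-face , λ {i} i∈ → ⊥⊆ (≡.subst (λ G → i Data.Fin.Subset.∈ G) carrier-[] i∈)
  ; vertex-face     = λ v∈ →
      let v∈Ω , v⊆F = ∈-filter⁻ (λ v → carrier [ v ] ⊆? F) v∈ in vertex-face v∈Ω , v⊆F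
  ; face-⊑          = λ { xs⊑ys (ys∈Ω , ys⊆F) → face-⊑ xs⊑ys ys∈Ω , ys⊆F ∘ carrier-⊑ xs⊑ys ys∈Ω }
  }
  where open CarriedComplex Ω

localH : {A : Set} → CarriedComplex n A → Poly
localH {n} Ω = ∑ₚ (subsets n) λ F →
  constₚ (-1ℤ ℤ.^ (n ∸ ∣ F ∣)) *ₚ h (restrict Ω F)

------------------------------------------------------------------------
-- The barycentric subdivision of 2^[n]

-- Its vertices are the nonempty faces of 2^[n] (standing for their
-- barycentres), its faces are the chains of nonempty faces, and the carrier
-- of a chain is its largest member, i.e. the union of its members.

Comparable : Subset n → Subset n → Set
Comparable F G = F ⊆ G ⊎ G ⊆ F

AllPairs-resp-⊑ : {A : Set} {R : Rel A 0ℓ} {xs ys : List A} →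
                  xs ⊑ ys → AllPairs R ys → AllPairs R xs
AllPairs-resp-⊑ []             []       = []
AllPairs-resp-⊑ (_ ∷ʳ τ)       (_ ∷ ps) = AllPairs-resp-⊑ τ ps
AllPairs-resp-⊑ (≡.refl ∷ τ)   (p ∷ ps) = All-resp-⊆ τ p ∷ AllPairs-resp-⊑ τ ps

⋃-mono-⊑ : {xs ys : List (Subset n)} → xs ⊑ ys → ⋃ xs ⊆ ⋃ ys
⋃-mono-⊑ []                                        x∈ = x∈
⋃-mono-⊑ {ys = _ ∷ ys}              (G ∷ʳ τ)       x∈ = q⊆p∪q G (⋃ ys) (⋃-mono-⊑ τ x∈)
⋃-mono-⊑ {xs = F ∷ xs} {ys = _ ∷ ys} (≡.refl ∷ τ) x∈ =
  x∈p∪q⁺ (Sum.map₂ (⋃-mono-⊑ τ) (x∈p∪q⁻ F (⋃ xs) x∈))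

subsets-unique : ∀ n → Unique (subsets n)
subsets-unique n = choices-unique (Vec.replicate n _) λ i →
  ≡.subst Unique (≡.sym (Vec.lookup-replicate i _)) (((λ ()) ∷ []) ∷ [] ∷ [])

barycentricSubdivision : ∀ n → CarriedComplex n (Subset n)
barycentricSubdivision n = record
  { complex = record
    { vertices        = filter nonempty? (subsets n)
    ; vertices-unique = Unique.filter⁺ nonempty? (subsets-unique n)
    ; Face            = AllPairs Comparable
    ; face?           = allPairs? λ F G → (F ⊆? G) ⊎-dec (G ⊆? F)
    ; []-face         = []
    ; vertex-face     = λ _ → [] ∷ []
    ; face-⊑          = AllPairs-resp-⊑
    }
  ; carrier    = ⋃
  ; carrier-[] = ≡.refl
  ; carrier-⊑  = λ τ _ → ⋃-mono-⊑ τ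
  }

------------------------------------------------------------------------
-- Ordered fields

-- Real numbers enter the geometry only through the structure of an ordered
-- field, so everything below is stated over an arbitrary one; ℝ is the case
-- of interest.  The inverse is a total function, its value at 0# is
-- irrelevant.

record OrderedField (c ℓ₁ ℓ₂ : Level) : Set (lsuc (c ⊔ ℓ₁ ⊔ ℓ₂)) where
  infix  4 _<_
  infixl 9 _⁻¹
  field
    commutativeRing : CommutativeRing c ℓ₁
  open CommutativeRing commutativeRing public hiding (zero)
  field
    _<_                : Rel Carrier ℓ₂
    isStrictTotalOrder : IsStrictTotalOrder _≈_ _<_
    _⁻¹                : Carrier → Carrier
    ⁻¹-inverseʳ        : ∀ x → ¬ x ≈ 0# → x * x ⁻¹ ≈ 1#
    0<1                : 0# < 1#
    +-monoʳ-<          : ∀ x {y z} → y < z → x + y < x + z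
    *-pos              : ∀ {x y} → 0# < x → 0# < y → 0# < x * y

  open IsStrictTotalOrder isStrictTotalOrder public
    using (<-respʳ-≈; <-respˡ-≈; _<?_; _≟_)
    renaming (trans to <-trans; irrefl to <-irrefl)
  open Relation.Binary.Construct.StrictToNonStrict _≈_ _<_ public using (_≤_)

  open Algebra.Properties.Monoid.Mult +-monoid public
    using () renaming (_×_ to _·_)
  open Algebra.Properties.Semiring.Sum semiring public
    using (sum; sum-syntax)

  -- The embedding ℤ → K.
  ι : ℤ → Carrier
  ι (+ k)    = k · 1#
  ι -[1+ k ] = - (suc k · 1#)

module OrderedFieldProperties {c ℓ₁ ℓ₂ : Level} (K : OrderedField c ℓ₁ ℓ₂) where
  open OrderedField K
  open Algebra.Properties.Monoid.Mult +-monoid public using (×-homo-+)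
  open Algebra.Properties.Ring ring public
    using (-0#≈0#; -‿involutive; -‿distribˡ-*; -‿distribʳ-*; -‿+-comm; +-cancelʳ)
  open Algebra.Properties.Semiring.Sum semiring public
    using (sum-cong-≋; ∑-distrib-+; *-distribˡ-sum; *-distribʳ-sum; sum-replicate-zero)
  open Algebra.Solver.Ring.NaturalCoefficients.Default commutativeSemiring public
    using (solve; _:+_; _:*_; _:=_; con)
  module ≤ = Relation.Binary.Construct.StrictToNonStrict _≈_ _<_
  open import Relation.Binary.Reasoning.Setoid setoid public

  private
    variable
      x y u v : Carrier

  ≤-refl : x ≤ x
  ≤-refl = inj₂ refl

  ≤-trans : x ≤ y → y ≤ u → x ≤ u
  ≤-trans = ≤.trans isEquivalence (IsStrictTotalOrder.<-resp-≈ isStrictTotalOrder) <-trans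

  ≤-respʳ-≈ : y ≈ u → x ≤ y → x ≤ u
  ≤-respʳ-≈ = ≤.≤-respʳ-≈ trans <-respʳ-≈

  ≤-respˡ-≈ : x ≈ u → x ≤ y → u ≤ y
  ≤-respˡ-≈ = ≤.≤-respˡ-≈ sym trans <-respˡ-≈

  <⇒≱ : x < y → ¬ y ≤ x
  <⇒≱ x<y (inj₁ y<x) = <-irrefl refl (<-trans x<y y<x)
  <⇒≱ x<y (inj₂ y≈x) = <-irrefl (sym y≈x) x<y

  +-monoʳ-≤ : ∀ x → y ≤ u → x + y ≤ x + u
  +-monoʳ-≤ x (inj₁ y<u) = inj₁ (+-monoʳ-< x y<u)
  +-monoʳ-≤ x (inj₂ y≈u) = inj₂ (+-congˡ y≈u)

  +-mono-≤ : x ≤ y → u ≤ v → x + u ≤ y + v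
  +-mono-≤ {x} {y} {u} {v} x≤y u≤v =
    ≤-trans (+-monoʳ-≤ x u≤v)
            (≤-respˡ-≈ (+-comm v x) (≤-respʳ-≈ (+-comm v y) (+-monoʳ-≤ v x≤y)))

  +-nonneg : 0# ≤ x → 0# ≤ y → 0# ≤ x + y
  +-nonneg 0≤x 0≤y = ≤-respˡ-≈ (+-identityˡ 0#) (+-mono-≤ 0≤x 0≤y)

  x≤x+y : ∀ x → 0# ≤ y → x ≤ x + y
  x≤x+y x 0≤y = ≤-respˡ-≈ (+-identityʳ x) (+-monoʳ-≤ x 0≤y)

  x+[y-x]≈y : ∀ x y → x + (y - x) ≈ y
  x+[y-x]≈y x y = begin
    x + (y - x)  ≈⟨ +-congˡ (+-comm y (- x)) ⟩
    x + (- x + y) ≈⟨ +-assoc x (- x) y ⟨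
    x - x + y    ≈⟨ +-congʳ (-‿inverseʳ x) ⟩
    0# + y       ≈⟨ +-identityˡ y ⟩
    y            ∎

  x≤y⇒0≤y-x : x ≤ y → 0# ≤ y - x
  x≤y⇒0≤y-x {x} {y} x≤y =
    ≤-respˡ-≈ (-‿inverseˡ x) (≤-respʳ-≈ (+-comm (- x) y) (+-monoʳ-≤ (- x) x≤y))

  *-nonneg : 0# ≤ x → 0# ≤ y → 0# ≤ x * y
  *-nonneg (inj₁ 0<x) (inj₁ 0<y) = inj₁ (*-pos 0<x 0<y)
  *-nonneg {x} (inj₁ _)   (inj₂ 0≈y) = inj₂ (trans (sym (zeroʳ x)) (*-congˡ 0≈y))
  *-nonneg {x} {y} (inj₂ 0≈x) _  = inj₂ (trans (sym (zeroˡ y)) (*-congʳ 0≈x))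

  *-monoˡ-≤ : 0# ≤ x → y ≤ u → x * y ≤ x * u
  *-monoˡ-≤ {x} {y} {u} 0≤x y≤u = ≤-respʳ-≈ eq (x≤x+y (x * y) (*-nonneg 0≤x (x≤y⇒0≤y-x y≤u)))
    where
    eq : x * y + x * (u - y) ≈ x * u
    eq = trans (sym (distribˡ x y (u - y))) (*-congˡ (x+[y-x]≈y y u))

  ·1-nonneg : ∀ k → 0# ≤ k · 1#
  ·1-nonneg zero    = ≤-refl
  ·1-nonneg (suc k) = +-nonneg (inj₁ 0<1) (·1-nonneg k)

  ·1-pos : ∀ k .{{_ : NonZero k}} → 0# < k · 1#
  ·1-pos (suc k) = ≤.<-≤-trans <-trans <-respʳ-≈ 0<1 (x≤x+y 1# (·1-nonneg k))

  ·1≉0 : ∀ k .{{_ : NonZero k}} → ¬ k · 1# ≈ 0#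
  ·1≉0 k k≈0 = <-irrefl (sym k≈0) (·1-pos k)

  ·1-cancel-≤ : ∀ j k → j · 1# ≤ k · 1# → j ℕ.≤ k
  ·1-cancel-≤ j k j≤k with j ℕ.≤? k
  ... | yes j≤k′ = j≤k′
  ... | no  j≰k  = contradiction j≤k (<⇒≱ k<j)
    where
    k<j : k · 1# < j · 1#
    k<j = ≡.subst (λ l → k · 1# < l · 1#) (ℕ.m+[n∸m]≡n (ℕ.<⇒≤ (ℕ.≰⇒> j≰k)))
      (<-respʳ-≈ (sym (×-homo-+ 1# k (j ∸ k)))
        (<-respˡ-≈ (+-identityʳ (k · 1#))
          (+-monoʳ-< (k · 1#) (·1-pos (j ∸ k) {{ℕ.>-nonZero (ℕ.m<n⇒0<n∸m (ℕ.≰⇒> j≰k))}}))))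

  -x≤x : 0# ≤ x → - x ≤ x
  -x≤x {x} 0≤x = ≤-trans (≤-respˡ-≈ (+-identityʳ (- x)) (≤-respʳ-≈ (-‿inverseˡ x) (+-monoʳ-≤ (- x) 0≤x))) 0≤x

  ι≤∣∣ : ∀ a → ι a ≤ ℤ.∣ a ∣ · 1#
  ι≤∣∣ (+ k)    = ≤-refl
  ι≤∣∣ -[1+ k ] = -x≤x (·1-nonneg (suc k))

  -ι≤∣∣ : ∀ a → - ι a ≤ ℤ.∣ a ∣ · 1#
  -ι≤∣∣ (+ k)    = -x≤x (·1-nonneg k)
  -ι≤∣∣ -[1+ k ] = ≤-respˡ-≈ (sym (-‿involutive _)) ≤-refl

  sum-nonneg : (a : Vector Carrier n) → (∀ i → 0# ≤ a i) → 0# ≤ sum a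
  sum-nonneg {zero}  a h = ≤-refl
  sum-nonneg {suc n} a h = +-nonneg (h zero) (sum-nonneg (tail a) (h ∘ suc))

  -‿sum : (a : Vector Carrier n) → - sum a ≈ ∑[ i < n ] (- a i)
  -‿sum {zero}  a = -0#≈0#
  -‿sum {suc n} a = trans (sym (-‿+-comm (a zero) (sum (tail a)))) (+-congˡ (-‿sum (tail a)))

  ∑ℕ : Vector ℕ n → ℕ
  ∑ℕ = Algebra.Properties.CommutativeMonoid.Sum.sum ℕ.+-0-commutativeMonoid

  private
    sum-≤ : (μ a : Vector Carrier n) (b : Vector ℕ n) →
            (∀ i → 0# < μ i × μ i < 1#) → (∀ i → a i ≤ b i · 1#) →
            ∑[ i < n ] (μ i * a i) ≤ ∑ℕ b · 1#
    sum-≤ {zero}  μ a b 0<λ<1 a≤b = ≤-refl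
    sum-≤ {suc n} μ a b 0<λ<1 a≤b = ≤-respʳ-≈ (sym (×-homo-+ 1# (b zero) (∑ℕ (tail b))))
      (+-mono-≤ (≤-trans (*-monoˡ-≤ (inj₁ (proj₁ (0<λ<1 zero))) (a≤b zero)) λb≤b)
                (sum-≤ (tail μ) (tail a) (tail b) (0<λ<1 ∘ suc) (a≤b ∘ suc)))
      where
      λb≤b : μ zero * (b zero · 1#) ≤ b zero · 1#
      λb≤b = ≤-respˡ-≈ (*-comm _ _) (≤-respʳ-≈ (*-identityʳ _)
               (*-monoˡ-≤ (·1-nonneg (b zero)) (inj₁ (proj₂ (0<λ<1 zero)))))

  ∣∣-bound : (μ : Vector Carrier n) (a : Vector ℤ n) (x : ℤ) →
             (∀ i → 0# < μ i × μ i < 1#) → ι x ≈ ∑[ i < n ] (μ i * ι (a i)) →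
             ℤ.∣ x ∣ ℕ.≤ ∑ℕ (ℤ.∣_∣ ∘ a)
  ∣∣-bound μ a (+ k) 0<λ<1 eq = ·1-cancel-≤ k _
    (≤-respˡ-≈ (sym eq) (sum-≤ μ (ι ∘ a) _ 0<λ<1 (ι≤∣∣ ∘ a)))
  ∣∣-bound μ a -[1+ k ] 0<λ<1 eq = ·1-cancel-≤ (suc k) _
    (≤-respˡ-≈ (sym eq′) (sum-≤ μ (-_ ∘ ι ∘ a) _ 0<λ<1 (-ι≤∣∣ ∘ a)))
    where
    eq′ : suc k · 1# ≈ ∑[ i < _ ] (μ i * - ι (a i))
    eq′ = begin
      suc k · 1#                   ≈⟨ -‿involutive _ ⟨
      - - (suc k · 1#)             ≈⟨ -‿cong eq ⟩
      - sum (λ i → μ i * ι (a i)) ≈⟨ -‿sum (λ i → μ i * ι (a i)) ⟩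
      sum (λ i → - (μ i * ι (a i))) ≈⟨ sum-cong-≋ (λ i → -‿distribʳ-* (μ i) (ι (a i))) ⟩
      sum (λ i → μ i * - ι (a i)) ∎

  -- Linear systems over K are decidable, by Gaussian elimination.

  Solvable : ∀ {n p} → (Fin n → Vector Carrier p) → Vector Carrier p → Set (c ⊔ ℓ₁)
  Solvable {n} {p} w x = ∃ λ (μ : Vector Carrier n) → ∀ (l : Fin p) → ∑[ i < n ] (μ i * w i l) ≈ x l

  solvable? : ∀ {n p} (w : Fin n → Vector Carrier p) (x : Vector Carrier p) → Dec (Solvable w x)
  solvable? {zero}  w x = map′ (λ 0≈x → (λ ()) , 0≈x) proj₂ (Fin.all? λ l → 0# ≟ x l)
  solvable? {suc n} {p} w x with Fin.any? (λ l → ¬? (w zero l ≟ 0#))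
  ... | no w₀≈0 = map′ from to (solvable? (tail w) x)
    where
    w₀l≈0 : ∀ l → w zero l ≈ 0#
    w₀l≈0 l with w zero l ≟ 0#
    ... | yes eq = eq
    ... | no neq = contradiction (l , neq) w₀≈0

    drop₀ : ∀ (μ : Vector Carrier (suc n)) l →
            ∑[ i < suc n ] (μ i * w i l) ≈ ∑[ i < n ] (μ (suc i) * w (suc i) l)
    drop₀ μ l = trans (+-congʳ (trans (*-congˡ (w₀l≈0 l)) (zeroʳ _))) (+-identityˡ _)

    from : Solvable (tail w) x → Solvable w x
    from (μ , eq) = 0#∷μ , λ l → trans (drop₀ 0#∷μ l) (eq l)
      where
      0#∷μ : Vector Carrier (suc n)
      0#∷μ zero    = 0#
      0#∷μ (suc i) = μ i

    to : Solvable w x → Solvable (tail w) x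
    to (μ , eq) = tail μ , λ l → trans (sym (drop₀ μ l)) (eq l)
  ... | yes (j , w₀j≉0) = map′ from to (solvable? w′ x′)
    where
    b ν : Carrier
    b = w zero j
    ν = b ⁻¹

    bν≈1 : b * ν ≈ 1#
    bν≈1 = ⁻¹-inverseʳ b w₀j≉0

    e : Vector Carrier p
    e l = - (ν * w zero l)

    w′ : Fin n → Vector Carrier p
    w′ i l = w (suc i) l + w (suc i) j * e l

    x′ : Vector Carrier p
    x′ l = x l + x j * e l

    w₀+be≈0 : ∀ l → w zero l + b * e l ≈ 0#
    w₀+be≈0 l = begin
      w zero l + b * e l               ≈⟨ +-congˡ (-‿distribʳ-* b (ν * w zero l)) ⟨
      w zero l - b * (ν * w zero l)    ≈⟨ +-congˡ (-‿cong (*-assoc b ν _)) ⟨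
      w zero l - b * ν * w zero l      ≈⟨ +-congˡ (-‿cong (*-congʳ bν≈1)) ⟩
      w zero l - 1# * w zero l         ≈⟨ +-congˡ (-‿cong (*-identityˡ _)) ⟩
      w zero l - w zero l              ≈⟨ -‿inverseʳ _ ⟩
      0#                               ∎

    ∑w : Vector Carrier n → Vector Carrier p
    ∑w μ l = ∑[ i < n ] (μ i * w (suc i) l)

    ∑w′ : ∀ μ l → ∑[ i < n ] (μ i * w′ i l) ≈ ∑w μ l + ∑w μ j * e l
    ∑w′ μ l = begin
      sum (λ i → μ i * w′ i l)
        ≈⟨ sum-cong-≋ (λ i → solve 4 (λ a b c d → a :* (b :+ c :* d) := a :* b :+ a :* c :* d)
                                refl (μ i) (w (suc i) l) (w (suc i) j) (e l)) ⟩
      sum (λ i → μ i * w (suc i) l + μ i * w (suc i) j * e l)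
        ≈⟨ ∑-distrib-+ (λ i → μ i * w (suc i) l) (λ i → μ i * w (suc i) j * e l) ⟩
      ∑w μ l + sum (λ i → μ i * w (suc i) j * e l)
        ≈⟨ +-congˡ (*-distribʳ-sum (e l) (λ i → μ i * w (suc i) j)) ⟨
      ∑w μ l + ∑w μ j * e l ∎

    to : Solvable w x → Solvable w′ x′
    to (μ , eq) = tail μ , λ l → begin
      sum (λ i → μ (suc i) * w′ i l)     ≈⟨ ∑w′ (tail μ) l ⟩
      ∑w (tail μ) l + ∑w (tail μ) j * e l ≈⟨ +-identityˡ _ ⟨
      0# + (∑w (tail μ) l + ∑w (tail μ) j * e l)
        ≈⟨ +-congʳ (trans (*-congˡ (w₀+be≈0 l)) (zeroʳ (μ zero))) ⟨
      μ zero * (w zero l + b * e l) + (∑w (tail μ) l + ∑w (tail μ) j * e l)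
        ≈⟨ solve 6 (λ m a b e s t → m :* (a :+ b :* e) :+ (s :+ t :* e)
                                  := (m :* a :+ s) :+ (m :* b :+ t) :* e)
             refl (μ zero) (w zero l) b (e l) (∑w (tail μ) l) (∑w (tail μ) j) ⟩
      (μ zero * w zero l + ∑w (tail μ) l) + (μ zero * b + ∑w (tail μ) j) * e l
        ≈⟨ +-cong (eq l) (*-congʳ (eq j)) ⟩
      x′ l ∎

    from : Solvable w′ x′ → Solvable w x
    from (μ , eq) = D*ν∷μ , λ l → +-cancelʳ (x j * e l) _ _ (begin
      D * ν * w zero l + ∑w μ l + x j * e l
        ≈⟨ +-congˡ (*-congʳ (x+[y-x]≈y (∑w μ j) (x j))) ⟨
      D * ν * w zero l + ∑w μ l + (∑w μ j + D) * e l
        ≈⟨ solve 6 (λ d v a s t e → d :* v :* a :+ s :+ (t :+ d) :* e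
                                  := d :* (v :* a :+ e) :+ (s :+ t :* e))
             refl D ν (w zero l) (∑w μ l) (∑w μ j) (e l) ⟩
      D * (ν * w zero l + e l) + (∑w μ l + ∑w μ j * e l)
        ≈⟨ +-congʳ (trans (*-congˡ (-‿inverseʳ _)) (zeroʳ D)) ⟩
      0# + (∑w μ l + ∑w μ j * e l) ≈⟨ +-identityˡ _ ⟩
      ∑w μ l + ∑w μ j * e l        ≈⟨ ∑w′ μ l ⟨
      sum (λ i → μ i * w′ i l)     ≈⟨ eq l ⟩
      x′ l                         ∎)
      where
      D : Carrier
      D = x j - ∑w μ j

      D*ν∷μ : Vector Carrier (suc n)
      D*ν∷μ zero    = D * ν
      D*ν∷μ (suc i) = μ i

------------------------------------------------------------------------
-- Lattice simplices and local h*-polynomials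

range : ℕ → List ℤ
range b = map +_ (upTo (suc b)) ++ map -[1+_] (upTo b)

∈-range : ∀ b x → ℤ.∣ x ∣ ℕ.≤ b → x ∈ range b
∈-range b (+ k)    k≤b = ∈-++⁺ˡ (∈-map⁺ +_ (∈-upTo⁺ (s≤s k≤b)))
∈-range b -[1+ k ] k<b = ∈-++⁺ʳ (map +_ (upTo (suc b))) (∈-map⁺ -[1+_] (∈-upTo⁺ k<b))

range-unique : ∀ b → Unique (range b)
range-unique b = Unique.++⁺
  (Unique.map⁺ ℤ.+-injective (Unique.upTo⁺ (suc b)))
  (Unique.map⁺ ℤ.-[1+-injective (Unique.upTo⁺ b))
  λ { (x∈₁ , x∈₂) → case ∈-map⁻ +_ x∈₁ , ∈-map⁻ -[1+_] x∈₂ of λ { ((_ , _ , ≡.refl) , (_ , _ , ())) } }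

module _ {c ℓ₁ ℓ₂ : Level} (K : OrderedField c ℓ₁ ℓ₂) where
  open OrderedField K
  open OrderedFieldProperties K

  -- A lattice d-simplex in K^m.
  record LatticeSimplex (m d : ℕ) : Set (c ⊔ ℓ₁) where
    field
      vertex              : Fin (suc d) → Vector ℤ m
      affinelyIndependent :
        (μ : Vector Carrier (suc d)) →
        (∀ j → ∑[ i < suc d ] (μ i * ι (vertex i j)) ≈ 0#) →
        ∑[ i < suc d ] μ i ≈ 0# →
        ∀ i → μ i ≈ 0#

  open LatticeSimplex

  InConvexHull : LatticeSimplex m d → Vector Carrier m → Set (c ⊔ ℓ₁ ⊔ ℓ₂)
  InConvexHull {d = d} Δ x =
    ∃ λ (μ : Vector Carrier (suc d)) →
      (∀ i → 0# ≤ μ i) ×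
      ∑[ i < suc d ] μ i ≈ 1# ×
      (∀ j → x j ≈ ∑[ i < suc d ] (μ i * ι (vertex Δ i j)))

  -- The lattice points of the open parallelepiped Π°.  A point of ℤ^{m+1} is
  -- written (y , t) with y its first m coordinates and t the last one.
  InΠ° : LatticeSimplex m d → Vec ℤ m × ℤ → Set (c ⊔ ℓ₁ ⊔ ℓ₂)
  InΠ° {d = d} Δ (y , t) =
    ∃ λ (μ : Vector Carrier (suc d)) →
      (∀ i → 0# < μ i × μ i < 1#) ×
      (∀ j → ι (lookup y j) ≈ ∑[ i < suc d ] (μ i * ι (vertex Δ i j))) ×
      ι t ≈ ∑[ i < suc d ] μ i

  inΠ°? : (Δ : LatticeSimplex m d) → Decidable (InΠ° Δ)
  inΠ°? {m} {d} Δ (y , t) with solvable? w x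
    where
    w : Fin (suc d) → Vector Carrier (suc m)
    w i zero    = 1#
    w i (suc j) = ι (vertex Δ i j)

    x : Vector Carrier (suc m)
    x zero    = ι t
    x (suc j) = ι (lookup y j)
  ... | no ∄μ = no λ { (μ , _ , eqs , eq) → ∄μ (μ , λ
    { zero    → trans (sum-cong-≋ (λ i → *-identityʳ (μ i))) (sym eq)
    ; (suc j) → sym (eqs j)
    }) }
  ... | yes (μ , eqs) = map′
    (λ 0<μ<1 → μ , 0<μ<1 , (λ j → sym (eqs (suc j))) , sym eq₀)
    (λ { (ν , 0<ν<1 , eqs′ , eq′) i → let ν≈μ = uniq ν eqs′ eq′ i in
       <-respʳ-≈ ν≈μ (proj₁ (0<ν<1 i)) , <-respˡ-≈ ν≈μ (proj₂ (0<ν<1 i)) })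
    (Fin.all? λ i → (0# <? μ i) ×-dec (μ i <? 1#))
    where
    eq₀ : sum μ ≈ ι t
    eq₀ = trans (sum-cong-≋ (λ i → sym (*-identityʳ (μ i)))) (eqs zero)

    a-b≈0 : ∀ {a b} → a ≈ b → a - b ≈ 0#
    a-b≈0 {b = b} a≈b = trans (+-congʳ a≈b) (-‿inverseʳ b)

    ∑-sub : (a b : Vector Carrier (suc d)) → ∑[ i < suc d ] (a i - b i) ≈ sum a - sum b
    ∑-sub a b = trans (∑-distrib-+ a (-_ ∘ b)) (+-congˡ (sym (-‿sum b)))

    uniq : (ν : Vector Carrier (suc d)) →
           (∀ j → ι (lookup y j) ≈ ∑[ i < suc d ] (ν i * ι (vertex Δ i j))) →
           ι t ≈ sum ν → ∀ i → ν i ≈ μ i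
    uniq ν eqs′ eq′ i = begin
      ν i                  ≈⟨ x+[y-x]≈y (μ i) (ν i) ⟨
      μ i + (ν i - μ i)    ≈⟨ +-congˡ (affinelyIndependent Δ (λ i → ν i - μ i) h₁ h₀ i) ⟩
      μ i + 0#             ≈⟨ +-identityʳ (μ i) ⟩
      μ i                  ∎
      where
      h₀ : ∑[ i < suc d ] (ν i - μ i) ≈ 0#
      h₀ = trans (∑-sub ν μ) (a-b≈0 (trans (sym eq′) (sym eq₀)))

      h₁ : ∀ j → ∑[ i < suc d ] ((ν i - μ i) * ι (vertex Δ i j)) ≈ 0#
      h₁ j = trans
        (sum-cong-≋ λ i → trans (distribʳ (v i) (ν i) (- μ i)) (+-congˡ (sym (-‿distribˡ-* (μ i) (v i)))))
        (trans (∑-sub (λ i → ν i * v i) (λ i → μ i * v i))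
               (a-b≈0 (trans (sym (eqs′ j)) (sym (eqs (suc j))))))
        where
        v : Vector Carrier (suc d)
        v i = ι (vertex Δ i j)

  -- A box containing Π°: the coordinates of a point of Π° are bounded by the
  -- sums of the absolute values of those of the generators, as 0 < μ i < 1.
  sides : LatticeSimplex m d → Vec (List ℤ) m
  sides Δ = Vec.tabulate λ j → range (∑ℕ λ i → ℤ.∣ vertex Δ i j ∣)

  box : LatticeSimplex m d → List (Vec ℤ m × ℤ)
  box {d = d} Δ = cartesianProduct (choices (sides Δ)) (range (∑ℕ {suc d} λ _ → 1))

  latticePoints : LatticeSimplex m d → List (Vec ℤ m × ℤ)
  latticePoints Δ = filter (inΠ°? Δ) (box Δ)

  latticePoints-unique : (Δ : LatticeSimplex m d) → Unique (latticePoints Δ)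
  latticePoints-unique {m} {d} Δ = Unique.filter⁺ (inΠ°? Δ) {xs = box Δ} (Unique.cartesianProduct⁺
    (choices-unique (sides Δ) λ j →
       ≡.subst Unique (≡.sym (Vec.lookup∘tabulate (λ j → range (∑ℕ λ i → ℤ.∣ vertex Δ i j ∣)) j))
         (range-unique (∑ℕ λ i → ℤ.∣ vertex Δ i j ∣)))
    (range-unique (∑ℕ {suc d} λ _ → 1)))

  ∈-latticePoints : (Δ : LatticeSimplex m d) → ∀ x → x ∈ latticePoints Δ ⇔ InΠ° Δ x
  ∈-latticePoints {m} {d} Δ x@(y , t) = mk⇔
    (λ x∈ → proj₂ (∈-filter⁻ (inΠ°? Δ) {xs = box Δ} x∈))
    (λ x∈Π° → ∈-filter⁺ (inΠ°? Δ) (∈-box x∈Π°) x∈Π°)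
    where
    ∈-box : InΠ° Δ x → x ∈ box Δ
    ∈-box (μ , 0<μ<1 , eqs , eq) = ∈-cartesianProduct⁺
      (∈-choices (sides Δ) y λ j →
        ≡.subst (lookup y j ∈_) (≡.sym (Vec.lookup∘tabulate (λ j → range (∑ℕ λ i → ℤ.∣ vertex Δ i j ∣)) j))
          (∈-range (∑ℕ λ i → ℤ.∣ vertex Δ i j ∣) (lookup y j)
            (∣∣-bound μ (λ i → vertex Δ i j) (lookup y j) 0<μ<1 (eqs j))))
      (∈-range (∑ℕ {suc d} λ _ → 1) t (∣∣-bound μ (λ _ → 1ℤ) t 0<μ<1 (trans eq
        (sum-cong-≋ λ i → sym (trans (*-congˡ (+-identityʳ 1#)) (*-identityʳ (μ i)))))))

  -- On Π° the last coordinate t is positive, so that ∣ t ∣ is t itself.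
  ℓ* : LatticeSimplex m d → Poly
  ℓ* Δ = ∑ₚ (latticePoints Δ) λ x → z ^ₚ ℤ.∣ proj₂ x ∣

  ----------------------------------------------------------------------
  -- Lecture hall simplices

  -- The points of P_m^s, as a subset of K^m.
  InLectureHall : Vector ℕ m → Vector Carrier m → Set (ℓ₁ ⊔ ℓ₂)
  InLectureHall s x =
    (∀ i → 0# ≤ x i / s i) ×
    (∀ i j → i Fin.≤ j → x i / s i ≤ x j / s j) ×
    (∀ i → x i / s i ≤ 1#)
    where
    infixl 7 _/_
    _/_ : Carrier → ℕ → Carrier
    a / k = a * ι (+ k) ⁻¹

  -- The vertices of P_m^s are v^(k) = (0,…,0,s_{k+1},…,s_m), k = 0,…,m.
  lectureHallVertex : Vector ℕ m → Fin (suc m) → Vector ℤ m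
  lectureHallVertex s zero    j       = + s j
  lectureHallVertex s (suc k) zero    = 0ℤ
  lectureHallVertex s (suc k) (suc j) = lectureHallVertex (tail s) k j

  -- partialSum μ j = μ_0 + … + μ_j.
  partialSum : Vector Carrier (suc m) → Vector Carrier m
  partialSum μ zero    = μ zero
  partialSum μ (suc j) = μ zero + partialSum (tail μ) j

  ∑-lectureHallVertex : (s : Vector ℕ m) (μ : Vector Carrier (suc m)) (j : Fin m) →
    ∑[ i < suc m ] (μ i * ι (lectureHallVertex s i j)) ≈ partialSum μ j * ι (+ s j)
  ∑-lectureHallVertex {suc m} s μ zero = trans
    (+-congˡ (trans (sum-cong-≋ λ i → zeroʳ (μ (suc i))) (sum-replicate-zero (suc m))))
    (+-identityʳ _)
  ∑-lectureHallVertex {suc m} s μ (suc j) = trans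
    (+-congˡ (∑-lectureHallVertex (tail s) (tail μ) j))
    (sym (distribʳ _ (μ zero) (partialSum (tail μ) j)))

  partialSum≈0 : (μ : Vector Carrier (suc m)) →
    (∀ j → partialSum μ j ≈ 0#) → sum μ ≈ 0# → ∀ i → μ i ≈ 0#
  partialSum≈0 {zero}  μ ps≈0 s≈0 zero    = trans (sym (+-identityʳ _)) s≈0
  partialSum≈0 {suc m} μ ps≈0 s≈0 zero    = ps≈0 zero
  partialSum≈0 {suc m} μ ps≈0 s≈0 (suc i) =
    partialSum≈0 (tail μ) (λ j → drop₀ (ps≈0 (suc j))) (drop₀ s≈0) i
    where
    drop₀ : ∀ {a} → μ zero + a ≈ 0# → a ≈ 0#
    drop₀ {a} eq = trans (sym (+-identityˡ a)) (trans (+-congʳ (sym (ps≈0 zero))) eq)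

  *⁻¹-cancel : ∀ a k → .{{_ : NonZero k}} → a * ι (+ k) * ι (+ k) ⁻¹ ≈ a
  *⁻¹-cancel a k = trans (*-assoc a _ _)
    (trans (*-congˡ (⁻¹-inverseʳ _ (·1≉0 k))) (*-identityʳ a))

  lectureHallSimplex : (s : Vector ℕ m) → (∀ i → NonZero (s i)) → LatticeSimplex m m
  lectureHallSimplex s s≢0 = record
    { vertex              = lectureHallVertex s
    ; affinelyIndependent = λ μ eqs eq → partialSum≈0 μ
        (λ j → trans (sym (*⁻¹-cancel (partialSum μ j) (s j) {{s≢0 j}}))
          (trans (*-congʳ (trans (sym (∑-lectureHallVertex s μ j)) (eqs j))) (zeroˡ _)))
        eq
    }

  private
    partialSum-nonneg : (μ : Vector Carrier (suc m)) → (∀ i → 0# ≤ μ i) →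
                        ∀ j → 0# ≤ partialSum μ j
    partialSum-nonneg μ 0≤μ zero    = 0≤μ zero
    partialSum-nonneg μ 0≤μ (suc j) = +-nonneg (0≤μ zero) (partialSum-nonneg (tail μ) (0≤μ ∘ suc) j)

    partialSum-≤ : (μ : Vector Carrier (suc m)) → (∀ i → 0# ≤ μ i) →
                   ∀ i j → i Fin.≤ j → partialSum μ i ≤ partialSum μ j
    partialSum-≤ μ 0≤μ zero    zero    _         = ≤-refl
    partialSum-≤ μ 0≤μ zero    (suc j) _         =
      x≤x+y (μ zero) (partialSum-nonneg (tail μ) (0≤μ ∘ suc) j)
    partialSum-≤ μ 0≤μ (suc i) (suc j) (s≤s i≤j) =
      +-monoʳ-≤ (μ zero) (partialSum-≤ (tail μ) (0≤μ ∘ suc) i j i≤j)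

    partialSum-≤-sum : (μ : Vector Carrier (suc m)) → (∀ i → 0# ≤ μ i) →
                       ∀ j → partialSum μ j ≤ sum μ
    partialSum-≤-sum μ 0≤μ zero    = x≤x+y (μ zero) (sum-nonneg (tail μ) (0≤μ ∘ suc))
    partialSum-≤-sum μ 0≤μ (suc j) = +-monoʳ-≤ (μ zero) (partialSum-≤-sum (tail μ) (0≤μ ∘ suc) j)

    -- The successive differences of a ≤ q_0 ≤ … ≤ q_{m-1} ≤ 1.
    differences : Carrier → Vector Carrier m → Vector Carrier (suc m)
    differences {zero}  a q zero    = 1# - a
    differences {suc m} a q zero    = q zero - a
    differences {suc m} a q (suc i) = differences (q zero) (tail q) i

    partialSum-differences : ∀ a (q : Vector Carrier m) j → a + partialSum (differences a q) j ≈ q j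
    partialSum-differences {suc m} a q zero    = x+[y-x]≈y a (q zero)
    partialSum-differences {suc m} a q (suc j) = trans (sym (+-assoc a _ _))
      (trans (+-congʳ (x+[y-x]≈y a (q zero))) (partialSum-differences (q zero) (tail q) j))

    sum-differences : ∀ a (q : Vector Carrier m) → a + sum (differences a q) ≈ 1#
    sum-differences {zero}  a q = trans (+-congˡ (+-identityʳ _)) (x+[y-x]≈y a 1#)
    sum-differences {suc m} a q = trans (sym (+-assoc a _ _))
      (trans (+-congʳ (x+[y-x]≈y a (q zero))) (sum-differences (q zero) (tail q)))

    differences-nonneg : ∀ a (q : Vector Carrier m) → a ≤ 1# → (∀ i → a ≤ q i) →
      (∀ i j → i Fin.≤ j → q i ≤ q j) → (∀ i → q i ≤ 1#) → ∀ i → 0# ≤ differences a q i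
    differences-nonneg {zero}  a q a≤1 a≤q mono q≤1 zero    = x≤y⇒0≤y-x a≤1
    differences-nonneg {suc m} a q a≤1 a≤q mono q≤1 zero    = x≤y⇒0≤y-x (a≤q zero)
    differences-nonneg {suc m} a q a≤1 a≤q mono q≤1 (suc i) =
      differences-nonneg (q zero) (tail q) (q≤1 zero) (λ i → mono zero (suc i) z≤n)
        (λ i j i≤j → mono (suc i) (suc j) (s≤s i≤j)) (q≤1 ∘ suc) i

  -- P_m^s is the convex hull of the vertices above.
  lectureHall⇔convexHull : (s : Vector ℕ m) (s≢0 : ∀ i → NonZero (s i)) (x : Vector Carrier m) →
    InLectureHall s x ⇔ InConvexHull (lectureHallSimplex s s≢0) x
  lectureHall⇔convexHull {m} s s≢0 x = mk⇔ to from
    where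
    q : Vector Carrier m
    q j = x j * ι (+ s j) ⁻¹

    qs≈x : ∀ j → q j * ι (+ s j) ≈ x j
    qs≈x j = trans (trans (*-assoc _ _ _) (trans (*-congˡ (*-comm _ _)) (sym (*-assoc _ _ _))))
                   (*⁻¹-cancel (x j) (s j) {{s≢0 j}})

    to : InLectureHall s x → InConvexHull (lectureHallSimplex s s≢0) x
    to (0≤q , mono , q≤1) = differences 0# q
      , differences-nonneg 0# q (inj₁ 0<1) 0≤q mono q≤1
      , trans (sym (+-identityˡ _)) (sum-differences 0# q)
      , λ j → sym (trans (∑-lectureHallVertex s (differences 0# q) j)
          (trans (*-congʳ (trans (sym (+-identityˡ _)) (partialSum-differences 0# q j))) (qs≈x j)))

    from : InConvexHull (lectureHallSimplex s s≢0) x → InLectureHall s x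
    from (μ , 0≤μ , ∑≈1 , eqs) =
        (λ i → ≤-respʳ-≈ (ps≈q i) (partialSum-nonneg μ 0≤μ i))
      , (λ i j i≤j → ≤-respˡ-≈ (ps≈q i) (≤-respʳ-≈ (ps≈q j) (partialSum-≤ μ 0≤μ i j i≤j)))
      , (λ i → ≤-respˡ-≈ (ps≈q i) (≤-respʳ-≈ ∑≈1 (partialSum-≤-sum μ 0≤μ i)))
      where
      ps≈q : ∀ j → partialSum μ j ≈ q j
      ps≈q j = trans (sym (*⁻¹-cancel (partialSum μ j) (s j) {{s≢0 j}}))
        (*-congʳ (sym (trans (eqs j) (∑-lectureHallVertex s μ j))))

  -- The s-derangement polynomial d_m^s.
  sDerangementPoly : (s : Vector ℕ m) → (∀ i → NonZero (s i)) → Poly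
  sDerangementPoly s s≢0 = ℓ* (lectureHallSimplex s s≢0)

-- The sequence (2, 3, …, n) of length n - 1.

2⋯_ : ∀ n → Vector ℕ (n ∸ 1)
(2⋯ n) i = 2 ℕ.+ toℕ i

2⋯-nonZero : ∀ n → (i : Fin (n ∸ 1)) → NonZero ((2⋯ n) i)
2⋯-nonZero n i = _

{-# OPTIONS --safe #-}
module Submission where

-- All three polynomials are the entry W n 0 of one table W, in which row k + 1
-- arises from row k by W (k + 1) b = ∑ W k r ω r b, the weights ω being 1 and z.
--
-- For the derangements, d_n is the permanent of the matrix with entries 1 below,
-- 0 on and z above the diagonal.  The minor deleting row 0 and column c satisfies
-- the recursion of W: expand it along row c, which has lost its diagonal entry.
--
-- For the lattice points, the coordinates of a point of Π°, divided by s, rise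
-- from 0 by steps in (0, 1).  W k b sums z^(number of integers passed) over such
-- sequences of residues with yᵢ modulo i + 1 that end in b modulo k + 1; the last
-- coordinate of the point counts the integers passed altogether.
--
-- For the subdivision, differences of neighbouring entries of W give, on
-- exponential generating functions with y = 1 - z,  w′ + z w = z e^{yx} (w + w′)
-- for w k = W k 0, whence g = e^x w satisfies g = y e^{yx} + z e^{yx} g.  Counting
-- chains by their least member shows that the h-polynomials of the barycentric
-- subdivisions satisfy the same equation, which has a unique solution because y
-- can be cancelled; the alternating sum defining ℓ_V is multiplication by e^{-x}.

open import Defs
open import Algebra.Bundles using (CommutativeRing; CommutativeSemiring)
import Algebra.Definitions.RawMonoid
import Algebra.Properties.AbelianGroup
import Algebra.Properties.CommutativeSemigroup
import Algebra.Properties.Ring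
import Algebra.Properties.Semiring.Exp
import Algebra.Properties.Semiring.Mult
open import Algebra.Structures using (IsCommutativeRing)
open import Data.Bool.Base using (if_then_else_; true; false)
open import Data.Empty using (⊥-elim)
open import Data.Fin.Base as Fin using (Fin; zero; suc; toℕ)
import Data.Fin.Properties as Fin
open import Data.Fin.Subset using (Subset; inside; outside; ∣_∣; ⋃; _⊆_; _⊂_; ⊥)
open import Data.Fin.Subset.Properties
  using (_⊆?_; _⊂?_; nonempty?; ∣⊥∣≡0; ∣p∣≤n; drop-∷-⊆; drop-∷-⊂; out⊆; in⊆in; out⊂; in⊂in; out⊂in;
         p⊆q⇒∣p∣≤∣q∣; ⊆-trans; ⊥⊆; p⊆p∪q; x∈p∪q⁻; ∉⊥)
open import Data.Integer.Base as ℤ using (ℤ; +_; -[1+_]; 0ℤ; 1ℤ; -1ℤ)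
import Data.Integer.Properties as ℤ
open import Data.List.Base
  using (List; []; _∷_; [_]; _++_; map; filter; foldr; length; upTo; applyUpTo; allFin; tabulate;
         concatMap; cartesianProductWith)
open import Data.List.Extrema.Nat using (max≤v⁺; xs≤max)
open import Data.List.Membership.Propositional using (_∈_; find; lose)
open import Data.List.Membership.Propositional.Properties
  using (∈-upTo⁺; ∈-upTo⁻; ∈-filter⁺; ∈-filter⁻; ∈-map⁺; ∈-map⁻; ∈-concatMap⁺; ∈-concatMap⁻)
open import Data.List.Membership.Propositional.Properties.WithK using (unique∧set⇒bag)
import Data.List.Properties as List
open import Data.List.Relation.Binary.BagAndSetEquality using (∼bag⇒↭)
open import Data.List.Relation.Binary.Permutation.Propositional as ↭ using (_↭_)
import Data.List.Relation.Binary.Permutation.Propositional.Properties as ↭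
open import Data.List.Relation.Unary.All as All using (All; []; _∷_)
import Data.List.Relation.Unary.All.Properties as All
open import Data.List.Relation.Unary.AllPairs as AllPairs using (AllPairs; []; _∷_; allPairs?)
import Data.List.Relation.Unary.AllPairs.Properties as AllPairs
open import Data.List.Relation.Unary.Any using (here; there)
open import Data.List.Relation.Unary.Unique.Propositional using (Unique)
import Data.List.Relation.Unary.Unique.Propositional.Properties as Unique
open import Data.Nat.Base as ℕ using (ℕ; zero; suc; _∸_; NonZero; z≤n; s≤s)
open import Data.Nat.Induction using (<-rec)
import Data.Nat.Properties as ℕ
open import Data.Product.Base using (∃; _×_; _,_; proj₁; proj₂)
open import Data.Sum.Base using (inj₁; inj₂)
open import Data.Vec.Base as Vec using (Vec; []; _∷_; lookup)
open import Data.Vec.Functional using (Vector; tail)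
import Data.Vec.Properties as Vec
import Data.Vec.Relation.Unary.All as VecAll
import Data.Vec.Relation.Unary.AllPairs as VecAllPairs
import Data.Vec.Relation.Unary.Unique.Propositional as VecUnique
import Data.Vec.Relation.Unary.Unique.Propositional.Properties as VecUnique
open import Function.Base using (_∘_; id)
open import Function.Bundles using (_⇔_; mk⇔; Equivalence)
open import Function.Construct.Composition using (_⇔-∘_)
open import Function.Construct.Symmetry using (⇔-sym)
open import Function.Definitions using (Injective; Surjective)
open import Level using (Level; _⊔_; 0ℓ)
open import Relation.Binary.Bundles using (Setoid)
open import Relation.Binary.Definitions using (DecidableEquality; tri<; tri≈; tri>)
open import Relation.Binary.PropositionalEquality as ≡ using (_≡_; _≢_)
import Relation.Binary.Reasoning.Setoid
open import Relation.Binary.Structures using (IsEquivalence; IsStrictTotalOrder)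
open import Relation.Nullary using (¬_; Dec; yes; no; does; contradiction)
open import Relation.Nullary.Decidable using (¬?; _×-dec_; _⊎-dec_)
open import Relation.Unary using (Pred; Decidable)

private
  variable
    a b p q : Level
    A : Set a
    B : Set b
    m n : ℕ

-- What the models share is a comparison of neighbouring indices: weight 1 for an increase, z
-- otherwise. The exception `ω 0 0` = 0 is the corner of the diagonal in the derangement matrix, and
-- for lattice points it is the strictness of 0 < μ < 1: from ratio 0 neither 0 nor 1 can be reached
-- in one step. All columns of the table are kept because the recursion for column 0 alone does not
-- close: each of its entries involves the whole preceding row. The subdivision offers no such
-- second index; its recursion runs over face sizes only. The table must therefore be collapsed to
-- its column 0, and this is where generating functions enter. `T` encodes multiplication by e^(ax)
-- through the product rule (e^(ax) f)′ = a e^(ax) f + e^(ax) f′, with `φ ∘ suc` as the derivative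
-- of φ. Hence no binomial coefficient, factorial or division is ever written, and the identities
-- make sense over ℤ[z].

applyUpTo-suc : ∀ n → applyUpTo ℕ.suc n ≡ map ℕ.suc (upTo n)
applyUpTo-suc n = ≡.sym (List.map-upTo ℕ.suc n)

filter-map : {P : Pred B p} (P? : Decidable P) (g : A → B) (xs : List A) →
             filter P? (map g xs) ≡ map g (filter (P? ∘ g) xs)
filter-map P? g []       = ≡.refl
filter-map P? g (x ∷ xs) with does (P? (g x))
... | true  = ≡.cong (g x ∷_) (filter-map P? g xs)
... | false = filter-map P? g xs

-- Finite sums and the binomial transform

module ListSum {c ℓ : Level} (S : CommutativeSemiring c ℓ) where
  open CommutativeSemiring S hiding (zero)
  open Algebra.Properties.CommutativeSemigroup +-commutativeSemigroup using (interchange; x∙yz≈y∙xz)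
  open Relation.Binary.Reasoning.Setoid setoid

  ∑ : List A → (A → Carrier) → Carrier
  ∑ xs f = foldr _+_ 0# (map f xs)

  infixr 8 [_]·_

  [_]·_ : {P : Set p} → Dec P → Carrier → Carrier
  [ P? ]· x = if does P? then x else 0#

  []·-cong : ∀ {q} {P : Set p} {Q : Set q} (P? : Dec P) (Q? : Dec Q) {x y : Carrier} →
             (P → Q) → (Q → P) → (P → x ≈ y) → [ P? ]· x ≈ [ Q? ]· y
  []·-cong (yes p) (yes q) f g x≈y = x≈y p
  []·-cong (yes p) (no ¬q) f g x≈y = contradiction (f p) ¬q
  []·-cong (no ¬p) (yes q) f g x≈y = contradiction (g q) ¬p
  []·-cong (no ¬p) (no ¬q) f g x≈y = refl

  []·-yes : {P : Set p} (P? : Dec P) {x : Carrier} → P → [ P? ]· x ≈ x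
  []·-yes (yes _) p = refl
  []·-yes (no ¬p) p = contradiction p ¬p

  []·-no : {P : Set p} (P? : Dec P) {x : Carrier} → ¬ P → [ P? ]· x ≈ 0#
  []·-no (yes p) ¬p = contradiction p ¬p
  []·-no (no _)  ¬p = refl

  *-[]· : {P : Set p} (P? : Dec P) (x y : Carrier) → x * [ P? ]· y ≈ [ P? ]· (x * y)
  *-[]· (yes _) x y = refl
  *-[]· (no _)  x y = zeroʳ x

  ∑-cong-∈ : (xs : List A) {f g : A → Carrier} → (∀ {x} → x ∈ xs → f x ≈ g x) → ∑ xs f ≈ ∑ xs g
  ∑-cong-∈ []       f≈g = refl
  ∑-cong-∈ (x ∷ xs) f≈g = +-cong (f≈g (here ≡.refl)) (∑-cong-∈ xs (f≈g ∘ there))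

  ∑-cong : (xs : List A) {f g : A → Carrier} → (∀ x → f x ≈ g x) → ∑ xs f ≈ ∑ xs g
  ∑-cong xs f≈g = ∑-cong-∈ xs λ {x} _ → f≈g x

  ∑-zero : (xs : List A) → ∑ xs (λ _ → 0#) ≈ 0#
  ∑-zero []       = refl
  ∑-zero (x ∷ xs) = trans (+-identityˡ _) (∑-zero xs)

  ∑-++ : (xs ys : List A) (f : A → Carrier) → ∑ (xs ++ ys) f ≈ ∑ xs f + ∑ ys f
  ∑-++ []       ys f = sym (+-identityˡ _)
  ∑-++ (x ∷ xs) ys f = trans (+-congˡ (∑-++ xs ys f)) (sym (+-assoc _ _ _))

  ∑-map : (g : A → B) (xs : List A) (f : B → Carrier) → ∑ (map g xs) f ≡ ∑ xs (f ∘ g)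
  ∑-map g xs f = ≡.cong (foldr _+_ 0#) (≡.sym (List.map-∘ xs))

  ∑-concatMap : (g : A → List B) (xs : List A) (f : B → Carrier) →
                ∑ (concatMap g xs) f ≈ ∑ xs (λ x → ∑ (g x) f)
  ∑-concatMap g []       f = refl
  ∑-concatMap g (x ∷ xs) f = trans (∑-++ (g x) (concatMap g xs) f) (+-congˡ (∑-concatMap g xs f))

  ∑-distrib-+ : (xs : List A) (f g : A → Carrier) → ∑ xs (λ x → f x + g x) ≈ ∑ xs f + ∑ xs g
  ∑-distrib-+ []       f g = sym (+-identityˡ 0#)
  ∑-distrib-+ (x ∷ xs) f g = trans (+-congˡ (∑-distrib-+ xs f g)) (interchange _ _ _ _)

  *-distribˡ-∑ : (x : Carrier) (xs : List A) (f : A → Carrier) → x * ∑ xs f ≈ ∑ xs (λ y → x * f y)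
  *-distribˡ-∑ x []       f = zeroʳ x
  *-distribˡ-∑ x (_ ∷ xs) f = trans (distribˡ x _ _) (+-congˡ (*-distribˡ-∑ x xs f))

  *-distribʳ-∑ : (x : Carrier) (xs : List A) (f : A → Carrier) → ∑ xs f * x ≈ ∑ xs (λ y → f y * x)
  *-distribʳ-∑ x xs f = trans (*-comm _ x) (trans (*-distribˡ-∑ x xs f) (∑-cong xs λ _ → *-comm x _))

  ∑-swap : (xs : List A) (ys : List B) (f : A → B → Carrier) →
           ∑ xs (λ x → ∑ ys (f x)) ≈ ∑ ys (λ y → ∑ xs (λ x → f x y))
  ∑-swap []       ys f = sym (∑-zero ys)
  ∑-swap (x ∷ xs) ys f = trans (+-congˡ (∑-swap xs ys f)) (sym (∑-distrib-+ ys (f x) _))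

  ∑-filter : {P : Pred A p} (P? : Decidable P) (xs : List A) (f : A → Carrier) →
             ∑ (filter P? xs) f ≈ ∑ xs (λ x → [ P? x ]· f x)
  ∑-filter P? []       f = refl
  ∑-filter P? (x ∷ xs) f with does (P? x)
  ... | true  = +-congˡ (∑-filter P? xs f)
  ... | false = trans (∑-filter P? xs f) (sym (+-identityˡ _))

  ∑-↭ : {xs ys : List A} (f : A → Carrier) → xs ↭ ys → ∑ xs f ≈ ∑ ys f
  ∑-↭ f ↭.refl          = refl
  ∑-↭ f (↭.prep x σ)    = +-congˡ (∑-↭ f σ)
  ∑-↭ f (↭.swap x y σ)  = trans (x∙yz≈y∙xz _ _ _) (+-congˡ (+-congˡ (∑-↭ f σ)))
  ∑-↭ f (↭.trans σ τ)   = trans (∑-↭ f σ) (∑-↭ f τ)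

  ∑-upTo-suc : ∀ n (f : ℕ → Carrier) → ∑ (upTo (suc n)) f ≈ f 0 + ∑ (upTo n) (f ∘ suc)
  ∑-upTo-suc n f = +-congˡ (reflexive (≡.trans (≡.cong (λ xs → ∑ xs f) (applyUpTo-suc n)) (∑-map suc (upTo n) f)))

  ∑-upTo-+ : ∀ m n (f : ℕ → Carrier) → ∑ (upTo (m ℕ.+ n)) f ≈ ∑ (upTo m) f + ∑ (upTo n) (f ∘ (m ℕ.+_))
  ∑-upTo-+ zero    n f = sym (+-identityˡ _)
  ∑-upTo-+ (suc m) n f = trans (∑-upTo-suc (m ℕ.+ n) f) (trans (+-congˡ (∑-upTo-+ m n (f ∘ suc)))
    (trans (sym (+-assoc _ _ _)) (+-congʳ (sym (∑-upTo-suc m f)))))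

  ∑-upTo-δ : ∀ n {j} (f : ℕ → Carrier) → j ℕ.< n → ∑ (upTo n) (λ i → [ i ℕ.≟ j ]· f i) ≈ f j
  ∑-upTo-δ (suc n) {zero}  f _         = trans (∑-upTo-suc n _)
    (trans (+-congˡ (∑-zero (upTo n))) (+-identityʳ _))
  ∑-upTo-δ (suc n) {suc j} f (s≤s j<n) = trans (∑-upTo-suc n _)
    (trans (+-identityˡ _) (∑-upTo-δ n (f ∘ suc) j<n))

  ∑-cartesianProductWith : ∀ {a b d} {A : Set a} {B : Set b} {D : Set d}
    (g : A → B → D) (xs : List A) (ys : List B) (f : D → Carrier) →
    ∑ (cartesianProductWith g xs ys) f ≈ ∑ xs (λ x → ∑ ys λ y → f (g x y))
  ∑-cartesianProductWith g []       ys f = refl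
  ∑-cartesianProductWith g (x ∷ xs) ys f = trans (∑-++ (map (g x) ys) _ f)
    (+-cong (reflexive (∑-map (g x) ys f)) (∑-cartesianProductWith g xs ys f))

  ∑-[]· : ∀ {a p} {A : Set a} {P : Set p} (P? : Dec P) (xs : List A) (f : A → Carrier) →
          ∑ xs (λ x → [ P? ]· f x) ≈ [ P? ]· ∑ xs f
  ∑-[]· (yes _) xs f = refl
  ∑-[]· (no _)  xs f = ∑-zero xs

  []·-congˡ : ∀ {p} {P : Set p} (P? : Dec P) {x y : Carrier} → x ≈ y → [ P? ]· x ≈ [ P? ]· y
  []·-congˡ P? x≈y = []·-cong P? P? id id λ _ → x≈y

  []·-× : ∀ {p q} {P : Set p} {Q : Set q} (P? : Dec P) (Q? : Dec Q) {x : Carrier} →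
          [ P? ×-dec Q? ]· x ≈ [ P? ]· [ Q? ]· x
  []·-× (yes _) Q? = refl
  []·-× (no _)  Q? = refl

  -- Allows sums with different natural bounds to be compared over a common range.
  ∑-upTo-support : ∀ M N (f : ℕ → Carrier) → (∀ b → ¬ b ℕ.< M → f b ≈ 0#) → M ℕ.≤ N →
                   ∑ (upTo N) f ≈ ∑ (upTo M) f
  ∑-upTo-support M N f f≈0 M≤N = begin
    ∑ (upTo N) f
      ≈⟨ reflexive (≡.cong (λ n → ∑ (upTo n) f) (ℕ.m+[n∸m]≡n M≤N)) ⟨
    ∑ (upTo (M ℕ.+ (N ℕ.∸ M))) f
      ≈⟨ ∑-upTo-+ M (N ℕ.∸ M) f ⟩
    ∑ (upTo M) f + ∑ (upTo (N ℕ.∸ M)) (f ∘ (M ℕ.+_))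
      ≈⟨ +-congˡ (trans (∑-cong (upTo (N ℕ.∸ M)) λ b → f≈0 (M ℕ.+ b) (ℕ.m+n≮m M b))
           (∑-zero (upTo (N ℕ.∸ M)))) ⟩
    ∑ (upTo M) f + 0#
      ≈⟨ +-identityʳ _ ⟩
    ∑ (upTo M) f ∎

-- T a is multiplication by e^{a x} on exponential generating functions.

module BinomialTransform {c ℓ : Level} (S : CommutativeSemiring c ℓ) where
  open CommutativeSemiring S hiding (zero)
  open Algebra.Properties.CommutativeSemigroup +-commutativeSemigroup using (interchange)
  open Algebra.Properties.CommutativeSemigroup *-commutativeSemigroup
    using () renaming (x∙yz≈y∙xz to x*yz≈y*xz)
  open Relation.Binary.Reasoning.Setoid setoid

  T : Carrier → (ℕ → Carrier) → ℕ → Carrier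
  T a φ zero    = φ 0
  T a φ (suc k) = a * T a φ k + T a (φ ∘ suc) k

  T-cong-≤ : ∀ a k {φ ψ : ℕ → Carrier} → (∀ m → m ℕ.≤ k → φ m ≈ ψ m) → T a φ k ≈ T a ψ k
  T-cong-≤ a zero    φ≈ψ = φ≈ψ 0 z≤n
  T-cong-≤ a (suc k) φ≈ψ = +-cong (*-congˡ (T-cong-≤ a k λ m m≤k → φ≈ψ m (ℕ.m≤n⇒m≤1+n m≤k)))
                                  (T-cong-≤ a k λ m m≤k → φ≈ψ (suc m) (s≤s m≤k))

  T-cong : ∀ a k {φ ψ : ℕ → Carrier} → (∀ m → φ m ≈ ψ m) → T a φ k ≈ T a ψ k
  T-cong a k φ≈ψ = T-cong-≤ a k λ m _ → φ≈ψ m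

  T-congˡ : ∀ {a b} k (φ : ℕ → Carrier) → a ≈ b → T a φ k ≈ T b φ k
  T-congˡ zero    φ a≈b = refl
  T-congˡ (suc k) φ a≈b = +-cong (*-cong a≈b (T-congˡ k φ a≈b)) (T-congˡ k (φ ∘ suc) a≈b)

  T-+ : ∀ a k (φ ψ : ℕ → Carrier) → T a (λ m → φ m + ψ m) k ≈ T a φ k + T a ψ k
  T-+ a zero    φ ψ = refl
  T-+ a (suc k) φ ψ = begin
    a * T a (λ m → φ m + ψ m) k + T a (λ m → φ (suc m) + ψ (suc m)) k
      ≈⟨ +-cong (trans (*-congˡ (T-+ a k φ ψ)) (distribˡ a _ _)) (T-+ a k (φ ∘ suc) (ψ ∘ suc)) ⟩
    a * T a φ k + a * T a ψ k + (T a (φ ∘ suc) k + T a (ψ ∘ suc) k)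
      ≈⟨ interchange _ _ _ _ ⟩
    T a φ (suc k) + T a ψ (suc k) ∎

  T-* : ∀ a x k (φ : ℕ → Carrier) → T a (λ m → x * φ m) k ≈ x * T a φ k
  T-* a x zero    φ = refl
  T-* a x (suc k) φ = begin
    a * T a (λ m → x * φ m) k + T a (λ m → x * φ (suc m)) k
      ≈⟨ +-cong (*-congˡ (T-* a x k φ)) (T-* a x k (φ ∘ suc)) ⟩
    a * (x * T a φ k) + x * T a (φ ∘ suc) k
      ≈⟨ +-congʳ (x*yz≈y*xz a x _) ⟩
    x * (a * T a φ k) + x * T a (φ ∘ suc) k
      ≈⟨ distribˡ x _ _ ⟨
    x * T a φ (suc k) ∎

  T-T : ∀ a b k (φ : ℕ → Carrier) → T a (T b φ) k ≈ T (a + b) φ k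
  T-T a b zero    φ = refl
  T-T a b (suc k) φ = begin
    a * T a (T b φ) k + T a (λ m → b * T b φ m + T b (φ ∘ suc) m) k
      ≈⟨ +-congˡ (trans (T-+ a k _ _) (+-congʳ (T-* a b k (T b φ)))) ⟩
    a * T a (T b φ) k + (b * T a (T b φ) k + T a (T b (φ ∘ suc)) k)
      ≈⟨ +-assoc _ _ _ ⟨
    a * T a (T b φ) k + b * T a (T b φ) k + T a (T b (φ ∘ suc)) k
      ≈⟨ +-congʳ (distribʳ _ a b) ⟨
    (a + b) * T a (T b φ) k + T a (T b (φ ∘ suc)) k
      ≈⟨ +-cong (*-congˡ (T-T a b k φ)) (T-T a b k (φ ∘ suc)) ⟩
    T (a + b) φ (suc k) ∎

  T-comm : ∀ a b k (φ : ℕ → Carrier) → T a (T b φ) k ≈ T b (T a φ) k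
  T-comm a b k φ = trans (T-T a b k φ) (trans (T-congˡ k φ (+-comm a b)) (sym (T-T b a k φ)))

  T-0 : ∀ k (φ : ℕ → Carrier) → T 0# φ k ≈ φ k
  T-0 zero    φ = refl
  T-0 (suc k) φ = trans (+-cong (zeroˡ _) (T-0 k (φ ∘ suc))) (+-identityˡ _)

  -- In `T a φ k` the last value φ k has coefficient 1, so T a φ k - φ k depends on the earlier
  -- values only. The semiring has no subtraction, hence the crossed form.
  T-top : ∀ a k {φ ψ : ℕ → Carrier} → (∀ m → m ℕ.< k → φ m ≈ ψ m) →
          T a φ k + ψ k ≈ T a ψ k + φ k
  T-top a zero    φ≈ψ = +-comm _ _
  T-top a (suc k) {φ} {ψ} φ≈ψ = begin
    a * T a φ k + T a (φ ∘ suc) k + ψ (suc k)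
      ≈⟨ +-assoc _ _ _ ⟩
    a * T a φ k + (T a (φ ∘ suc) k + ψ (suc k))
      ≈⟨ +-cong (*-congˡ (T-cong-≤ a k λ m m≤k → φ≈ψ m (s≤s m≤k)))
                (T-top a k λ m m<k → φ≈ψ (suc m) (s≤s m<k)) ⟩
    a * T a ψ k + (T a (ψ ∘ suc) k + φ (suc k))
      ≈⟨ +-assoc _ _ _ ⟨
    T a ψ (suc k) + φ (suc k) ∎

-- The common table

module Table {c ℓ : Level} (S : CommutativeSemiring c ℓ)
  (z : CommutativeSemiring.Carrier S) where
  open CommutativeSemiring S hiding (zero)
  open ListSum S

  -- θ r b is 1 for r < b and z for b ≤ r; ω differs from θ only in ω 0 0 = 0.

  θ : ℕ → ℕ → Carrier
  θ r       zero    = z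
  θ zero    (suc b) = 1#
  θ (suc r) (suc b) = θ r b

  ω : ℕ → ℕ → Carrier
  ω r       (suc b) = θ r (suc b)
  ω zero    zero    = 0#
  ω (suc r) zero    = z

  W : ℕ → ℕ → Carrier
  W zero    b = 1#
  W (suc k) b = ∑ (upTo (suc k)) λ r → W k r * ω r b

  θ-≤ : ∀ {r j} → r ℕ.≤ j → θ r (suc j) ≡ 1#
  θ-≤ {zero}          _         = ≡.refl
  θ-≤ {suc r} {suc j} (s≤s r≤j) = θ-≤ r≤j

  θ-≥ : ∀ {r j} → j ℕ.≤ r → θ r j ≡ z
  θ-≥ {r}     {zero}  _         = ≡.refl
  θ-≥ {suc r} {suc j} (s≤s j≤r) = θ-≥ j≤r

-- The functional equation behind column 0 of the table

module LocalEulerian {c ℓ : Level} (R : CommutativeRing c ℓ)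
  (z y : CommutativeRing.Carrier R)
  (y+z≈1 : CommutativeRing._≈_ R (CommutativeRing._+_ R y z) (CommutativeRing.1# R))
  where
  open CommutativeRing R hiding (zero)
  open Algebra.Properties.Semiring.Exp semiring using (_^_)
  open Algebra.Properties.CommutativeSemigroup +-commutativeSemigroup
    using (xy∙z≈xz∙y)
  open Algebra.Properties.CommutativeSemigroup *-commutativeSemigroup
    using () renaming (x∙yz≈y∙xz to x*yz≈y*xz)
  open Algebra.Properties.Ring ring using (+-cancelʳ)
  open ListSum commutativeSemiring
  open BinomialTransform commutativeSemiring
  open Table commutativeSemiring z
  open Relation.Binary.Reasoning.Setoid setoid

  w : ℕ → Carrier
  w k = W k 0

  y*x+z*x≈x : ∀ x → y * x + z * x ≈ x
  y*x+z*x≈x x = trans (sym (distribʳ x y z)) (trans (*-congʳ y+z≈1) (*-identityˡ x))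

  private
    -- Agrees with row `suc k` of `W` except in column 0. The uniform weight θ makes differences of
    -- adjacent columns single terms, since θ changes from z to 1 in row j only.
    X : ℕ → ℕ → Carrier
    X k b = ∑ (upTo (suc k)) λ r → W k r * θ r b

    θ-suc : ∀ r j → θ r (suc j) ≈ θ r j + [ r ℕ.≟ j ]· y
    θ-suc zero    zero    = trans (sym y+z≈1) (+-comm y z)
    θ-suc zero    (suc j) = sym (+-identityʳ _)
    θ-suc (suc r) zero    = sym (+-identityʳ _)
    θ-suc (suc r) (suc j) = θ-suc r j

    θ-zero : ∀ r → θ r 0 ≈ ω r 0 + [ r ℕ.≟ 0 ]· z
    θ-zero zero    = sym (+-identityˡ z)
    θ-zero (suc r) = sym (+-identityʳ z)

    ∑-W-+-δ : ∀ k j (u v : ℕ → Carrier) x → (∀ r → u r ≈ v r + [ r ℕ.≟ j ]· x) → j ℕ.≤ k →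
      ∑ (upTo (suc k)) (λ r → W k r * u r) ≈ ∑ (upTo (suc k)) (λ r → W k r * v r) + x * W k j
    ∑-W-+-δ k j u v x u≈v+δ j≤k = begin
      ∑ (upTo (suc k)) (λ r → W k r * u r)
        ≈⟨ ∑-cong (upTo (suc k)) (λ r → trans (*-congˡ (u≈v+δ r)) (trans (distribˡ _ _ _)
             (+-congˡ (*-[]· (r ℕ.≟ j) (W k r) x)))) ⟩
      ∑ (upTo (suc k)) (λ r → W k r * v r + [ r ℕ.≟ j ]· (W k r * x))
        ≈⟨ ∑-distrib-+ (upTo (suc k)) _ _ ⟩
      ∑ (upTo (suc k)) (λ r → W k r * v r) + ∑ (upTo (suc k)) (λ r → [ r ℕ.≟ j ]· (W k r * x))
        ≈⟨ +-congˡ (trans (∑-upTo-δ (suc k) (λ r → W k r * x) (s≤s j≤k)) (*-comm _ x)) ⟩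
      ∑ (upTo (suc k)) (λ r → W k r * v r) + x * W k j ∎

    X-suc : ∀ k j → j ℕ.≤ k → X k (suc j) ≈ X k j + y * W k j
    X-suc k j = ∑-W-+-δ k j _ _ y λ r → θ-suc r j

    X-zero : ∀ k → X k 0 ≈ w (suc k) + z * w k
    X-zero k = ∑-W-+-δ k 0 _ _ z θ-zero z≤n

    φ : ℕ → Carrier
    φ m = w m + w (suc m)

    W-one : ∀ d → W (suc d) 1 ≈ φ d
    W-one d = begin
      X d 1                              ≈⟨ X-suc d 0 z≤n ⟩
      X d 0 + y * w d                    ≈⟨ +-congʳ (X-zero d) ⟩
      w (suc d) + z * w d + y * w d      ≈⟨ xy∙z≈xz∙y _ _ _ ⟩
      w (suc d) + y * w d + z * w d      ≈⟨ +-assoc _ _ _ ⟩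
      w (suc d) + (y * w d + z * w d)    ≈⟨ +-congˡ (y*x+z*x≈x (w d)) ⟩
      w (suc d) + w d                    ≈⟨ +-comm _ _ ⟩
      φ d                                ∎

    -- The parameter d numbers the diagonals. `X-suc` expresses an entry by two entries of the
    -- column to its left, on the diagonals d and d + 1; this is the recursion of `T y`, started by
    -- `W-one` in column 1.
    W-T : ∀ j d → W (suc (j ℕ.+ d)) (suc j) ≈ T y (λ m → φ (d ℕ.+ m)) j
    W-T zero    d = trans (W-one d) (reflexive (≡.cong φ (≡.sym (ℕ.+-identityʳ d))))
    W-T (suc j) d = begin
      X (suc (j ℕ.+ d)) (suc (suc j))
        ≈⟨ X-suc (suc (j ℕ.+ d)) (suc j) (s≤s (ℕ.m≤m+n j d)) ⟩
      W (suc (suc (j ℕ.+ d))) (suc j) + y * W (suc (j ℕ.+ d)) (suc j)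
        ≈⟨ +-comm _ _ ⟩
      y * W (suc (j ℕ.+ d)) (suc j) + W (suc (suc (j ℕ.+ d))) (suc j)
        ≈⟨ +-congˡ (reflexive (≡.cong (λ k → W (suc k) (suc j)) (≡.sym (ℕ.+-suc j d)))) ⟩
      y * W (suc (j ℕ.+ d)) (suc j) + W (suc (j ℕ.+ suc d)) (suc j)
        ≈⟨ +-cong (*-congˡ (W-T j d)) (trans (W-T j (suc d))
             (T-cong y j λ m → reflexive (≡.cong φ (≡.sym (ℕ.+-suc d m))))) ⟩
      T y (λ m → φ (d ℕ.+ m)) (suc j) ∎

  -- In `X j 0` every weight is z, in `W (suc j) (suc j)` every weight is 1. Both are thus multiples
  -- of the same row sum, and diagonal 0 of `W-T` evaluates it.
  w-suc : ∀ j → w (suc j) + z * w j ≈ z * T y φ j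
  w-suc j = begin
    w (suc j) + z * w j   ≈⟨ X-zero j ⟨
    X j 0                 ≈⟨ ∑-cong (upTo (suc j)) (λ r → *-comm _ z) ⟩
    ∑ (upTo (suc j)) (λ r → z * W j r)
      ≈⟨ *-distribˡ-∑ z (upTo (suc j)) (W j) ⟨
    z * ∑ (upTo (suc j)) (W j)
      ≈⟨ *-congˡ (∑-cong-∈ (upTo (suc j)) λ r∈ → sym (trans
           (*-congˡ (reflexive (θ-≤ (ℕ.s≤s⁻¹ (∈-upTo⁻ r∈))))) (*-identityʳ _))) ⟩
    z * W (suc j) (suc j)
      ≈⟨ *-congˡ (trans (reflexive (≡.cong (λ k → W (suc k) (suc j)) (≡.sym (ℕ.+-identityʳ j)))) (W-T j 0)) ⟩
    z * T y φ j ∎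

  -- On exponential generating functions: h(x) = y e^{yx} + z e^{yx} h(x).
  IsEulerian : (ℕ → Carrier) → Set ℓ
  IsEulerian h = ∀ k → h k ≈ y ^ suc k + z * T y h k

  private
    g : ℕ → Carrier
    g = T 1# w

    g-suc : ∀ k → g (suc k) ≈ T 1# φ k
    g-suc k = trans (+-congʳ (*-identityˡ _)) (sym (T-+ 1# k w (w ∘ suc)))

    -- Multiplication by e^x turns w + w′ into g′. Splitting g into y g + z g supplies the term z w
    -- that `w-suc` asks for next to w′.
    g-rec : ∀ k → g (suc k) ≈ y * g k + z * T y (g ∘ suc) k
    g-rec k = begin
      1# * g k + T 1# (w ∘ suc) k
        ≈⟨ +-congʳ (trans (*-identityˡ _) (sym (y*x+z*x≈x (g k)))) ⟩
      y * g k + z * g k + T 1# (w ∘ suc) k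
        ≈⟨ trans (+-assoc _ _ _) (+-congˡ (+-comm _ _)) ⟩
      y * g k + (T 1# (w ∘ suc) k + z * g k)
        ≈⟨ +-congˡ (+-congˡ (T-* 1# z k w)) ⟨
      y * g k + (T 1# (w ∘ suc) k + T 1# (λ m → z * w m) k)
        ≈⟨ +-congˡ (T-+ 1# k _ _) ⟨
      y * g k + T 1# (λ m → w (suc m) + z * w m) k
        ≈⟨ +-congˡ (trans (T-cong 1# k w-suc) (T-* 1# z k (T y φ))) ⟩
      y * g k + z * T 1# (T y φ) k
        ≈⟨ +-congˡ (*-congˡ (trans (T-comm 1# y k φ) (T-cong y k λ m → sym (g-suc m)))) ⟩
      y * g k + z * T y (g ∘ suc) k ∎

    -- The defect u = g - y e^(yx) - z e^(yx) g satisfies u′ = y u by `g-rec`, and u(0) = 1 - y - z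
    -- = 0. The induction is this argument on coefficients.
    g-isEulerian : IsEulerian g
    g-isEulerian zero    = sym (trans (+-cong (*-identityʳ y) (*-identityʳ z)) y+z≈1)
    g-isEulerian (suc k) = begin
      g (suc k)                                             ≈⟨ g-rec k ⟩
      y * g k + z * T y (g ∘ suc) k                         ≈⟨ +-congʳ (*-congˡ (g-isEulerian k)) ⟩
      y * (y ^ suc k + z * T y g k) + z * T y (g ∘ suc) k   ≈⟨ +-congʳ (distribˡ y _ _) ⟩
      y ^ suc (suc k) + y * (z * T y g k) + z * T y (g ∘ suc) k
        ≈⟨ trans (+-assoc _ _ _) (+-congˡ (+-congʳ (x*yz≈y*xz y z _))) ⟩
      y ^ suc (suc k) + (z * (y * T y g k) + z * T y (g ∘ suc) k)
        ≈⟨ +-congˡ (distribˡ z _ _) ⟨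
      y ^ suc (suc k) + z * T y g (suc k)                  ∎

  module _ (y-cancelˡ : ∀ {u v} → y * u ≈ y * v → u ≈ v) where

    -- `T y h k` contains h k itself with coefficient 1. Moving z * h k to the left leaves y * h k,
    -- which the earlier values determine by `T-top`.
    isEulerian-unique : {h g : ℕ → Carrier} → IsEulerian h → IsEulerian g → ∀ k → h k ≈ g k
    isEulerian-unique {h} {g} h-eq g-eq = <-rec _ λ k ih → y-cancelˡ (+-cancelʳ (z * h k + z * g k) _ _ (begin
      y * h k + (z * h k + z * g k)          ≈⟨ +-assoc _ _ _ ⟨
      y * h k + z * h k + z * g k            ≈⟨ +-congʳ (trans (y*x+z*x≈x (h k)) (h-eq k)) ⟩
      y ^ suc k + z * T y h k + z * g k     ≈⟨ +-assoc _ _ _ ⟩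
      y ^ suc k + (z * T y h k + z * g k)   ≈⟨ +-congˡ (distribˡ z _ _) ⟨
      y ^ suc k + z * (T y h k + g k)       ≈⟨ +-congˡ (*-congˡ (T-top y k λ m m<k → ih m<k)) ⟩
      y ^ suc k + z * (T y g k + h k)       ≈⟨ +-congˡ (distribˡ z _ _) ⟩
      y ^ suc k + (z * T y g k + z * h k)   ≈⟨ +-assoc _ _ _ ⟨
      y ^ suc k + z * T y g k + z * h k     ≈⟨ +-congʳ (trans (y*x+z*x≈x (g k)) (g-eq k)) ⟨
      y * g k + z * g k + z * h k            ≈⟨ trans (+-assoc _ _ _) (+-congˡ (+-comm _ _)) ⟩
      y * g k + (z * h k + z * g k)          ∎))

    T[-1]-Eulerian : {h : ℕ → Carrier} → IsEulerian h → ∀ k → T (- 1#) h k ≈ w k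
    T[-1]-Eulerian {h} h-eq k = begin
      T (- 1#) h k           ≈⟨ T-cong (- 1#) k (isEulerian-unique h-eq g-isEulerian) ⟩
      T (- 1#) (T 1# w) k    ≈⟨ T-T (- 1#) 1# k w ⟩
      T (- 1# + 1#) w k      ≈⟨ T-congˡ k w (-‿inverseˡ 1#) ⟩
      T 0# w k               ≈⟨ T-0 k w ⟩
      w k                    ∎

-- Binomial transforms as sums over subsets

module BinomialSums {c ℓ : Level} (S : CommutativeSemiring c ℓ) where
  open CommutativeSemiring S hiding (zero)
  open Algebra.Properties.Semiring.Exp semiring using (_^_)
  open ListSum S
  open BinomialTransform S
  open Relation.Binary.Reasoning.Setoid setoid

  T-∑ : ∀ {a} {A : Set a} x (xs : List A) (f : ℕ → A → Carrier) k →
        T x (λ m → ∑ xs (f m)) k ≈ ∑ xs (λ i → T x (λ m → f m i) k)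
  T-∑ x []       f k = T-0# k
    where
    T-0# : ∀ k → T x (λ _ → 0#) k ≈ 0#
    T-0# zero    = refl
    T-0# (suc k) = trans (+-cong (trans (*-congˡ (T-0# k)) (zeroʳ x)) (T-0# k)) (+-identityʳ 0#)
  T-∑ x (i ∷ xs) f k = trans (T-+ x k _ _) (+-congˡ (T-∑ x xs f k))

  T-*ʳ : ∀ a x k (φ : ℕ → Carrier) → T a (λ m → φ m * x) k ≈ T a φ k * x
  T-*ʳ a x k φ = trans (T-cong a k λ m → *-comm (φ m) x) (trans (T-* a x k φ) (*-comm x _))

  -- The binomial formula ∑ (k choose m) a^(k-m) φ m, with the coefficients hidden in `T 1#`.
  T-scale : ∀ a k (φ : ℕ → Carrier) → T a φ k ≈ T 1# (λ m → a ^ (k ∸ m) * φ m) k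
  T-scale a zero    φ = sym (*-identityˡ _)
  T-scale a (suc k) φ = +-cong
    (begin
      a * T a φ k                                 ≈⟨ *-congˡ (T-scale a k φ) ⟩
      a * T 1# (λ m → a ^ (k ∸ m) * φ m) k        ≈⟨ T-* 1# a k _ ⟨
      T 1# (λ m → a * (a ^ (k ∸ m) * φ m)) k
        ≈⟨ T-cong-≤ 1# k (λ m m≤k → trans (sym (*-assoc a _ _))
             (*-congʳ (reflexive (≡.cong (a ^_) (≡.sym (ℕ.+-∸-assoc 1 m≤k)))))) ⟩
      T 1# (λ m → a ^ (suc k ∸ m) * φ m) k        ≈⟨ *-identityˡ _ ⟨
      1# * T 1# (λ m → a ^ (suc k ∸ m) * φ m) k   ∎)
    (T-scale a k (φ ∘ suc))

  -- Omitting the first element costs a factor a, including it shifts φ: the two terms in the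
  -- recursion of `T`.
  ∑-subsets : ∀ a n (φ : ℕ → Carrier) → ∑ (subsets n) (λ F → a ^ (n ∸ ∣ F ∣) * φ ∣ F ∣) ≈ T a φ n
  ∑-subsets a zero    φ = trans (+-identityʳ _) (*-identityˡ _)
  ∑-subsets a (suc n) φ = begin
    ∑ (subsets (suc n)) (λ F → a ^ (suc n ∸ ∣ F ∣) * φ ∣ F ∣)
      ≈⟨ ∑-cartesianProductWith _∷_ (outside ∷ inside ∷ []) (subsets n) _ ⟩
    ∑ (subsets n) (λ F → a ^ (suc n ∸ ∣ F ∣) * φ ∣ F ∣) +
      (∑ (subsets n) (λ F → a ^ (n ∸ ∣ F ∣) * φ (suc ∣ F ∣)) + 0#)
      ≈⟨ +-cong (∑-cong (subsets n) λ F → trans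
           (*-congʳ (reflexive (≡.cong (a ^_) (ℕ.+-∸-assoc 1 (∣p∣≤n F))))) (*-assoc a _ _))
           (trans (+-identityʳ _) (∑-subsets a n (φ ∘ suc))) ⟩
    ∑ (subsets n) (λ F → a * (a ^ (n ∸ ∣ F ∣) * φ ∣ F ∣)) + T a (φ ∘ suc) n
      ≈⟨ +-congʳ (trans (sym (*-distribˡ-∑ a (subsets n) _)) (*-congˡ (∑-subsets a n φ))) ⟩
    T a φ (suc n) ∎

-- From chain counts to the functional equation

module ChainPolynomial {c ℓ : Level} (R : CommutativeRing c ℓ)
  (z y : CommutativeRing.Carrier R)
  (y+z≈1 : CommutativeRing._≈_ R (CommutativeRing._+_ R y z) (CommutativeRing.1# R))
  where
  open CommutativeRing R hiding (zero)
  open Algebra.Properties.Semiring.Exp semiring using (_^_; ^-homo-*)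
  open Algebra.Properties.CommutativeSemigroup *-commutativeSemigroup using (x∙yz≈y∙xz)
  open ListSum commutativeSemiring
  open BinomialTransform commutativeSemiring
  open BinomialSums commutativeSemiring
  open LocalEulerian R z y y+z≈1 using (IsEulerian; y*x+z*x≈x)
  open Relation.Binary.Reasoning.Setoid setoid

  -- `c k i` abstracts the number of chains of i nonempty subsets of a k-element set. Removing the
  -- least member of a chain of i + 1 sets leaves a chain in its complement, of size m < k; the
  -- summand `c k i` in `c-suc` completes the binomial sum by m = k.
  module _ (c : ℕ → ℕ → Carrier)
    (c-zero : ∀ k → c k 0 ≈ 1#)
    (c-> : ∀ {k i} → k ℕ.< i → c k i ≈ 0#)
    (c-suc : ∀ k i → c k (suc i) + c k i ≈ T 1# (λ m → c m i) k)
    where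

    H : ℕ → Carrier
    H k = ∑ (upTo (suc k)) λ i → c k i * z ^ i * y ^ (k ∸ i)

    -- Brings `H m` to degree k in z and y. The terms with m < i ≤ k that the longer range adds
    -- vanish by `c->`.
    homogenize : ∀ {m k} → m ℕ.≤ k → y ^ (k ∸ m) * H m ≈ ∑ (upTo (suc k)) (λ i → c m i * (z ^ i * y ^ (k ∸ i)))
    homogenize {m} {k} m≤k = begin
      y ^ (k ∸ m) * H m
        ≈⟨ *-distribˡ-∑ (y ^ (k ∸ m)) (upTo (suc m)) _ ⟩
      ∑ (upTo (suc m)) (λ i → y ^ (k ∸ m) * (c m i * z ^ i * y ^ (m ∸ i)))
        ≈⟨ ∑-cong-∈ (upTo (suc m)) (λ {i} i∈ → trans (x∙yz≈y∙xz _ _ _) (trans (*-assoc _ _ _)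
             (*-congˡ (*-congˡ (trans (sym (^-homo-* y (k ∸ m) (m ∸ i)))
               (reflexive (≡.cong (y ^_) (k∸m+m∸i (ℕ.s≤s⁻¹ (∈-upTo⁻ i∈)))))))))) ⟩
      ∑ (upTo (suc m)) (λ i → c m i * (z ^ i * y ^ (k ∸ i)))
        ≈⟨ ∑-upTo-support (suc m) (suc k) _ (λ i i≮1+m → trans (*-congʳ (c-> (ℕ.≮⇒≥ i≮1+m))) (zeroˡ _))
             (s≤s m≤k) ⟨
      ∑ (upTo (suc k)) (λ i → c m i * (z ^ i * y ^ (k ∸ i))) ∎
      where
      k∸m+m∸i : ∀ {i} → i ℕ.≤ m → (k ∸ m) ℕ.+ (m ∸ i) ≡ k ∸ i
      k∸m+m∸i {i} i≤m = ≡.trans (≡.sym (ℕ.+-∸-assoc (k ∸ m) i≤m)) (≡.cong (_∸ i) (ℕ.m∸n+n≡m m≤k))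

    T-H : ∀ k → T y H k ≈ ∑ (upTo (suc k)) (λ i → c k (suc i) * (z ^ i * y ^ (k ∸ i))) + H k
    T-H k = begin
      T y H k
        ≈⟨ trans (T-scale y k H) (T-cong-≤ 1# k λ m m≤k → homogenize m≤k) ⟩
      T 1# (λ m → ∑ (upTo (suc k)) λ i → c m i * x i) k
        ≈⟨ T-∑ 1# (upTo (suc k)) _ k ⟩
      ∑ (upTo (suc k)) (λ i → T 1# (λ m → c m i * x i) k)
        ≈⟨ ∑-cong (upTo (suc k)) (λ i → trans (T-*ʳ 1# (x i) k _)
             (trans (*-congʳ (sym (c-suc k i))) (distribʳ _ _ _))) ⟩
      ∑ (upTo (suc k)) (λ i → c k (suc i) * x i + c k i * x i)
        ≈⟨ trans (∑-distrib-+ (upTo (suc k)) _ _) (+-congˡ (∑-cong (upTo (suc k)) λ i → sym (*-assoc _ _ _))) ⟩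
      ∑ (upTo (suc k)) (λ i → c k (suc i) * x i) + H k ∎
      where
      x : ℕ → Carrier
      x i = z ^ i * y ^ (k ∸ i)

    -- In degree k + 1 only the term i = 0 lacks a factor z. The remaining sum is the one in `T-H`,
    -- so that adding z * H k produces z * T y H k.
    y*H : ∀ k → y * H k ≈ y ^ suc k + z * ∑ (upTo (suc k)) (λ i → c k (suc i) * (z ^ i * y ^ (k ∸ i)))
    y*H k = begin
      y * H k
        ≈⟨ *-congʳ (trans (reflexive (≡.cong (y ^_) (ℕ.m+n∸n≡m 1 k))) (*-identityʳ y)) ⟨
      y ^ (suc k ∸ k) * H k
        ≈⟨ homogenize (ℕ.n≤1+n k) ⟩
      ∑ (upTo (suc (suc k))) (λ i → c k i * (z ^ i * y ^ (suc k ∸ i)))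
        ≈⟨ ∑-upTo-suc (suc k) _ ⟩
      c k 0 * (1# * y ^ suc k) + ∑ (upTo (suc k)) (λ i → c k (suc i) * (z * z ^ i * y ^ (k ∸ i)))
        ≈⟨ +-cong (trans (*-cong (c-zero k) (*-identityˡ _)) (*-identityˡ _))
             (∑-cong (upTo (suc k)) λ i → trans (*-congˡ (*-assoc z _ _)) (x∙yz≈y∙xz _ _ _)) ⟩
      y ^ suc k + ∑ (upTo (suc k)) (λ i → z * (c k (suc i) * (z ^ i * y ^ (k ∸ i))))
        ≈⟨ +-congˡ (*-distribˡ-∑ z (upTo (suc k)) _) ⟨
      y ^ suc k + z * ∑ (upTo (suc k)) (λ i → c k (suc i) * (z ^ i * y ^ (k ∸ i))) ∎

    H-isEulerian : IsEulerian H
    H-isEulerian k = begin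
      H k
        ≈⟨ y*x+z*x≈x (H k) ⟨
      y * H k + z * H k
        ≈⟨ +-congʳ (y*H k) ⟩
      y ^ suc k + z * ∑ (upTo (suc k)) (λ i → c k (suc i) * (z ^ i * y ^ (k ∸ i))) + z * H k
        ≈⟨ trans (+-assoc _ _ _) (+-congˡ (sym (distribˡ z _ _))) ⟩
      y ^ suc k + z * (∑ (upTo (suc k)) (λ i → c k (suc i) * (z ^ i * y ^ (k ∸ i))) + H k)
        ≈⟨ +-congˡ (*-congˡ (T-H k)) ⟨
      y ^ suc k + z * T y H k ∎

-- Derangements

filter-comm : ∀ {a p q} {A : Set a} {P : Pred A p} {Q : Pred A q} (P? : Decidable P) (Q? : Decidable Q)
              (xs : List A) → filter P? (filter Q? xs) ≡ filter Q? (filter P? xs)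
filter-comm P? Q? [] = ≡.refl
filter-comm P? Q? (x ∷ xs) with does (P? x) in p | does (Q? x) in q
... | true  | true  rewrite p | q = ≡.cong (x ∷_) (filter-comm P? Q? xs)
... | true  | false rewrite q = filter-comm P? Q? xs
... | false | true  rewrite p = filter-comm P? Q? xs
... | false | false = filter-comm P? Q? xs

-- Pigeonhole: a missed value would let `punchOut` squeeze Fin (suc n) injectively into Fin n.
injective⇒surjective : {f : Fin n → Fin n} → Injective _≡_ _≡_ f → Surjective _≡_ _≡_ f
injective⇒surjective {suc n} {f} f-inj y with Fin.any? (λ i → f i Fin.≟ y)
... | yes (i , fi≡y) = i , λ { ≡.refl → fi≡y }
... | no  y∉f = contradiction
  (Fin.injective⇒≤ {f = λ i → Fin.punchOut (y≢f i)} λ {i} {j} eq →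
    f-inj (Fin.punchOut-injective (y≢f i) (y≢f j) eq))
  ℕ.1+n≰n
  where
  y≢f : ∀ i → y ≢ f i
  y≢f i y≡fi = y∉f (i , ≡.sym y≡fi)

unique? : Decidable (VecUnique.Unique {A = Fin n} {n = n})
unique? = VecAllPairs.allPairs? λ i j → ¬? (i Fin.≟ j)

unique⇒injective : (v : Vec (Fin n) n) → VecUnique.Unique v → Injective _≡_ _≡_ (lookup v)
unique⇒injective v v! = VecUnique.lookup-injective v! _ _

injective⇒unique : (v : Vec (Fin n) n) → Injective _≡_ _≡_ (lookup v) → VecUnique.Unique v
injective⇒unique v v-inj = ≡.subst VecUnique.Unique (Vec.tabulate∘lookup v) (VecUnique.tabulate⁺ v-inj)

-- The map of the same name on `Fin`, freed of bounds, so that minors of one infinite matrix can be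
-- renumbered without a change of index type.
punchIn : ℕ → ℕ → ℕ
punchIn zero    c       = suc c
punchIn (suc j) zero    = zero
punchIn (suc j) (suc c) = suc (punchIn j c)

punchIn-injective : ∀ j {c d} → punchIn j c ≡ punchIn j d → c ≡ d
punchIn-injective zero    {c}     {d}     eq = ℕ.suc-injective eq
punchIn-injective (suc j) {zero}  {zero}  eq = ≡.refl
punchIn-injective (suc j) {suc c} {suc d} eq = ≡.cong suc (punchIn-injective j (ℕ.suc-injective eq))

upTo-↭-punchIn : ∀ {k j} → j ℕ.≤ k → upTo (suc k) ↭ j ∷ map (punchIn j) (upTo k)
upTo-↭-punchIn {k} {zero} _ = ↭.prep 0 (↭.↭-reflexive (applyUpTo-suc k))
upTo-↭-punchIn {suc k} {suc j} (s≤s j≤k) = begin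
  0 ∷ applyUpTo suc (suc k)              ≡⟨ ≡.cong (0 ∷_) (applyUpTo-suc (suc k)) ⟩
  0 ∷ map suc (upTo (suc k))                           ↭⟨ ↭.prep 0 (↭.map⁺ suc (upTo-↭-punchIn j≤k)) ⟩
  0 ∷ suc j ∷ map suc (map (punchIn j) (upTo k))           ↭⟨ ↭.swap 0 (suc j) ↭.refl ⟩
  suc j ∷ 0 ∷ map suc (map (punchIn j) (upTo k))
    ≡⟨ ≡.cong (λ xs → suc j ∷ 0 ∷ xs) (≡.trans (≡.sym (List.map-∘ (upTo k))) (List.map-∘ (upTo k))) ⟩
  suc j ∷ 0 ∷ map (punchIn (suc j)) (map suc (upTo k))
    ≡⟨ ≡.cong (λ xs → suc j ∷ 0 ∷ map (punchIn (suc j)) xs) (applyUpTo-suc k) ⟨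
  suc j ∷ map (punchIn (suc j)) (upTo (suc k))             ∎
  where open ↭.PermutationReasoning

allFin-suc : ∀ n → allFin (suc n) ≡ zero ∷ map suc (allFin n)
allFin-suc n = ≡.cong (zero ∷_) (≡.sym (List.map-tabulate id suc))

map-toℕ-allFin : ∀ n → map toℕ (allFin n) ≡ upTo n
map-toℕ-allFin zero    = ≡.refl
map-toℕ-allFin (suc n) = begin
  map toℕ (allFin (suc n))        ≡⟨ ≡.cong (map toℕ) (allFin-suc n) ⟩
  0 ∷ map toℕ (map suc (allFin n))
    ≡⟨ ≡.cong (0 ∷_) (≡.trans (≡.sym (List.map-∘ (allFin n))) (List.map-∘ (allFin n))) ⟩
  0 ∷ map suc (map toℕ (allFin n)) ≡⟨ ≡.cong (λ xs → 0 ∷ map suc xs) (map-toℕ-allFin n) ⟩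
  0 ∷ map suc (upTo n)            ≡⟨ ≡.cong (0 ∷_) (applyUpTo-suc n) ⟨
  upTo (suc n)                    ∎
  where open ≡.≡-Reasoning

module _ {c : Level} {C : Set c} (_≟_ : DecidableEquality C) where

  without : C → List C → List C
  without c = filter λ d → ¬? (c ≟ d)

without-map : ∀ {c d} {C : Set c} {D : Set d} (_≟_ : DecidableEquality C) (_≟′_ : DecidableEquality D)
  {f : C → D} → Injective _≡_ _≡_ f → ∀ c cs → without _≟′_ (f c) (map f cs) ≡ map f (without _≟_ c cs)
without-map _≟_ _≟′_ {f} f-inj c cs = ≡.trans (filter-map (λ d → ¬? (f c ≟′ d)) f cs)
  (≡.cong (map f) (List.filter-≐ (λ d → ¬? (f c ≟′ f d)) (λ d → ¬? (c ≟ d))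
    ((_∘ ≡.cong f) , (_∘ f-inj)) cs))

without-upTo : ∀ {k j} → j ℕ.≤ k → without ℕ._≟_ j (upTo (suc k)) ≡ map (punchIn j) (upTo k)
without-upTo {k} {zero} _ = begin
  without ℕ._≟_ 0 (applyUpTo suc k)   ≡⟨ ≡.cong (without ℕ._≟_ 0) (applyUpTo-suc k) ⟩
  without ℕ._≟_ 0 (map suc (upTo k))   ≡⟨ filter-map _ suc (upTo k) ⟩
  map suc (filter (λ d → ¬? (0 ℕ.≟ suc d)) (upTo k))
    ≡⟨ ≡.cong (map suc) (List.filter-all _ (All.universal (λ _ ()) (upTo k))) ⟩
  map suc (upTo k)                     ∎
  where open ≡.≡-Reasoning
without-upTo {suc k} {suc j} (s≤s j≤k) = ≡.cong (0 ∷_) (begin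
  without ℕ._≟_ (suc j) (applyUpTo suc (suc k))
    ≡⟨ ≡.cong (without ℕ._≟_ (suc j)) (applyUpTo-suc (suc k)) ⟩
  without ℕ._≟_ (suc j) (map suc (upTo (suc k)))
    ≡⟨ without-map ℕ._≟_ ℕ._≟_ ℕ.suc-injective j (upTo (suc k)) ⟩
  map suc (without ℕ._≟_ j (upTo (suc k)))         ≡⟨ ≡.cong (map suc) (without-upTo j≤k) ⟩
  map suc (map (punchIn j) (upTo k))
    ≡⟨ ≡.trans (≡.sym (List.map-∘ (upTo k))) (List.map-∘ (upTo k)) ⟩
  map (punchIn (suc j)) (map suc (upTo k))
    ≡⟨ ≡.cong (map (punchIn (suc j))) (applyUpTo-suc k) ⟨
  map (punchIn (suc j)) (applyUpTo suc k) ∎)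
  where open ≡.≡-Reasoning

-- Permanents over lists of rows and columns

module Permanent {c ℓ : Level} (S : CommutativeSemiring c ℓ) where
  open CommutativeSemiring S hiding (zero)
  open ListSum S
  open Algebra.Properties.CommutativeSemigroup *-commutativeSemigroup using (x∙yz≈y∙xz)
  open Algebra.Definitions.RawMonoid *-rawMonoid using () renaming (sum to ∏)
  open Relation.Binary.Reasoning.Setoid setoid

  private
    variable
      Row Row′ : Set a

  module _ {C : Set} (_≟_ : DecidableEquality C) where

    -- Expansion along the first listed row. Columns are removed by value, so a minor keeps the
    -- original labels, on which the entries depend.
    permanent : (Row → C → Carrier) → List Row → List C → Carrier
    permanent A []       cols = 1#
    permanent A (r ∷ rs) cols = ∑ cols λ c → A r c * permanent A rs (without _≟_ c cols)

    permanent-cong : {A B : Row → C → Carrier} → (∀ r c → A r c ≈ B r c) → ∀ rs cols →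
                     permanent A rs cols ≈ permanent B rs cols
    permanent-cong A≈B []       cols = refl
    permanent-cong A≈B (r ∷ rs) cols = ∑-cong cols λ c → *-cong (A≈B r c) (permanent-cong A≈B rs _)

    -- Expanding twice gives a sum over ordered pairs of distinct columns; exchanging the two
    -- summations exchanges the rows.
    permanent-swap : (A : Row → C → Carrier) (r r′ : Row) (rs : List Row) (cols : List C) →
                     permanent A (r ∷ r′ ∷ rs) cols ≈ permanent A (r′ ∷ r ∷ rs) cols
    permanent-swap A r r′ rs cols = begin
      permanent A (r ∷ r′ ∷ rs) cols
        ≈⟨ expand r r′ ⟩
      ∑ cols (λ c → ∑ cols λ d → [ ¬? (c ≟ d) ]· (A r c * (A r′ d * rest c d)))
        ≈⟨ ∑-swap cols cols _ ⟩
      ∑ cols (λ d → ∑ cols λ c → [ ¬? (c ≟ d) ]· (A r c * (A r′ d * rest c d)))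
        ≈⟨ ∑-cong cols (λ d → ∑-cong cols λ c → []·-cong (¬? (c ≟ d)) (¬? (d ≟ c)) (_∘ ≡.sym) (_∘ ≡.sym)
             λ _ → trans (x∙yz≈y∙xz _ _ _) (*-congˡ (*-congˡ
               (reflexive (≡.cong (permanent A rs) (filter-comm (λ e → ¬? (d ≟ e)) (λ e → ¬? (c ≟ e)) cols)))))) ⟩
      ∑ cols (λ d → ∑ cols λ c → [ ¬? (d ≟ c) ]· (A r′ d * (A r c * rest d c)))
        ≈⟨ expand r′ r ⟨
      permanent A (r′ ∷ r ∷ rs) cols ∎
      where
      rest : C → C → Carrier
      rest c d = permanent A rs (without _≟_ d (without _≟_ c cols))

      expand : ∀ r r′ → permanent A (r ∷ r′ ∷ rs) cols ≈
               ∑ cols (λ c → ∑ cols λ d → [ ¬? (c ≟ d) ]· (A r c * (A r′ d * rest c d)))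
      expand r r′ = ∑-cong cols λ c → trans (*-distribˡ-∑ (A r c) (without _≟_ c cols) _)
        (∑-filter (λ d → ¬? (c ≟ d)) cols _)

    permanent-↭ : (A : Row → C → Carrier) {rs rs′ : List Row} → rs ↭ rs′ → ∀ cols →
                  permanent A rs cols ≈ permanent A rs′ cols
    permanent-↭ A ↭.refl         cols = refl
    permanent-↭ A (↭.prep r σ)   cols = ∑-cong cols λ c → *-congˡ (permanent-↭ A σ _)
    permanent-↭ A (↭.swap {xs} r r′ σ) cols = trans (permanent-swap A r r′ xs cols)
      (∑-cong cols λ c → *-congˡ (∑-cong (without _≟_ c cols) λ d → *-congˡ (permanent-↭ A σ _)))
    permanent-↭ A (↭.trans σ τ)  cols = trans (permanent-↭ A σ cols) (permanent-↭ A τ cols)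

    permanent-map-rows : (A : Row′ → C → Carrier) (e : Row → Row′) (rs : List Row) (cols : List C) →
                         permanent A (map e rs) cols ≈ permanent (A ∘ e) rs cols
    permanent-map-rows A e []       cols = refl
    permanent-map-rows A e (r ∷ rs) cols = ∑-cong cols λ c → *-congˡ (permanent-map-rows A e rs _)

    -- The sum runs over all maps from rows to columns, hence the test for injectivity.
    permanent-choices : ∀ m (A : Fin m → C → Carrier) (cols : List C) →
      ∑ (choices (Vec.replicate m cols)) (λ v →
        [ VecAllPairs.allPairs? (λ c d → ¬? (c ≟ d)) v ]· ∏ (λ i → A i (lookup v i)))
      ≈ permanent A (allFin m) cols
    permanent-choices zero    A cols = +-identityʳ 1#
    permanent-choices (suc m) A cols = begin
      ∑ (choices (cols Vec.∷ Vec.replicate m cols)) (λ v → [ distinct? v ]· ∏ (λ i → A i (lookup v i)))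
        ≈⟨ ∑-cartesianProductWith _∷_ cols _ _ ⟩
      ∑ cols (λ c → ∑ vs λ v → [ all? c v ×-dec distinct? v ]· (A zero c * ∏A v))
        ≈⟨ ∑-cong cols (λ c → ∑-cong vs λ v → trans ([]·-× (all? c v) (distinct? v))
             (sym (trans (*-[]· (all? c v) _ _) ([]·-congˡ (all? c v) (*-[]· (distinct? v) _ _))))) ⟩
      ∑ cols (λ c → ∑ vs λ v → A zero c * [ all? c v ]· [ distinct? v ]· ∏A v)
        ≈⟨ ∑-cong cols (λ c → *-distribˡ-∑ (A zero c) vs _) ⟨
      ∑ cols (λ c → A zero c * ∑ vs λ v → [ all? c v ]· [ distinct? v ]· ∏A v)
        ≈⟨ ∑-cong cols (λ c → *-congˡ (∑-choices-filter (λ d → ¬? (c ≟ d)) m _)) ⟩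
      ∑ cols (λ c → A zero c * ∑ (choices (Vec.replicate m (without _≟_ c cols))) λ v → [ distinct? v ]· ∏A v)
        ≈⟨ ∑-cong cols (λ c → *-congˡ (trans (permanent-choices m (A ∘ suc) (without _≟_ c cols))
             (sym (permanent-map-rows A suc (allFin m) (without _≟_ c cols))))) ⟩
      permanent A (zero ∷ map suc (allFin m)) cols
        ≈⟨ reflexive (≡.cong (λ rs → permanent A rs cols) (allFin-suc m)) ⟨
      permanent A (allFin (suc m)) cols ∎
      where
      vs : List (Vec C m)
      vs = choices (Vec.replicate m cols)

      distinct? : ∀ {k} → Decidable (VecAllPairs.AllPairs {A = C} _≢_ {k})
      distinct? = VecAllPairs.allPairs? λ c d → ¬? (c ≟ d)

      all? : ∀ c → Decidable (VecAll.All {A = C} (c ≢_) {m})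
      all? c = VecAll.all? λ d → ¬? (c ≟ d)

      ∏A : Vec C m → Carrier
      ∏A v = ∏ λ i → A (suc i) (lookup v i)

      -- Turns the test that the later entries avoid column c into the deletion of c from the column
      -- list, which is the expansion step of `permanent`.
      ∑-choices-filter : ∀ {q} {Q : Pred C q} (Q? : Decidable Q) m (f : Vec C m → Carrier) →
        ∑ (choices (Vec.replicate m cols)) (λ v → [ VecAll.all? Q? v ]· f v)
        ≈ ∑ (choices (Vec.replicate m (filter Q? cols))) f
      ∑-choices-filter Q? zero    f = refl
      ∑-choices-filter Q? (suc m) f = begin
        ∑ (choices (cols Vec.∷ Vec.replicate m cols)) (λ v → [ VecAll.all? Q? v ]· f v)
          ≈⟨ ∑-cartesianProductWith _∷_ cols _ _ ⟩
        ∑ cols (λ c → ∑ vs′ λ v → [ Q? c ×-dec VecAll.all? Q? v ]· f (c ∷ v))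
          ≈⟨ ∑-cong cols (λ c → trans (∑-cong vs′ λ v → []·-× (Q? c) (VecAll.all? Q? v)) (∑-[]· (Q? c) vs′ _)) ⟩
        ∑ cols (λ c → [ Q? c ]· ∑ vs′ λ v → [ VecAll.all? Q? v ]· f (c ∷ v))
          ≈⟨ ∑-filter Q? cols _ ⟨
        ∑ (filter Q? cols) (λ c → ∑ vs′ λ v → [ VecAll.all? Q? v ]· f (c ∷ v))
          ≈⟨ ∑-cong (filter Q? cols) (λ c → ∑-choices-filter Q? m (f ∘ (c ∷_))) ⟩
        ∑ (filter Q? cols) (λ c → ∑ (choices (Vec.replicate m (filter Q? cols))) (f ∘ (c ∷_)))
          ≈⟨ ∑-cartesianProductWith _∷_ (filter Q? cols) _ f ⟨
        ∑ (choices (Vec.replicate (suc m) (filter Q? cols))) f ∎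
        where
        vs′ : List (Vec C m)
        vs′ = choices (Vec.replicate m cols)

  permanent-map-cols : {C D : Set} (_≟_ : DecidableEquality C) (_≟′_ : DecidableEquality D)
    (A : Row → D → Carrier) {f : C → D} → Injective _≡_ _≡_ f → (rs : List Row) (cols : List C) →
    permanent _≟′_ A rs (map f cols) ≈ permanent _≟_ (λ r c → A r (f c)) rs cols
  permanent-map-cols _≟_ _≟′_ A f-inj []       cols = refl
  permanent-map-cols _≟_ _≟′_ A {f} f-inj (r ∷ rs) cols = trans (reflexive (∑-map f cols _))
    (∑-cong cols λ c → *-congˡ (trans (reflexive (≡.cong (permanent _≟′_ A rs)
        (without-map _≟_ _≟′_ f-inj c cols)))
      (permanent-map-cols _≟_ _≟′_ A f-inj rs (without _≟_ c cols))))

-- The derangement matrix and its minors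

module DerangementMatrix {c ℓ : Level} (S : CommutativeSemiring c ℓ)
  (z : CommutativeSemiring.Carrier S) where
  open CommutativeSemiring S hiding (zero)
  open ListSum S
  open Table S z
  open Permanent S
  open Algebra.Definitions.RawMonoid *-rawMonoid using () renaming (sum to ∏)
  open Algebra.Properties.Semiring.Exp semiring using (_^_)
  open Relation.Binary.Reasoning.Setoid setoid

  D : ℕ → ℕ → Carrier
  D zero    zero    = 0#
  D zero    (suc c) = z
  D (suc i) zero    = 1#
  D (suc i) (suc c) = D i c

  D-diagonal : ∀ i → D i i ≡ 0#
  D-diagonal zero    = ≡.refl
  D-diagonal (suc i) = D-diagonal i

  D-off-diagonal : ∀ {i c} → i ≢ c → D i c ≡ (if does (i ℕ.<? c) then z else 1#)
  D-off-diagonal {zero}  {zero}  i≢c = contradiction ≡.refl i≢c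
  D-off-diagonal {zero}  {suc c} i≢c = ≡.refl
  D-off-diagonal {suc i} {zero}  i≢c = ≡.refl
  D-off-diagonal {suc i} {suc c} i≢c = D-off-diagonal (i≢c ∘ ≡.cong suc)

  D-zero : ∀ c → D 0 c ≡ ω c 0
  D-zero zero    = ≡.refl
  D-zero (suc c) = ≡.refl

  -- Once its diagonal entry is deleted, row j reads 1 before position j and z from there on.
  D-punchIn : ∀ j c → D j (punchIn j c) ≡ θ c j
  D-punchIn zero    c       = ≡.refl
  D-punchIn (suc j) zero    = ≡.refl
  D-punchIn (suc j) (suc c) = D-punchIn j c

  -- An entry depends only on how its row and column index compare, and `punchIn j` is strictly
  -- increasing.
  D-punchIn-punchIn : ∀ j r c → D (punchIn j r) (punchIn j c) ≡ D r c
  D-punchIn-punchIn zero    r       c       = ≡.refl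
  D-punchIn-punchIn (suc j) zero    zero    = ≡.refl
  D-punchIn-punchIn (suc j) zero    (suc c) = ≡.refl
  D-punchIn-punchIn (suc j) (suc r) zero    = ≡.refl
  D-punchIn-punchIn (suc j) (suc r) (suc c) = D-punchIn-punchIn j r c

  perD : List ℕ → List ℕ → Carrier
  perD = permanent ℕ._≟_ D

  minor : ℕ → ℕ → Carrier
  minor k c = perD (map suc (upTo k)) (without ℕ._≟_ c (upTo (suc k)))

  perD-punchIn : ∀ j rs cols → perD (map (punchIn j) rs) (map (punchIn j) cols) ≈ perD rs cols
  perD-punchIn j rs cols = begin
    perD (map (punchIn j) rs) (map (punchIn j) cols)
      ≈⟨ permanent-map-cols ℕ._≟_ ℕ._≟_ D (punchIn-injective j) (map (punchIn j) rs) cols ⟩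
    permanent ℕ._≟_ (λ r c → D r (punchIn j c)) (map (punchIn j) rs) cols
      ≈⟨ permanent-map-rows ℕ._≟_ _ (punchIn j) rs cols ⟩
    permanent ℕ._≟_ (λ r c → D (punchIn j r) (punchIn j c)) rs cols
      ≈⟨ permanent-cong ℕ._≟_ (λ r c → reflexive (D-punchIn-punchIn j r c)) rs cols ⟩
    perD rs cols ∎

  -- Row 0 still has its diagonal entry, the zero at the corner; hence the weight ω rather than θ.
  perD-suc : ∀ k → perD (upTo (suc k)) (upTo (suc k)) ≈ ∑ (upTo (suc k)) (λ c → minor k c * ω c 0)
  perD-suc k = ∑-cong (upTo (suc k)) λ c → trans
    (*-cong (reflexive (D-zero c))
      (reflexive (≡.cong (λ rs → perD rs (without ℕ._≟_ c (upTo (suc k)))) (applyUpTo-suc k))))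
    (*-comm _ _)

  minor-zero : ∀ k → minor k 0 ≈ perD (upTo k) (upTo k)
  minor-zero k = trans (reflexive (≡.cong (perD (map suc (upTo k))) (without-upTo {k} z≤n)))
    (perD-punchIn 0 (upTo k) (upTo k))

  -- Expansion along row suc j, whose diagonal entry has been deleted.
  minor-suc : ∀ {k j} → j ℕ.≤ k → minor (suc k) (suc j) ≈ ∑ (upTo (suc k)) (λ c → minor k c * θ c (suc j))
  minor-suc {k} {j} j≤k = begin
    perD (map suc (upTo (suc k))) (without ℕ._≟_ (suc j) (upTo (suc (suc k))))
      ≈⟨ reflexive (≡.cong (perD (map suc (upTo (suc k)))) (without-upTo (s≤s j≤k))) ⟩
    perD (map suc (upTo (suc k))) cols
      ≈⟨ permanent-↭ ℕ._≟_ D (↭.map⁺ suc (upTo-↭-punchIn j≤k)) cols ⟩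
    perD (suc j ∷ map suc (map (punchIn j) (upTo k))) cols
      ≈⟨ reflexive (≡.cong (λ rs → perD (suc j ∷ rs) cols)
           (≡.trans (≡.sym (List.map-∘ (upTo k))) (List.map-∘ (upTo k)))) ⟩
    perD (suc j ∷ map (punchIn (suc j)) (map suc (upTo k))) cols
      ≈⟨ reflexive (∑-map (punchIn (suc j)) (upTo (suc k)) _) ⟩
    ∑ (upTo (suc k)) (λ c → D (suc j) (punchIn (suc j) c) *
      perD (map (punchIn (suc j)) (map suc (upTo k))) (without ℕ._≟_ (punchIn (suc j) c) cols))
      ≈⟨ ∑-cong (upTo (suc k)) (λ c → trans (*-cong (reflexive (D-punchIn (suc j) c)) (rest c)) (*-comm _ _)) ⟩
    ∑ (upTo (suc k)) (λ c → minor k c * θ c (suc j)) ∎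
    where
    cols : List ℕ
    cols = map (punchIn (suc j)) (upTo (suc k))

    without-cols : ∀ c →
      without ℕ._≟_ (punchIn (suc j) c) cols ≡ map (punchIn (suc j)) (without ℕ._≟_ c (upTo (suc k)))
    without-cols c = without-map ℕ._≟_ ℕ._≟_ (punchIn-injective (suc j)) c (upTo (suc k))

    rest : ∀ c →
      perD (map (punchIn (suc j)) (map suc (upTo k))) (without ℕ._≟_ (punchIn (suc j) c) cols) ≈ minor k c
    rest c = trans (reflexive (≡.cong (perD (map (punchIn (suc j)) (map suc (upTo k)))) (without-cols c)))
      (perD-punchIn (suc j) (map suc (upTo k)) (without ℕ._≟_ c (upTo (suc k))))

  minor≈W : ∀ k c → c ℕ.≤ k → minor k c ≈ W k c
  minor≈W zero    zero    _         = refl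
  minor≈W (suc k) c       c≤1+k     = trans (expand c c≤1+k)
    (∑-cong-∈ (upTo (suc k)) λ {r} r∈ → *-congʳ (minor≈W k r (ℕ.s≤s⁻¹ (∈-upTo⁻ r∈))))
    where
    expand : ∀ c → c ℕ.≤ suc k → minor (suc k) c ≈ ∑ (upTo (suc k)) (λ r → minor k r * ω r c)
    expand zero    _         = trans (minor-zero (suc k)) (perD-suc k)
    expand (suc j) (s≤s j≤k) = minor-suc j≤k

  perD≈W : ∀ n → perD (upTo n) (upTo n) ≈ W n 0
  perD≈W n = trans (sym (minor-zero n)) (minor≈W n 0 z≤n)

  ∏-cong : ∀ {n} {f g : Fin n → Carrier} → (∀ i → f i ≈ g i) → ∏ f ≈ ∏ g
  ∏-cong {zero}  f≈g = refl
  ∏-cong {suc n} f≈g = *-cong (f≈g zero) (∏-cong (f≈g ∘ suc))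

  ∏-zero : ∀ {n} (f : Fin n → Carrier) i → f i ≈ 0# → ∏ f ≈ 0#
  ∏-zero f zero    fi≈0 = trans (*-congʳ fi≈0) (zeroˡ _)
  ∏-zero f (suc i) fi≈0 = trans (*-congˡ (∏-zero (f ∘ suc) i fi≈0)) (zeroʳ _)

  ∏-if : ∀ {n a p} {A : Set a} {P : Pred A p} (P? : Decidable P) (g : Fin n → A) →
         ∏ (λ i → if does (P? (g i)) then z else 1#) ≈ z ^ length (filter P? (tabulate g))
  ∏-if {zero}  P? g = refl
  ∏-if {suc n} P? g with does (P? (g zero))
  ... | true  = *-congˡ (∏-if P? (g ∘ suc))
  ... | false = trans (*-identityˡ _) (∏-if P? (g ∘ suc))

  -- A fixed point contributes a zero factor from the diagonal, so both sides vanish. Otherwise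
  -- distinct entries already make π bijective, and the product collects one z per excedance.
  derangement-weight : (π : Vec (Fin n) n) →
    [ isDerangement? π ]· (z ^ exc π) ≈ [ unique? π ]· ∏ (λ i → D (toℕ i) (toℕ (lookup π i)))
  derangement-weight π with Fin.any? (λ i → lookup π i Fin.≟ i)
  ... | yes (i , πi≡i) = trans
    ([]·-no (isDerangement? π) λ { (_ , fixfree) → fixfree i πi≡i })
    (sym (trans ([]·-cong (unique? π) (unique? π) id id λ _ → ∏-zero _ i
      (reflexive (≡.trans (≡.cong (D (toℕ i) ∘ toℕ) πi≡i) (D-diagonal (toℕ i))))) zero-if))
    where
    zero-if : [ unique? π ]· 0# ≈ 0#
    zero-if with does (unique? π)
    ... | true  = refl
    ... | false = refl
  ... | no fixfree = []·-cong (isDerangement? π) (unique? π)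
    (λ { ((inj , _) , _) → injective⇒unique π inj })
    (λ π! → let inj = unique⇒injective π π! in
       (inj , injective⇒surjective inj) , λ i πi≡i → fixfree (i , πi≡i))
    λ _ → sym (trans
      (∏-cong λ i → reflexive (D-off-diagonal λ i≡πi → fixfree (i , ≡.sym (Fin.toℕ-injective i≡πi))))
      (∏-if (λ i → i Fin.<? lookup π i) id))

  ∑-derangements : ∀ n → ∑ (derangements n) (λ π → z ^ exc π) ≈ W n 0
  ∑-derangements n = begin
    ∑ (derangements n) (λ π → z ^ exc π)
      ≈⟨ ∑-filter isDerangement? vs _ ⟩
    ∑ vs (λ π → [ isDerangement? π ]· (z ^ exc π))
      ≈⟨ ∑-cong vs derangement-weight ⟩
    ∑ vs (λ π → [ unique? π ]· ∏ (λ i → D (toℕ i) (toℕ (lookup π i))))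
      ≈⟨ permanent-choices Fin._≟_ n (λ i c → D (toℕ i) (toℕ c)) (allFin n) ⟩
    permanent Fin._≟_ (λ i c → D (toℕ i) (toℕ c)) (allFin n) (allFin n)
      ≈⟨ permanent-map-cols Fin._≟_ ℕ._≟_ (λ i c → D (toℕ i) c) Fin.toℕ-injective (allFin n) (allFin n) ⟨
    permanent ℕ._≟_ (λ i c → D (toℕ i) c) (allFin n) (map toℕ (allFin n))
      ≈⟨ permanent-map-rows ℕ._≟_ D toℕ (allFin n) (map toℕ (allFin n)) ⟨
    perD (map toℕ (allFin n)) (map toℕ (allFin n))
      ≈⟨ reflexive (≡.cong (λ xs → perD xs xs) (map-toℕ-allFin n)) ⟩
    perD (upTo n) (upTo n)
      ≈⟨ perD≈W n ⟩
    W n 0 ∎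
    where
    vs : List (Vec (Fin n) n)
    vs = choices (Vec.replicate n (allFin n))

-- Lattice points of lecture hall simplices

-- a/k < b/k′ < a/k + 1, with the denominators cleared.

Between : ℕ → ℕ → ℕ → ℕ → Set
Between k k′ a b = a ℕ.* k′ ℕ.< b ℕ.* k × b ℕ.* k ℕ.< (a ℕ.+ k) ℕ.* k′

between? : ∀ k k′ a b → Dec (Between k k′ a b)
between? k k′ a b = (a ℕ.* k′ ℕ.<? b ℕ.* k) ×-dec (b ℕ.* k ℕ.<? (a ℕ.+ k) ℕ.* k′)

-- The search bound is generous: it follows from b ≤ b * k, which is why membership below asks for a
-- nonzero k.
window : ℕ → ℕ → ℕ → List ℕ
window k k′ a = filter (between? k k′ a) (upTo ((a ℕ.+ k) ℕ.* k′))

Between⇒< : ∀ k k′ a b .{{_ : NonZero k}} → Between k k′ a b → b ℕ.< (a ℕ.+ k) ℕ.* k′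
Between⇒< k k′ a b (_ , bk<) = ℕ.≤-<-trans (ℕ.m≤m*n b k) bk<

-- The coordinates of a point y/s, with s = (k+1, k+2, …), and the height t/1
-- increase by steps in the open interval (0, 1), starting from a/k.

Steps : ℕ → ℕ → Vec ℤ m → ℤ → Set
Steps k a []      t = ∃ λ b → t ≡ + b × Between k 1 a b
Steps k a (x ∷ y) t = ∃ λ b → x ≡ + b × Between k (suc k) a b × Steps (suc k) b y t

points : ℕ → ℕ → ∀ m → List (Vec ℤ m × ℤ)
points k a zero    = map (λ t → [] , + t) (window k 1 a)
points k a (suc m) = concatMap
  (λ b → map (λ x → + b ∷ proj₁ x , proj₂ x) (points (suc k) b m))
  (window k (suc k) a)

∈-window : ∀ k k′ a .{{_ : NonZero k}} {b} → b ∈ window k k′ a ⇔ Between k k′ a b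
∈-window k k′ a {b} = mk⇔
  (proj₂ ∘ ∈-filter⁻ (between? k k′ a) {xs = upTo ((a ℕ.+ k) ℕ.* k′)})
  (λ p → ∈-filter⁺ (between? k k′ a) (∈-upTo⁺ (Between⇒< k k′ a b p)) p)

∈-points : ∀ k a m .{{_ : NonZero k}} (y : Vec ℤ m) t → (y , t) ∈ points k a m ⇔ Steps k a y t
∈-points k a zero    [] t = mk⇔ to from
  where
  to : ([] , t) ∈ points k a zero → Steps k a [] t
  to y∈ with ∈-map⁻ _ y∈
  ... | b , b∈ , ≡.refl = b , ≡.refl , Equivalence.to (∈-window k 1 a) b∈

  from : Steps k a [] t → ([] , t) ∈ points k a zero
  from (b , ≡.refl , p) = ∈-map⁺ (λ t → [] , + t) (Equivalence.from (∈-window k 1 a) p)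
∈-points k a (suc m) (x ∷ y) t = mk⇔ to from
  where
  block : ℕ → List (Vec ℤ (suc m) × ℤ)
  block b = map (λ x → + b ∷ proj₁ x , proj₂ x) (points (suc k) b m)

  to : (x ∷ y , t) ∈ points k a (suc m) → Steps k a (x ∷ y) t
  to y∈ with find (∈-concatMap⁻ block {xs = window k (suc k) a} y∈)
  ... | b , b∈ , xy∈ with ∈-map⁻ _ xy∈
  ... | _ , y∈′ , ≡.refl =
    b , ≡.refl , Equivalence.to (∈-window k (suc k) a) b∈ , Equivalence.to (∈-points (suc k) b m y t) y∈′

  from : Steps k a (x ∷ y) t → (x ∷ y , t) ∈ points k a (suc m)
  from (b , ≡.refl , p , steps) = ∈-concatMap⁺ block (lose (Equivalence.from (∈-window k (suc k) a) p)
    (∈-map⁺ _ (Equivalence.from (∈-points (suc k) b m y t) steps)))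

window-unique : ∀ k k′ a → Unique (window k k′ a)
window-unique k k′ a = Unique.filter⁺ (between? k k′ a) (Unique.upTo⁺ ((a ℕ.+ k) ℕ.* k′))

points-unique : ∀ k a m → Unique (points k a m)
points-unique k a zero    = Unique.map⁺ (λ { ≡.refl → ≡.refl }) (window-unique k 1 a)
points-unique k a (suc m) = Unique.concat⁺
  (All.map⁺ (All.universal (λ b → Unique.map⁺ (λ { ≡.refl → ≡.refl }) (points-unique (suc k) b m))
    (window k (suc k) a)))
  (AllPairs.map⁺ (AllPairs.map disjoint (window-unique k (suc k) a)))
  where
  disjoint : ∀ {b b′} → b ≢ b′ → ∀ {x : Vec ℤ (suc m) × ℤ} →
    ¬ (x ∈ map (λ x → + b ∷ proj₁ x , proj₂ x) (points (suc k) b m) ×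
       x ∈ map (λ x → + b′ ∷ proj₁ x , proj₂ x) (points (suc k) b′ m))
  disjoint b≢b′ (x∈ , x∈′) with ∈-map⁻ _ x∈ | ∈-map⁻ _ x∈′
  ... | _ , _ , ≡.refl | _ , _ , eq = b≢b′ (ℤ.+-injective (≡.cong (Vec.head ∘ proj₁) eq))

-- Both fractions grow by 1, so k * k′ is added to all three cleared terms.
Between-shift : ∀ k k′ a b → Between k k′ (k ℕ.+ a) (k′ ℕ.+ b) ⇔ Between k k′ a b
Between-shift k k′ a b = mk⇔
  (λ { (l , u) → ℕ.+-cancelˡ-< (k ℕ.* k′) _ _ (≡.subst₂ ℕ._<_ eqₗ eqₘ l)
               , ℕ.+-cancelˡ-< (k ℕ.* k′) _ _ (≡.subst₂ ℕ._<_ eqₘ eqᵤ u) })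
  (λ { (l , u) → ≡.subst₂ ℕ._<_ (≡.sym eqₗ) (≡.sym eqₘ) (ℕ.+-monoʳ-< (k ℕ.* k′) l)
               , ≡.subst₂ ℕ._<_ (≡.sym eqₘ) (≡.sym eqᵤ) (ℕ.+-monoʳ-< (k ℕ.* k′) u) })
  where
  eqₗ : (k ℕ.+ a) ℕ.* k′ ≡ k ℕ.* k′ ℕ.+ a ℕ.* k′
  eqₗ = ℕ.*-distribʳ-+ k′ k a

  eqₘ : (k′ ℕ.+ b) ℕ.* k ≡ k ℕ.* k′ ℕ.+ b ℕ.* k
  eqₘ = ≡.trans (ℕ.*-distribʳ-+ k k′ b) (≡.cong (ℕ._+ b ℕ.* k) (ℕ.*-comm k′ k))

  eqᵤ : (k ℕ.+ a ℕ.+ k) ℕ.* k′ ≡ k ℕ.* k′ ℕ.+ (a ℕ.+ k) ℕ.* k′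
  eqᵤ = ≡.trans (≡.cong (ℕ._* k′) (ℕ.+-assoc k a k)) (ℕ.*-distribʳ-+ k′ k (a ℕ.+ k))

-- For r < k and b ≤ k the inequality r/k < b/(k+1) amounts to r < b. Hence exactly one of b/(k+1)
-- and 1 + b/(k+1) lies in the open unit interval above r/k: the former if r < b, the latter if b ≤
-- r. The exception is r = b = 0, where they are its two end points.
module _ {k r b : ℕ} (r<k : r ℕ.< k) where
  open ℕ.≤-Reasoning

  Between-> : r ℕ.< b → b ℕ.≤ k → Between k (suc k) r b
  Between-> r<b b≤k = (begin-strict
      r ℕ.* suc k     ≡⟨ ℕ.*-suc r k ⟩
      r ℕ.+ r ℕ.* k     <⟨ ℕ.+-monoˡ-< (r ℕ.* k) r<k ⟩
      suc r ℕ.* k     ≤⟨ ℕ.*-monoˡ-≤ k r<b ⟩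
      b ℕ.* k         ∎)
    , (begin-strict
      b ℕ.* k         ≤⟨ ℕ.*-monoˡ-≤ k b≤k ⟩
      k ℕ.* k         <⟨ ℕ.m<n+m (k ℕ.* k) (ℕ.≤-<-trans z≤n r<k) ⟩
      k ℕ.+ k ℕ.* k     ≡⟨ ℕ.*-suc k k ⟨
      k ℕ.* suc k     ≤⟨ ℕ.*-monoˡ-≤ (suc k) (ℕ.m≤n+m k r) ⟩
      (r ℕ.+ k) ℕ.* suc k ∎)

  ¬Between-+-> : r ℕ.< b → ¬ Between k (suc k) r (suc k ℕ.+ b)
  ¬Between-+-> r<b (_ , u) = ℕ.<⇒≱ u (begin
    (r ℕ.+ k) ℕ.* suc k         ≡⟨ ℕ.*-suc (r ℕ.+ k) k ⟩
    r ℕ.+ k ℕ.+ (r ℕ.+ k) ℕ.* k     ≤⟨ ℕ.+-monoˡ-≤ ((r ℕ.+ k) ℕ.* k) (ℕ.+-monoˡ-≤ k (ℕ.<⇒≤ r<k)) ⟩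
    k ℕ.+ k ℕ.+ (r ℕ.+ k) ℕ.* k     ≡⟨ ℕ.+-assoc k k _ ⟩
    k ℕ.+ (suc r ℕ.+ k) ℕ.* k     ≡⟨ ≡.cong (λ x → k ℕ.+ x ℕ.* k) (ℕ.+-comm (suc r) k) ⟩
    (suc k ℕ.+ suc r) ℕ.* k     ≤⟨ ℕ.*-monoˡ-≤ k (ℕ.+-monoʳ-≤ (suc k) r<b) ⟩
    (suc k ℕ.+ b) ℕ.* k         ∎)

  ¬Between-≤ : b ℕ.≤ r → ¬ Between k (suc k) r b
  ¬Between-≤ b≤r (l , _) = ℕ.<⇒≱ l (ℕ.*-mono-≤ b≤r (ℕ.n≤1+n k))

  Between-+-≤ : 0 ℕ.< r → b ℕ.≤ r → Between k (suc k) r (suc k ℕ.+ b)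
  Between-+-≤ 0<r b≤r = (begin-strict
      r ℕ.* suc k           <⟨ ℕ.*-monoˡ-< (suc k) r<k ⟩
      k ℕ.* suc k           ≡⟨ ℕ.*-comm k (suc k) ⟩
      suc k ℕ.* k           ≤⟨ ℕ.*-monoˡ-≤ k (ℕ.m≤m+n (suc k) b) ⟩
      (suc k ℕ.+ b) ℕ.* k     ∎)
    , (begin-strict
      (suc k ℕ.+ b) ℕ.* k     ≤⟨ ℕ.*-monoˡ-≤ k (ℕ.+-monoʳ-≤ (suc k) b≤r) ⟩
      k ℕ.+ (k ℕ.+ r) ℕ.* k     <⟨ ℕ.+-monoˡ-< ((k ℕ.+ r) ℕ.* k) (ℕ.m<n+m k 0<r) ⟩
      r ℕ.+ k ℕ.+ (k ℕ.+ r) ℕ.* k ≡⟨ ≡.cong (λ x → r ℕ.+ k ℕ.+ x ℕ.* k) (ℕ.+-comm k r) ⟩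
      r ℕ.+ k ℕ.+ (r ℕ.+ k) ℕ.* k ≡⟨ ℕ.*-suc (r ℕ.+ k) k ⟨
      (r ℕ.+ k) ℕ.* suc k     ∎)

¬Between-0 : ∀ k → ¬ Between k (suc k) 0 (suc k ℕ.+ 0)
¬Between-0 k (_ , u) = ℕ.<-irrefl (≡.trans (≡.cong (ℕ._* k) (ℕ.+-identityʳ (suc k))) (ℕ.*-comm (suc k) k)) u

Between-bound : ∀ k k′ a b → a ℕ.< k → b ℕ.* k ℕ.< (a ℕ.+ k) ℕ.* k′ → b ℕ.< k′ ℕ.+ k′
Between-bound k k′ a b a<k u = ℕ.*-cancelʳ-< k b (k′ ℕ.+ k′) (begin-strict
  b ℕ.* k           <⟨ u ⟩
  (a ℕ.+ k) ℕ.* k′    ≤⟨ ℕ.*-monoˡ-≤ k′ (ℕ.+-monoˡ-≤ k (ℕ.<⇒≤ a<k)) ⟩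
  (k ℕ.+ k) ℕ.* k′    ≡⟨ ℕ.*-distribʳ-+ k′ k k ⟩
  k ℕ.* k′ ℕ.+ k ℕ.* k′ ≡⟨ ≡.cong₂ ℕ._+_ (ℕ.*-comm k k′) (ℕ.*-comm k k′) ⟩
  k′ ℕ.* k ℕ.+ k′ ℕ.* k ≡⟨ ℕ.*-distribʳ-+ k k′ k′ ⟨
  (k′ ℕ.+ k′) ℕ.* k   ∎)
  where open ℕ.≤-Reasoning

-- Summing over lattice points by residues

module LatticeSum {c ℓ : Level} (S : CommutativeSemiring c ℓ)
  (z : CommutativeSemiring.Carrier S) where
  open CommutativeSemiring S hiding (zero)
  open ListSum S
  open Table S z
  open Algebra.Properties.Semiring.Exp semiring using (_^_)
  open Relation.Binary.Reasoning.Setoid setoid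

  ∑-window : ∀ k k′ a .{{_ : NonZero k}} N (f : ℕ → Carrier) → (a ℕ.+ k) ℕ.* k′ ℕ.≤ N →
             ∑ (window k k′ a) f ≈ ∑ (upTo N) (λ b → [ between? k k′ a b ]· f b)
  ∑-window k k′ a N f M≤N = trans (∑-filter (between? k k′ a) (upTo ((a ℕ.+ k) ℕ.* k′)) f)
    (sym (∑-upTo-support _ N _ (λ b b≮M → []·-no (between? k k′ a b) (b≮M ∘ Between⇒< k k′ a b)) M≤N))

  ∑-window-shift : ∀ k k′ a .{{_ : NonZero k}} (f : ℕ → Carrier) →
                   ∑ (window k k′ (k ℕ.+ a)) f ≈ ∑ (window k k′ a) (f ∘ (k′ ℕ.+_))
  ∑-window-shift k k′ a f = begin
    ∑ (window k k′ (k ℕ.+ a)) f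
      ≈⟨ ∑-window k k′ (k ℕ.+ a) (k′ ℕ.+ M) f (ℕ.m≤n+m M k′) ⟩
    ∑ (upTo (k′ ℕ.+ M)) (λ b → [ between? k k′ (k ℕ.+ a) b ]· f b)
      ≈⟨ ∑-upTo-+ k′ M _ ⟩
    ∑ (upTo k′) (λ b → [ between? k k′ (k ℕ.+ a) b ]· f b) +
      ∑ (upTo M) (λ b → [ between? k k′ (k ℕ.+ a) (k′ ℕ.+ b) ]· f (k′ ℕ.+ b))
      -- For b < k′ the ratio b/k′ is below 1 and so misses the raised lower end.
      ≈⟨ +-cong (trans (∑-cong-∈ (upTo k′) λ {b} b∈ → []·-no (between? k k′ (k ℕ.+ a) b) λ { (l , _) →
                   ℕ.<⇒≱ l (low b (∈-upTo⁻ b∈)) }) (∑-zero (upTo k′)))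
                (∑-cong (upTo M) λ b → []·-cong (between? k k′ (k ℕ.+ a) (k′ ℕ.+ b)) (between? k k′ a b)
                   (Equivalence.to (Between-shift k k′ a b))
                   (Equivalence.from (Between-shift k k′ a b)) λ _ → refl) ⟩
    0# + ∑ (upTo M) (λ b → [ between? k k′ a b ]· f (k′ ℕ.+ b))
      ≈⟨ +-identityˡ _ ⟩
    ∑ (upTo M) (λ b → [ between? k k′ a b ]· f (k′ ℕ.+ b))
      ≈⟨ ∑-window k k′ a M _ (ℕ.*-monoˡ-≤ k′ (ℕ.+-monoˡ-≤ k (ℕ.m≤n+m a k))) ⟨
    ∑ (window k k′ a) (f ∘ (k′ ℕ.+_)) ∎
    where
    M : ℕ
    M = (k ℕ.+ a ℕ.+ k) ℕ.* k′

    low : ∀ b → b ℕ.< k′ → b ℕ.* k ℕ.≤ (k ℕ.+ a) ℕ.* k′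
    low b b<k′ = ≡.subst (b ℕ.* k ℕ.≤_) (ℕ.*-comm k′ (k ℕ.+ a)) (ℕ.*-mono-≤ (ℕ.<⇒≤ b<k′) (ℕ.m≤m+n k a))

  -- A start a/k below 1 forces b/k′ < 2, so each b in the window is a residue modulo k′ or such a
  -- residue plus k′.
  ∑-window-residue : ∀ k k′ a .{{_ : NonZero k}} (f : ℕ → Carrier) → a ℕ.< k →
    ∑ (window k k′ a) f ≈
    ∑ (upTo k′) (λ b → [ between? k k′ a b ]· f b + [ between? k k′ a (k′ ℕ.+ b) ]· f (k′ ℕ.+ b))
  ∑-window-residue k k′ a f a<k = begin
    ∑ (window k k′ a) f
      ≈⟨ ∑-filter (between? k k′ a) (upTo ((a ℕ.+ k) ℕ.* k′)) f ⟩
    ∑ (upTo ((a ℕ.+ k) ℕ.* k′)) g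
      ≈⟨ ∑-upTo-support _ N g (λ b b≮M → []·-no (between? k k′ a b) (b≮M ∘ Between⇒< k k′ a b))
           (ℕ.m≤m+n M (k′ ℕ.+ k′)) ⟨
    ∑ (upTo N) g
      ≈⟨ ∑-upTo-support (k′ ℕ.+ k′) N g
           (λ b b≮ → []·-no (between? k k′ a b) λ { (_ , u) → b≮ (Between-bound k k′ a b a<k u) })
           (ℕ.m≤n+m (k′ ℕ.+ k′) M) ⟩
    ∑ (upTo (k′ ℕ.+ k′)) g
      ≈⟨ ∑-upTo-+ k′ k′ g ⟩
    ∑ (upTo k′) g + ∑ (upTo k′) (g ∘ (k′ ℕ.+_))
      ≈⟨ ∑-distrib-+ (upTo k′) g (g ∘ (k′ ℕ.+_)) ⟨
    ∑ (upTo k′) (λ b → g b + g (k′ ℕ.+ b)) ∎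
    where
    g : ℕ → Carrier
    g b = [ between? k k′ a b ]· f b

    M N : ℕ
    M = (a ℕ.+ k) ℕ.* k′
    N = M ℕ.+ (k′ ℕ.+ k′)

  ∑points : ℕ → ℕ → ℕ → Carrier
  ∑points k a m = ∑ (points k a m) λ x → z ^ ℤ.∣ proj₂ x ∣

  ∑points-zero : ∀ k a → ∑points k a 0 ≈ ∑ (window k 1 a) (z ^_)
  ∑points-zero k a = reflexive (∑-map (λ t → [] , + t) (window k 1 a) _)

  ∑points-suc : ∀ k a m → ∑points k a (suc m) ≈ ∑ (window k (suc k) a) (λ b → ∑points (suc k) b m)
  ∑points-suc k a m = trans (∑-concatMap _ (window k (suc k) a) _)
    (∑-cong (window k (suc k) a) λ b → reflexive (∑-map _ (points (suc k) b m) _))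

  -- Raising the start by 1 raises every later ratio and the final height by 1. Therefore only the
  -- residue of a modulo k has to be remembered.
  ∑points-shift : ∀ k a m .{{_ : NonZero k}} → ∑points k (k ℕ.+ a) m ≈ z * ∑points k a m
  ∑points-shift k a zero    = begin
    ∑points k (k ℕ.+ a) 0                   ≈⟨ ∑points-zero k (k ℕ.+ a) ⟩
    ∑ (window k 1 (k ℕ.+ a)) (z ^_)         ≈⟨ ∑-window-shift k 1 a (z ^_) ⟩
    ∑ (window k 1 a) (λ t → z * z ^ t)  ≈⟨ *-distribˡ-∑ z (window k 1 a) (z ^_) ⟨
    z * ∑ (window k 1 a) (z ^_)         ≈⟨ *-congˡ (∑points-zero k a) ⟨
    z * ∑points k a 0                   ∎
  ∑points-shift k a (suc m) = begin
    ∑points k (k ℕ.+ a) (suc m)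
      ≈⟨ ∑points-suc k (k ℕ.+ a) m ⟩
    ∑ (window k (suc k) (k ℕ.+ a)) (λ b → ∑points (suc k) b m)
      ≈⟨ ∑-window-shift k (suc k) a _ ⟩
    ∑ (window k (suc k) a) (λ b → ∑points (suc k) (suc k ℕ.+ b) m)
      ≈⟨ ∑-cong (window k (suc k) a) (λ b → ∑points-shift (suc k) b m) ⟩
    ∑ (window k (suc k) a) (λ b → z * ∑points (suc k) b m)
      ≈⟨ *-distribˡ-∑ z (window k (suc k) a) _ ⟨
    z * ∑ (window k (suc k) a) (λ b → ∑points (suc k) b m)
      ≈⟨ *-congˡ (∑points-suc k a m) ⟨
    z * ∑points k a (suc m) ∎

  -- The weight is 1 if the next ratio stays below 1 and z if it reaches 1 or more. It is 0 for r =
  -- b = 0, where the step would have length 0 or 1.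
  ω-weight : ∀ k r b x → r ℕ.< k → b ℕ.≤ k →
    [ between? k (suc k) r b ]· x + [ between? k (suc k) r (suc k ℕ.+ b) ]· (z * x) ≈ ω r b * x
  ω-weight k r b x r<k b≤k with r ℕ.<? b
  ω-weight k r (suc j) x r<k b≤k | yes r<b = trans
    (+-cong ([]·-yes (between? k (suc k) r (suc j)) (Between-> r<k r<b b≤k))
            ([]·-no (between? k (suc k) r (suc k ℕ.+ suc j)) (¬Between-+-> r<k r<b)))
    (trans (+-identityʳ x) (sym (trans (*-congʳ (reflexive (θ-≤ (ℕ.s≤s⁻¹ r<b)))) (*-identityˡ x))))
  ω-weight k zero zero x r<k b≤k | no r≮b = trans
    (+-cong ([]·-no (between? k (suc k) 0 0) {x} (¬Between-≤ r<k z≤n))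
            ([]·-no (between? k (suc k) 0 (suc k ℕ.+ 0)) (¬Between-0 k)))
    (trans (+-identityʳ _) (sym (zeroˡ x)))
  ω-weight k zero (suc b) x r<k b≤k | no r≮b = contradiction (s≤s z≤n) r≮b
  ω-weight k (suc r) b x r<k b≤k | no r≮b = trans
    (+-cong ([]·-no (between? k (suc k) (suc r) b) (¬Between-≤ r<k (ℕ.≮⇒≥ r≮b)))
            ([]·-yes (between? k (suc k) (suc r) (suc k ℕ.+ b)) (Between-+-≤ r<k (s≤s z≤n) (ℕ.≮⇒≥ r≮b))))
    (trans (+-identityˡ _) (*-congʳ (reflexive (≡.sym (ω-≥ b (ℕ.≮⇒≥ r≮b))))))
    where
    ω-≥ : ∀ b → b ℕ.≤ suc r → ω (suc r) b ≡ z
    ω-≥ zero    _   = ≡.refl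
    ω-≥ (suc b) b≤r = θ-≥ b≤r

  -- The height has denominator 1, hence the single residue 0. Height 0 is never above r/k, and
  -- height 1 is less than one step away exactly when r > 0.
  ∑points-ω-zero : ∀ k r → r ℕ.< k → ∑points k r 0 ≈ ω r 0
  ∑points-ω-zero k@(suc _) r r<k = begin
    ∑points k r 0
      ≈⟨ trans (∑points-zero k r) (∑-window-residue k 1 r (z ^_) r<k) ⟩
    [ between? k 1 r 0 ]· 1# + [ between? k 1 r 1 ]· (z * 1#) + 0#
      ≈⟨ +-identityʳ _ ⟩
    [ between? k 1 r 0 ]· 1# + [ between? k 1 r 1 ]· (z * 1#)
      ≈⟨ +-congʳ ([]·-no (between? k 1 r 0) {1#} λ { (() , _) }) ⟩
    0# + [ between? k 1 r 1 ]· (z * 1#)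
      ≈⟨ +-identityˡ _ ⟩
    [ between? k 1 r 1 ]· (z * 1#)
      ≈⟨ last r r<k ⟩
    ω r 0 ∎
    where
    last : ∀ r → r ℕ.< k → [ between? k 1 r 1 ]· (z * 1#) ≈ ω r 0
    last zero    r<k = []·-no (between? k 1 0 1) λ { (_ , u) → ℕ.<-irrefl (ℕ.*-comm 1 k) u }
    last (suc r) r<k = trans ([]·-yes (between? k 1 (suc r) 1)
      ( ≡.subst₂ ℕ._<_ (≡.sym (ℕ.*-identityʳ (suc r))) (≡.sym (ℕ.*-identityˡ k)) r<k
      , ≡.subst₂ ℕ._<_ (≡.sym (ℕ.*-identityˡ k)) (≡.sym (ℕ.*-identityʳ (suc r ℕ.+ k))) (ℕ.m<n+m k (s≤s z≤n))))
      (*-identityʳ z)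

  ∑points-ω-suc : ∀ k r m → r ℕ.< k → ∑points k r (suc m) ≈ ∑ (upTo (suc k)) (λ b → ω r b * ∑points (suc k) b m)
  ∑points-ω-suc k@(suc _) r m r<k = begin
    ∑points k r (suc m)
      ≈⟨ trans (∑points-suc k r m) (∑-window-residue k (suc k) r _ r<k) ⟩
    ∑ (upTo (suc k)) (λ b → [ between? k (suc k) r b ]· ∑points (suc k) b m +
      [ between? k (suc k) r (suc k ℕ.+ b) ]· ∑points (suc k) (suc k ℕ.+ b) m)
      ≈⟨ ∑-cong-∈ (upTo (suc k)) (λ {b} b∈ → trans
           (+-congˡ ([]·-cong (between? k (suc k) r (suc k ℕ.+ b)) (between? k (suc k) r (suc k ℕ.+ b)) id id
              λ _ → ∑points-shift (suc k) b m))
           (ω-weight k r b _ r<k (ℕ.s≤s⁻¹ (∈-upTo⁻ b∈)))) ⟩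
    ∑ (upTo (suc k)) (λ b → ω r b * ∑points (suc k) b m) ∎

  -- A transfer-matrix product: row k of `W` accounts for the steps before a cut, `∑points` for
  -- those after it. Exchanging the summations moves the cut one step on, until no coordinate is
  -- left.
  ∑-W-∑points : ∀ m k → ∑ (upTo (suc k)) (λ r → W k r * ∑points (suc k) r m) ≈ W (k ℕ.+ suc m) 0
  ∑-W-∑points zero    k = trans
    (∑-cong-∈ (upTo (suc k)) λ {r} r∈ → *-congˡ (∑points-ω-zero (suc k) r (∈-upTo⁻ r∈)))
    (reflexive (≡.cong (λ n → W n 0) (≡.sym (ℕ.+-comm k 1))))
  ∑-W-∑points (suc m) k = begin
    ∑ (upTo (suc k)) (λ r → W k r * ∑points (suc k) r (suc m))
      ≈⟨ ∑-cong-∈ (upTo (suc k)) (λ {r} r∈ → trans (*-congˡ (∑points-ω-suc (suc k) r m (∈-upTo⁻ r∈)))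
           (trans (*-distribˡ-∑ (W k r) (upTo (suc (suc k))) _)
             (∑-cong (upTo (suc (suc k))) λ b → sym (*-assoc _ _ _)))) ⟩
    ∑ (upTo (suc k)) (λ r → ∑ (upTo (suc (suc k))) λ b → W k r * ω r b * ∑points (suc (suc k)) b m)
      ≈⟨ ∑-swap (upTo (suc k)) (upTo (suc (suc k))) _ ⟩
    ∑ (upTo (suc (suc k))) (λ b → ∑ (upTo (suc k)) λ r → W k r * ω r b * ∑points (suc (suc k)) b m)
      ≈⟨ ∑-cong (upTo (suc (suc k))) (λ b → *-distribʳ-∑ _ (upTo (suc k)) _) ⟨
    ∑ (upTo (suc (suc k))) (λ b → W (suc k) b * ∑points (suc (suc k)) b m)
      ≈⟨ ∑-W-∑points m (suc k) ⟩
    W (suc k ℕ.+ suc m) 0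
      ≈⟨ reflexive (≡.cong (λ n → W n 0) (≡.sym (ℕ.+-suc k (suc m)))) ⟩
    W (k ℕ.+ suc (suc m)) 0 ∎

  ∑points≈W : ∀ m → ∑points 1 0 m ≈ W (suc m) 0
  ∑points≈W m = trans (sym (trans (+-identityʳ _) (*-identityˡ _))) (∑-W-∑points m 0)

-- From the open parallelepiped to sequences of steps

module LectureHallPoints {c ℓ₁ ℓ₂ : Level} (K : OrderedField c ℓ₁ ℓ₂) where
  open OrderedField K
  open OrderedFieldProperties K
  open Algebra.Properties.Semiring.Mult semiring using (×1-homo-*)

  cast : ℕ → Carrier
  cast k = k · 1#

  +-monoˡ-< : ∀ x {y u} → y < u → y + x < u + x
  +-monoˡ-< x y<u = <-respˡ-≈ (+-comm x _) (<-respʳ-≈ (+-comm x _) (+-monoʳ-< x y<u))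

  x+y-x≈y : ∀ x y → - x + (x + y) ≈ y
  x+y-x≈y x y = trans (sym (+-assoc _ _ _)) (trans (+-congʳ (-‿inverseˡ x)) (+-identityˡ y))

  +-cancelˡ-< : ∀ x {y u} → x + y < x + u → y < u
  +-cancelˡ-< x lt = <-respˡ-≈ (x+y-x≈y x _) (<-respʳ-≈ (x+y-x≈y x _) (+-monoʳ-< (- x) lt))

  x<y⇒0<y-x : ∀ {x y} → x < y → 0# < y - x
  x<y⇒0<y-x {x} x<y = <-respˡ-≈ (-‿inverseʳ x) (+-monoˡ-< (- x) x<y)

  *-monoʳ-< : ∀ {x y u} → 0# < u → x < y → x * u < y * u
  *-monoʳ-< {x} {y} {u} 0<u x<y = <-respˡ-≈ (+-identityʳ _) (<-respʳ-≈ eq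
    (+-monoʳ-< (x * u) (*-pos (x<y⇒0<y-x x<y) 0<u)))
    where
    eq : x * u + (y - x) * u ≈ y * u
    eq = trans (sym (distribʳ u x (y - x))) (*-congʳ (x+[y-x]≈y x y))

  cast-mono-≤ : ∀ {j k} → j ℕ.≤ k → cast j ≤ cast k
  cast-mono-≤ {j} {k} j≤k = ≤-respʳ-≈
    (trans (sym (×-homo-+ 1# j (k ℕ.∸ j))) (reflexive (≡.cong cast (ℕ.m+[n∸m]≡n j≤k))))
    (x≤x+y (cast j) (·1-nonneg (k ℕ.∸ j)))

  cast-cancel-< : ∀ j k → cast j < cast k → j ℕ.< k
  cast-cancel-< j k j<k = ℕ.≰⇒> λ k≤j → <⇒≱ j<k (cast-mono-≤ k≤j)

  -- The relation p = a/k, multiplied out so that comparisons in the field become comparisons of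
  -- natural numbers.
  record IsFraction (p : Carrier) (a k : ℕ) : Set ℓ₁ where
    constructor fraction
    field
      cleared : p * cast k ≈ cast a

  open IsFraction

  module _ {p q : Carrier} {k k′ a b : ℕ} {{_ : NonZero k}} {{_ : NonZero k′}}
    (p≈a/k : IsFraction p a k) (q≈b/k′ : IsFraction q b k′) where

    private
      scaleˡ : p * (cast k * cast k′) ≈ cast (a ℕ.* k′)
      scaleˡ = trans (sym (*-assoc _ _ _)) (trans (*-congʳ (cleared p≈a/k)) (sym (×1-homo-* a k′)))

      scaleʳ : q * (cast k * cast k′) ≈ cast (b ℕ.* k)
      scaleʳ = trans (*-congˡ (*-comm _ _)) (trans (sym (*-assoc _ _ _))
        (trans (*-congʳ (cleared q≈b/k′)) (sym (×1-homo-* b k))))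

    fraction-<⁻ : p < q → a ℕ.* k′ ℕ.< b ℕ.* k
    fraction-<⁻ p<q = cast-cancel-< _ _ (<-respˡ-≈ scaleˡ (<-respʳ-≈ scaleʳ
      (*-monoʳ-< (*-pos (·1-pos k) (·1-pos k′)) p<q)))

    fraction-≈⁻ : p ≈ q → b ℕ.* k ℕ.≤ a ℕ.* k′
    fraction-≈⁻ p≈q = ·1-cancel-≤ _ _ (inj₂ (trans (sym scaleʳ) (trans (*-congʳ (sym p≈q)) scaleˡ)))

  -- By trichotomy in the field: p ≈ q and q < p, translated to ℕ, both contradict the given
  -- inequality.
  fraction-<⁺ : ∀ {p q k k′ a b} {{_ : NonZero k}} {{_ : NonZero k′}} →
    IsFraction p a k → IsFraction q b k′ → a ℕ.* k′ ℕ.< b ℕ.* k → p < q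
  fraction-<⁺ {p} {q} p≈a/k q≈b/k′ lt with IsStrictTotalOrder.compare isStrictTotalOrder p q
  ... | tri< p<q _ _ = p<q
  ... | tri≈ _ p≈q _ = contradiction (fraction-≈⁻ p≈a/k q≈b/k′ p≈q) (ℕ.<⇒≱ lt)
  ... | tri> _ _ q<p = contradiction (fraction-<⁻ q≈b/k′ p≈a/k q<p) (ℕ.<⇒≯ lt)

  fraction-+1 : ∀ {p k a} → IsFraction p a k → IsFraction (p + 1#) (a ℕ.+ k) k
  fraction-+1 {p} {k} {a} (fraction pk≈a) = fraction (trans (distribʳ _ _ _)
    (trans (+-cong pk≈a (*-identityˡ _)) (sym (×-homo-+ 1# a k))))

  fraction-/1 : ∀ {p b} → p ≈ cast b → IsFraction p b 1
  fraction-/1 p≈b = fraction (trans (*-congˡ (+-identityʳ 1#)) (trans (*-identityʳ _) p≈b))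

  ι-nonneg⁻ : ∀ x → 0# < ι x → ∃ λ b → x ≡ + b
  ι-nonneg⁻ (+ b)    _    = b , ≡.refl
  ι-nonneg⁻ -[1+ n ] 0<ιx = contradiction
    (+-monoʳ-≤ (cast (suc n)) (inj₁ 0<ιx))
    (<⇒≱ (<-respˡ-≈ (sym (-‿inverseʳ _)) (<-respʳ-≈ (sym (+-identityʳ _)) (·1-pos (suc n)))))

  between⇔ : ∀ {p q k k′ a b} {{_ : NonZero k}} {{_ : NonZero k′}} →
    IsFraction p a k → IsFraction q b k′ → Between k k′ a b ⇔ (p < q × q < p + 1#)
  between⇔ p≈a/k q≈b/k′ = mk⇔
    (λ { (l , u) → fraction-<⁺ p≈a/k q≈b/k′ l , fraction-<⁺ q≈b/k′ (fraction-+1 p≈a/k) u })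
    (λ { (l , u) → fraction-<⁻ p≈a/k q≈b/k′ l , fraction-<⁻ q≈b/k′ (fraction-+1 p≈a/k) u })

  IsStep : Carrier → Set ℓ₂
  IsStep μ = 0# < μ × μ < 1#

  <⇒isStep : ∀ {p q} → p < q × q < p + 1# → IsStep (q - p)
  <⇒isStep {p} {q} (p<q , q<p+1) = x<y⇒0<y-x p<q
    , +-cancelˡ-< p (<-respˡ-≈ (sym (x+[y-x]≈y p q)) q<p+1)

  isStep⇒< : ∀ p {μ} → IsStep μ → p < p + μ × p + μ < p + 1#
  isStep⇒< p (0<μ , μ<1) = <-respˡ-≈ (+-identityʳ p) (+-monoʳ-< p 0<μ) , +-monoʳ-< p μ<1

  x/k*k≈x : ∀ x k .{{_ : NonZero k}} → x * cast k ⁻¹ * cast k ≈ x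
  x/k*k≈x x k = trans (*-assoc _ _ _)
    (trans (*-congˡ (trans (*-comm _ _) (⁻¹-inverseʳ _ (·1≉0 k)))) (*-identityʳ x))

  -- The partial sums p + μ₀ + … + μⱼ are the ratios yⱼ / (k + 1 + j).
  HasSteps : ℕ → Carrier → Vec ℤ m → ℤ → Set (c ⊔ ℓ₁ ⊔ ℓ₂)
  HasSteps {m} k p y t = ∃ λ (μ : Vector Carrier (suc m)) →
    (∀ i → IsStep (μ i)) ×
    (∀ j → ι (lookup y j) ≈ (p + partialSum K μ j) * cast (suc k ℕ.+ toℕ j)) ×
    ι t ≈ p + sum μ

  Steps⇒HasSteps : ∀ k p a {{_ : NonZero k}} (y : Vec ℤ m) t → IsFraction p a k →
                   Steps k a y t → HasSteps k p y t
  Steps⇒HasSteps k p a [] t p≈a/k (b , ≡.refl , between) =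
    (λ _ → cast b - p)
    , (λ _ → <⇒isStep (Equivalence.to (between⇔ p≈a/k b≈b/1) between))
    , (λ ())
    , sym (trans (+-congˡ (+-identityʳ _)) (x+[y-x]≈y p (cast b)))
    where
    b≈b/1 : IsFraction (cast b) b 1
    b≈b/1 = fraction-/1 refl
  Steps⇒HasSteps {suc m} k p a (x ∷ y) t p≈a/k (b , ≡.refl , between , steps) =
    μ , isStep , coordinate , trans ιt≈ (trans (+-congʳ (sym p+μ₀≈p′)) (+-assoc _ _ _))
    where
    p′ : Carrier
    p′ = cast b * cast (suc k) ⁻¹

    p′≈b/k : IsFraction p′ b (suc k)
    p′≈b/k = fraction (x/k*k≈x (cast b) (suc k))

    rest : HasSteps (suc k) p′ y t
    rest = Steps⇒HasSteps (suc k) p′ b y t p′≈b/k steps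

    ιt≈ : ι t ≈ p′ + sum (proj₁ rest)
    ιt≈ = proj₂ (proj₂ (proj₂ rest))

    μ : Vector Carrier (suc (suc m))
    μ zero    = p′ - p
    μ (suc i) = proj₁ rest i

    p+μ₀≈p′ : p + (p′ - p) ≈ p′
    p+μ₀≈p′ = x+[y-x]≈y p p′

    isStep : ∀ i → IsStep (μ i)
    isStep zero    = <⇒isStep (Equivalence.to (between⇔ p≈a/k p′≈b/k) between)
    isStep (suc i) = proj₁ (proj₂ rest) i

    coordinate : ∀ j → ι (lookup (x ∷ y) j) ≈ (p + partialSum K μ j) * cast (suc k ℕ.+ toℕ j)
    coordinate zero    = sym (trans
      (*-cong p+μ₀≈p′ (reflexive (≡.cong cast (ℕ.+-identityʳ (suc k))))) (cleared p′≈b/k))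
    coordinate (suc j) = trans (proj₁ (proj₂ (proj₂ rest)) j) (*-cong
      (trans (+-congʳ (sym p+μ₀≈p′)) (+-assoc _ _ _))
      (reflexive (≡.cong cast (≡.sym (ℕ.+-suc (suc k) (toℕ j))))))

  -- Starting from a nonnegative p, every partial sum is positive. So the integer coordinates are
  -- natural numbers, as `Steps` demands, and the assumption passes on to the next start.
  HasSteps⇒Steps : ∀ k p a {{_ : NonZero k}} (y : Vec ℤ m) t → 0# ≤ p → IsFraction p a k →
                   HasSteps k p y t → Steps k a y t
  HasSteps⇒Steps k p a [] t 0≤p p≈a/k (μ , isStep , _ , ιt≈)
    with isStep⇒< p (isStep zero)
  ... | p<q , q<p+1 with ι-nonneg⁻ t (<-respʳ-≈ (sym (trans ιt≈ (+-congˡ (+-identityʳ _))))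
    (≤.≤-<-trans sym <-trans <-respˡ-≈ 0≤p p<q))
  ... | b , ≡.refl = b , ≡.refl , Equivalence.from (between⇔ p≈a/k q≈b/k) (p<q , q<p+1)
    where
    q≈b/k : IsFraction (p + μ zero) b 1
    q≈b/k = fraction-/1 (sym (trans ιt≈ (+-congˡ (+-identityʳ _))))
  HasSteps⇒Steps k p a (x ∷ y) t 0≤p p≈a/k (μ , isStep , coordinate , ιt≈)
    with isStep⇒< p (isStep zero)
  ... | p<q , q<p+1 with ≤.≤-<-trans sym <-trans <-respˡ-≈ 0≤p p<q
  ... | 0<q with ι-nonneg⁻ x (<-respʳ-≈ (sym (coordinate zero)) (*-pos 0<q (·1-pos (suc k ℕ.+ 0))))
  ... | b , ≡.refl = b , ≡.refl , Equivalence.from (between⇔ p≈a/k q≈b/k) (p<q , q<p+1) ,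
    HasSteps⇒Steps (suc k) (p + μ zero) b y t (inj₁ 0<q) q≈b/k
      ( tail μ , (isStep ∘ suc)
      , (λ j → trans (coordinate (suc j)) (*-cong (sym (+-assoc _ _ _))
                 (reflexive (≡.cong cast (ℕ.+-suc (suc k) (toℕ j))))))
      , trans ιt≈ (sym (+-assoc _ _ _)) )
    where
    q≈b/k : IsFraction (p + μ zero) b (suc k)
    q≈b/k = fraction (trans (*-congˡ (reflexive (≡.cong cast (≡.sym (ℕ.+-identityʳ (suc k))))))
      (sym (coordinate zero)))

  -- By the triangular shape of the vertices, coordinate j divided by j + 2 is the partial sum of μ
  -- up to j, and the last coordinate is the full sum. The sequence of ratios starts from 0 = 0/1.
  inΠ°⇔Steps : ∀ m (y : Vec ℤ m) t →
    InΠ° K (lectureHallSimplex K (2⋯ suc m) (2⋯-nonZero (suc m))) (y , t) ⇔ Steps 1 0 y t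
  inΠ°⇔Steps m y t = mk⇔
    (λ { (μ , isStep , eqs , eq) → HasSteps⇒Steps 1 0# 0 y t ≤-refl (fraction (zeroˡ _))
      ( μ , isStep
      , (λ j → trans (eqs j) (trans (∑-lectureHallVertex K s μ j) (*-congʳ (sym (+-identityˡ _)))))
      , trans eq (sym (+-identityˡ _)) ) })
    (λ steps → let μ , isStep , eqs , eq = Steps⇒HasSteps 1 0# 0 y t (fraction (zeroˡ _)) steps in
      μ , isStep
      , (λ j → trans (eqs j) (trans (*-congʳ (+-identityˡ _)) (sym (∑-lectureHallVertex K s μ j))))
      , trans eq (+-identityˡ _))
    where
    s : Vector ℕ m
    s = 2⋯ suc m

-- The ring of polynomials

-- A record, since p and q cannot be recovered from p ≈ₚ q by unification.

infix 4 _≋_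

record _≋_ (p q : Poly) : Set where
  constructor coeffs
  field
    at : p ≈ₚ q

open _≋_

infix 8 -ₚ_

-ₚ_ : Poly → Poly
-ₚ p = map ℤ.-_ p

coeff-+ₚ : ∀ p q k → coeff (p +ₚ q) k ≡ coeff p k ℤ.+ coeff q k
coeff-+ₚ []      q       k       = ≡.sym (ℤ.+-identityˡ _)
coeff-+ₚ (a ∷ p) []      k       = ≡.sym (ℤ.+-identityʳ _)
coeff-+ₚ (a ∷ p) (b ∷ q) zero    = ≡.refl
coeff-+ₚ (a ∷ p) (b ∷ q) (suc k) = coeff-+ₚ p q k

coeff-map : ∀ (f : ℤ → ℤ) → f 0ℤ ≡ 0ℤ → ∀ p k → coeff (map f p) k ≡ f (coeff p k)
coeff-map f f0≡0 []      k       = ≡.sym f0≡0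
coeff-map f f0≡0 (a ∷ p) zero    = ≡.refl
coeff-map f f0≡0 (a ∷ p) (suc k) = coeff-map f f0≡0 p k

≋-isEquivalence : IsEquivalence _≋_
≋-isEquivalence = record
  { refl  = coeffs λ k → ≡.refl
  ; sym   = λ p≋q → coeffs λ k → ≡.sym (at p≋q k)
  ; trans = λ p≋q q≋r → coeffs λ k → ≡.trans (at p≋q k) (at q≋r k)
  }

open IsEquivalence ≋-isEquivalence using ()
  renaming (refl to ≋-refl; sym to ≋-sym; trans to ≋-trans; reflexive to ≋-reflexive)
≋-setoid : Setoid 0ℓ 0ℓ
≋-setoid = record { isEquivalence = ≋-isEquivalence }

module ≋-Reasoning = Relation.Binary.Reasoning.Setoid ≋-setoid

+ₚ-cong : ∀ {p p′ q q′} → p ≋ p′ → q ≋ q′ → p +ₚ q ≋ p′ +ₚ q′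
+ₚ-cong {p} {p′} {q} {q′} p≋ q≋ = coeffs λ k → ≡.trans (coeff-+ₚ p q k)
  (≡.trans (≡.cong₂ ℤ._+_ (at p≋ k) (at q≋ k)) (≡.sym (coeff-+ₚ p′ q′ k)))

+ₚ-comm : ∀ p q → p +ₚ q ≋ q +ₚ p
+ₚ-comm p q = coeffs λ k → ≡.trans (coeff-+ₚ p q k)
  (≡.trans (ℤ.+-comm (coeff p k) (coeff q k)) (≡.sym (coeff-+ₚ q p k)))

+ₚ-assoc : ∀ p q r → (p +ₚ q) +ₚ r ≋ p +ₚ (q +ₚ r)
+ₚ-assoc p q r = coeffs λ k → ≡.trans (≡.trans (coeff-+ₚ (p +ₚ q) r k) (≡.cong (ℤ._+ coeff r k) (coeff-+ₚ p q k)))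
  (≡.trans (ℤ.+-assoc (coeff p k) (coeff q k) (coeff r k))
    (≡.sym (≡.trans (coeff-+ₚ p (q +ₚ r) k) (≡.cong (λ a → coeff p k ℤ.+ a) (coeff-+ₚ q r k)))))

+ₚ-identityʳ : ∀ p → p +ₚ [] ≋ p
+ₚ-identityʳ p = +ₚ-comm p []

-ₚ-cong : ∀ {p q} → p ≋ q → -ₚ p ≋ -ₚ q
-ₚ-cong {p} {q} p≋q = coeffs λ k → ≡.trans (coeff-map ℤ.-_ ≡.refl p k)
  (≡.trans (≡.cong ℤ.-_ (at p≋q k)) (≡.sym (coeff-map ℤ.-_ ≡.refl q k)))

-ₚ-inverseʳ : ∀ p → p +ₚ -ₚ p ≋ []
-ₚ-inverseʳ p = coeffs λ k → ≡.trans (coeff-+ₚ p (-ₚ p) k)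
  (≡.trans (≡.cong (λ a → coeff p k ℤ.+ a) (coeff-map ℤ.-_ ≡.refl p k)) (ℤ.+-inverseʳ (coeff p k)))

infixr 7 _·ₚ_

_·ₚ_ : ℤ → Poly → Poly
a ·ₚ p = map (a ℤ.*_) p

coeff-·ₚ : ∀ a p k → coeff (a ·ₚ p) k ≡ a ℤ.* coeff p k
coeff-·ₚ a = coeff-map (a ℤ.*_) (ℤ.*-zeroʳ a)

·ₚ-cong : ∀ a {p q} → p ≋ q → a ·ₚ p ≋ a ·ₚ q
·ₚ-cong a {p} {q} p≋q = coeffs λ k → ≡.trans (coeff-·ₚ a p k)
  (≡.trans (≡.cong (a ℤ.*_) (at p≋q k)) (≡.sym (coeff-·ₚ a q k)))

·ₚ-distribˡ : ∀ a p q → a ·ₚ (p +ₚ q) ≋ a ·ₚ p +ₚ a ·ₚ q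
·ₚ-distribˡ a p q = coeffs λ k → ≡.trans (≡.trans (coeff-·ₚ a (p +ₚ q) k) (≡.cong (a ℤ.*_) (coeff-+ₚ p q k)))
  (≡.trans (ℤ.*-distribˡ-+ a (coeff p k) (coeff q k))
    (≡.sym (≡.trans (coeff-+ₚ (a ·ₚ p) (a ·ₚ q) k) (≡.cong₂ ℤ._+_ (coeff-·ₚ a p k) (coeff-·ₚ a q k)))))

·ₚ-assoc : ∀ a b p → (a ℤ.* b) ·ₚ p ≋ a ·ₚ b ·ₚ p
·ₚ-assoc a b p = coeffs λ k → ≡.trans (≡.trans (coeff-·ₚ (a ℤ.* b) p k) (ℤ.*-assoc a b (coeff p k)))
  (≡.sym (≡.trans (coeff-·ₚ a (b ·ₚ p) k) (≡.cong (a ℤ.*_) (coeff-·ₚ b p k))))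

·ₚ-identity : ∀ p → 1ℤ ·ₚ p ≋ p
·ₚ-identity p = coeffs λ k → ≡.trans (coeff-·ₚ 1ℤ p k) (ℤ.*-identityˡ (coeff p k))

·ₚ-zero : ∀ p → 0ℤ ·ₚ p ≋ []
·ₚ-zero p = coeffs λ k → ≡.trans (coeff-·ₚ 0ℤ p k) (ℤ.*-zeroˡ (coeff p k))

∷-cong : ∀ {a b p q} → a ≡ b → p ≋ q → a ∷ p ≋ b ∷ q
∷-cong a≡b p≋q = coeffs λ { zero → a≡b ; (suc k) → at p≋q k }

shift-[] : 0ℤ ∷ [] ≋ []
shift-[] = coeffs λ { zero → ≡.refl ; (suc k) → ≡.refl }

+ₚ-interchange : ∀ p q r s → (p +ₚ q) +ₚ (r +ₚ s) ≋ (p +ₚ r) +ₚ (q +ₚ s)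
+ₚ-interchange p q r s = begin
  (p +ₚ q) +ₚ (r +ₚ s)  ≈⟨ +ₚ-assoc p q (r +ₚ s) ⟩
  p +ₚ (q +ₚ (r +ₚ s))  ≈⟨ +ₚ-cong (≋-refl {p}) (≋-trans (≋-sym (+ₚ-assoc q r s))
                             (≋-trans (+ₚ-cong (+ₚ-comm q r) ≋-refl) (+ₚ-assoc r q s))) ⟩
  p +ₚ (r +ₚ (q +ₚ s))  ≈⟨ +ₚ-assoc p r (q +ₚ s) ⟨
  (p +ₚ r) +ₚ (q +ₚ s)  ∎
  where open ≋-Reasoning

*ₚ-congˡ : ∀ p {q r} → q ≋ r → p *ₚ q ≋ p *ₚ r
*ₚ-congˡ []      q≋r = ≋-refl
*ₚ-congˡ (a ∷ p) q≋r = +ₚ-cong (·ₚ-cong a q≋r) (∷-cong ≡.refl (*ₚ-congˡ p q≋r))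

*ₚ-distribˡ : ∀ p q r → p *ₚ (q +ₚ r) ≋ p *ₚ q +ₚ p *ₚ r
*ₚ-distribˡ []      q r = ≋-refl
*ₚ-distribˡ (a ∷ p) q r = ≋-trans (+ₚ-cong (·ₚ-distribˡ a q r) (∷-cong ≡.refl (*ₚ-distribˡ p q r)))
  (+ₚ-interchange (a ·ₚ q) (a ·ₚ r) (0ℤ ∷ p *ₚ q) (0ℤ ∷ p *ₚ r))

*ₚ-zeroʳ : ∀ p → p *ₚ [] ≋ []
*ₚ-zeroʳ []      = ≋-refl
*ₚ-zeroʳ (a ∷ p) = ≋-trans (∷-cong ≡.refl (*ₚ-zeroʳ p)) shift-[]

-- Mirrors in the second factor the defining recursion in the first; commutativity follows by
-- playing one against the other.
*ₚ-∷ : ∀ p b q → p *ₚ (b ∷ q) ≋ b ·ₚ p +ₚ (0ℤ ∷ p *ₚ q)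
*ₚ-∷ []      b q = ≋-sym shift-[]
*ₚ-∷ (a ∷ p) b q = ∷-cong (≡.cong (ℤ._+ 0ℤ) (ℤ.*-comm a b)) (begin
  a ·ₚ q +ₚ p *ₚ (b ∷ q)                 ≈⟨ +ₚ-cong ≋-refl (*ₚ-∷ p b q) ⟩
  a ·ₚ q +ₚ (b ·ₚ p +ₚ (0ℤ ∷ p *ₚ q))    ≈⟨ +ₚ-assoc (a ·ₚ q) (b ·ₚ p) _ ⟨
  (a ·ₚ q +ₚ b ·ₚ p) +ₚ (0ℤ ∷ p *ₚ q)    ≈⟨ +ₚ-cong (+ₚ-comm (a ·ₚ q) (b ·ₚ p)) ≋-refl ⟩
  (b ·ₚ p +ₚ a ·ₚ q) +ₚ (0ℤ ∷ p *ₚ q)    ≈⟨ +ₚ-assoc (b ·ₚ p) (a ·ₚ q) _ ⟩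
  b ·ₚ p +ₚ (a ·ₚ q +ₚ (0ℤ ∷ p *ₚ q))    ∎)
  where open ≋-Reasoning

*ₚ-comm : ∀ p q → p *ₚ q ≋ q *ₚ p
*ₚ-comm []      q = ≋-sym (*ₚ-zeroʳ q)
*ₚ-comm (a ∷ p) q = ≋-trans (+ₚ-cong ≋-refl (∷-cong ≡.refl (*ₚ-comm p q))) (≋-sym (*ₚ-∷ q a p))

*ₚ-cong : ∀ {p p′ q q′} → p ≋ p′ → q ≋ q′ → p *ₚ q ≋ p′ *ₚ q′
*ₚ-cong {p} {p′} {q} {q′} p≋ q≋ = ≋-trans (*ₚ-congˡ p q≋)
  (≋-trans (*ₚ-comm p q′) (≋-trans (*ₚ-congˡ q′ p≋) (*ₚ-comm q′ p′)))

*ₚ-distribʳ : ∀ p q r → (q +ₚ r) *ₚ p ≋ q *ₚ p +ₚ r *ₚ p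
*ₚ-distribʳ p q r = ≋-trans (*ₚ-comm (q +ₚ r) p)
  (≋-trans (*ₚ-distribˡ p q r) (+ₚ-cong (*ₚ-comm p q) (*ₚ-comm p r)))

·ₚ-*ₚ : ∀ a p q → (a ·ₚ p) *ₚ q ≋ a ·ₚ (p *ₚ q)
·ₚ-*ₚ a []      q = ≋-refl
·ₚ-*ₚ a (b ∷ p) q = ≋-trans
  (+ₚ-cong (·ₚ-assoc a b q) (∷-cong (≡.sym (ℤ.*-zeroʳ a)) (·ₚ-*ₚ a p q)))
  (≋-sym (·ₚ-distribˡ a (b ·ₚ q) (0ℤ ∷ p *ₚ q)))

shift-*ₚ : ∀ p q → (0ℤ ∷ p) *ₚ q ≋ 0ℤ ∷ p *ₚ q
shift-*ₚ p q = +ₚ-cong (·ₚ-zero q) (≋-refl {0ℤ ∷ p *ₚ q})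

*ₚ-assoc : ∀ p q r → (p *ₚ q) *ₚ r ≋ p *ₚ (q *ₚ r)
*ₚ-assoc []      q r = ≋-refl
*ₚ-assoc (a ∷ p) q r = ≋-trans (*ₚ-distribʳ r (a ·ₚ q) (0ℤ ∷ p *ₚ q))
  (+ₚ-cong (·ₚ-*ₚ a q r) (≋-trans (shift-*ₚ (p *ₚ q) r) (∷-cong ≡.refl (*ₚ-assoc p q r))))

constₚ-*ₚ : ∀ a p → constₚ a *ₚ p ≋ a ·ₚ p
constₚ-*ₚ a p = ≋-trans (+ₚ-cong (≋-refl {a ·ₚ p}) shift-[]) (+ₚ-identityʳ (a ·ₚ p))

*ₚ-identityˡ : ∀ p → constₚ 1ℤ *ₚ p ≋ p
*ₚ-identityˡ p = ≋-trans (constₚ-*ₚ 1ℤ p) (·ₚ-identity p)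

Poly-isCommutativeRing : IsCommutativeRing _≋_ _+ₚ_ _*ₚ_ -ₚ_ [] (constₚ 1ℤ)
Poly-isCommutativeRing = record
  { isRing = record
    { +-isAbelianGroup = record
      { isGroup = record
        { isMonoid = record
          { isSemigroup = record
            { isMagma = record { isEquivalence = ≋-isEquivalence ; ∙-cong = +ₚ-cong }
            ; assoc   = +ₚ-assoc
            }
          ; identity = (λ p → ≋-refl) , +ₚ-identityʳ
          }
        ; inverse = (λ p → ≋-trans (+ₚ-comm (-ₚ p) p) (-ₚ-inverseʳ p)) , -ₚ-inverseʳ
        ; ⁻¹-cong = -ₚ-cong
        }
      ; comm = +ₚ-comm
      }
    ; *-cong     = *ₚ-cong
    ; *-assoc    = *ₚ-assoc
    ; *-identity = *ₚ-identityˡ , λ p → ≋-trans (*ₚ-comm p _) (*ₚ-identityˡ p)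
    ; distrib    = *ₚ-distribˡ , *ₚ-distribʳ
    }
  ; *-comm = *ₚ-comm
  }

Poly-commutativeRing : CommutativeRing 0ℓ 0ℓ
Poly-commutativeRing = record { isCommutativeRing = Poly-isCommutativeRing }

1-z+z≋1 : 1-z +ₚ z ≋ constₚ 1ℤ
1-z+z≋1 = coeffs λ { zero → ≡.refl ; (suc zero) → ≡.refl ; (suc (suc k)) → ≡.refl }

-- Coefficient k + 1 of (1 - z) p is the difference of coefficients k + 1 and k of p, so those of p
-- are recovered from the constant term upwards.
1-z-cancelˡ : ∀ {p q} → 1-z *ₚ p ≋ 1-z *ₚ q → p ≋ q
1-z-cancelˡ {p} {q} eq = coeffs go
  where
  open Algebra.Properties.AbelianGroup ℤ.+-0-abelianGroup using (∙-cancelʳ)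

  expand : ∀ p → 1-z *ₚ p ≋ p +ₚ (0ℤ ∷ -1ℤ ·ₚ p)
  expand p = +ₚ-cong (·ₚ-identity p) (∷-cong ≡.refl (constₚ-*ₚ -1ℤ p))

  coeff-suc : ∀ p k → coeff (1-z *ₚ p) (suc k) ≡ coeff p (suc k) ℤ.+ -1ℤ ℤ.* coeff p k
  coeff-suc p k = ≡.trans (at (expand p) (suc k)) (≡.trans (coeff-+ₚ p (0ℤ ∷ -1ℤ ·ₚ p) (suc k))
    (≡.cong (λ a → coeff p (suc k) ℤ.+ a) (coeff-·ₚ -1ℤ p k)))

  coeff-zero : ∀ p → coeff (1-z *ₚ p) 0 ≡ coeff p 0
  coeff-zero p = ≡.trans (at (expand p) 0) (≡.trans (coeff-+ₚ p (0ℤ ∷ -1ℤ ·ₚ p) 0) (ℤ.+-identityʳ _))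

  go : ∀ k → coeff p k ≡ coeff q k
  go zero    = ≡.trans (≡.sym (coeff-zero p)) (≡.trans (at eq 0) (coeff-zero q))
  go (suc k) = ∙-cancelʳ (-1ℤ ℤ.* coeff p k) _ _ (≡.trans (≡.sym (coeff-suc p k)) (≡.trans (at eq (suc k))
    (≡.trans (coeff-suc q k) (≡.cong (λ a → coeff q (suc k) ℤ.+ -1ℤ ℤ.* a) (≡.sym (go k))))))

-- The barycentric subdivision

filter-cong-∈ : {P : Pred A p} {Q : Pred A q} (P? : Decidable P) (Q? : Decidable Q) (xs : List A) →
  (∀ {x} → x ∈ xs → P x → Q x) → (∀ {x} → x ∈ xs → Q x → P x) → filter P? xs ≡ filter Q? xs
filter-cong-∈ P? Q? []       P⇒Q Q⇒P = ≡.refl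
filter-cong-∈ P? Q? (x ∷ xs) P⇒Q Q⇒P with P? x | filter-cong-∈ P? Q? xs (P⇒Q ∘ there) (Q⇒P ∘ there)
... | yes Px | ih = ≡.trans (≡.cong (x ∷_) ih) (≡.sym (List.filter-accept Q? (P⇒Q (here ≡.refl) Px)))
... | no ¬Px | ih = ≡.trans ih (≡.sym (List.filter-reject Q? (¬Px ∘ Q⇒P (here ≡.refl))))

filter-filter : {P : Pred A p} {Q : Pred A q} (P? : Decidable P) (Q? : Decidable Q) (xs : List A) →
  filter P? (filter Q? xs) ≡ filter (λ x → Q? x ×-dec P? x) xs
filter-filter P? Q? []       = ≡.refl
filter-filter P? Q? (x ∷ xs) with does (Q? x)
... | false = filter-filter P? Q? xs
... | true with does (P? x)
...   | false = filter-filter P? Q? xs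
...   | true  = ≡.cong (x ∷_) (filter-filter P? Q? xs)

module _ {A : Set} where

  sublists-All : {P : Pred A p} {xs : List A} → All P xs → All (All P) (sublists xs)
  sublists-All []         = [] ∷ []
  sublists-All (px ∷ pxs) = All.++⁺ (All.map⁺ (All.map (px ∷_) (sublists-All pxs))) (sublists-All pxs)

  filter-all-sublists : {P : Pred A p} (P? : Decidable P) (xs : List A) →
    filter (All.all? P?) (sublists xs) ≡ sublists (filter P? xs)
  filter-all-sublists P? []       = ≡.refl
  filter-all-sublists P? (x ∷ xs) with P? x in Px
  ... | yes px = begin
    filter (All.all? P?) (map (x ∷_) (sublists xs) ++ sublists xs)
      ≡⟨ List.filter-++ (All.all? P?) (map (x ∷_) (sublists xs)) (sublists xs) ⟩
    filter (All.all? P?) (map (x ∷_) (sublists xs)) ++ filter (All.all? P?) (sublists xs)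
      ≡⟨ ≡.cong (_++ _) (filter-map (All.all? P?) (x ∷_) (sublists xs)) ⟩
    map (x ∷_) (filter (All.all? P? ∘ (x ∷_)) (sublists xs)) ++ filter (All.all? P?) (sublists xs)
      ≡⟨ ≡.cong (λ yss → map (x ∷_) yss ++ filter (All.all? P?) (sublists xs))
           (filter-cong-∈ (All.all? P? ∘ (x ∷_)) (All.all? P?) (sublists xs) (λ _ → All.tail) (λ _ → px ∷_)) ⟩
    map (x ∷_) (filter (All.all? P?) (sublists xs)) ++ filter (All.all? P?) (sublists xs)
      ≡⟨ ≡.cong (λ yss → map (x ∷_) yss ++ yss) (filter-all-sublists P? xs) ⟩
    map (x ∷_) (sublists (filter P? xs)) ++ sublists (filter P? xs) ∎
    where open ≡.≡-Reasoning
  ... | no ¬px = begin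
    filter (All.all? P?) (map (x ∷_) (sublists xs) ++ sublists xs)
      ≡⟨ List.filter-++ (All.all? P?) (map (x ∷_) (sublists xs)) (sublists xs) ⟩
    filter (All.all? P?) (map (x ∷_) (sublists xs)) ++ filter (All.all? P?) (sublists xs)
      ≡⟨ ≡.cong (_++ _) (List.filter-none (All.all? P?)
           (All.map⁺ (All.universal (λ ys pys → ¬px (All.head pys)) (sublists xs)))) ⟩
    filter (All.all? P?) (sublists xs)
      ≡⟨ filter-all-sublists P? xs ⟩
    sublists (filter P? xs) ∎
    where open ≡.≡-Reasoning

-- Counting chains of subsets

private
  module ℕ∑ = ListSum ℕ.+-*-commutativeSemiring
  open ℕ∑ using () renaming (∑ to ∑ℕ; [_]·_ to [_]ℕ·_)
  open BinomialTransform ℕ.+-*-commutativeSemiring using () renaming (T to Tℕ)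

-- The list order is a linear extension of inclusion, so the first listed member of a chain is its
-- least.
Ascending : List (Subset n) → Set
Ascending = AllPairs λ F G → ¬ G ⊆ F

chain? : Decidable (AllPairs (Comparable {n}))
chain? = allPairs? λ F G → (F ⊆? G) ⊎-dec (G ⊆? F)

chains : List (Subset n) → ℕ → ℕ
chains xs       zero    = 1
chains []       (suc i) = 0
chains (F ∷ xs) (suc i) = chains (filter (F ⊆?_) xs) i ℕ.+ chains xs (suc i)

chainLists : List (Subset n) → ℕ → List (List (Subset n))
chainLists xs i = filter (λ ys → length ys ℕ.≟ i) (filter chain? (sublists xs))

module _ (F : Subset n) (xs : List (Subset n)) (F≺xs : All (λ G → ¬ G ⊆ F) xs) where

  chains-from : filter (chain? ∘ (F ∷_)) (sublists xs) ≡ filter chain? (sublists (filter (F ⊆?_) xs))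
  chains-from = begin
    filter (chain? ∘ (F ∷_)) (sublists xs)
      ≡⟨ filter-cong-∈ (chain? ∘ (F ∷_)) (λ ys → All.all? (F ⊆?_) ys ×-dec chain? ys) (sublists xs)
           (λ { {ys} ys∈ (F~ys ∷ ys-chain) → comparable⇒⊆ (All.lookup (sublists-All F≺xs) ys∈) F~ys , ys-chain })
           (λ { _ (F⊆ys , ys-chain) → All.map inj₁ F⊆ys ∷ ys-chain }) ⟩
    filter (λ ys → All.all? (F ⊆?_) ys ×-dec chain? ys) (sublists xs)
      ≡⟨ filter-filter chain? (All.all? (F ⊆?_)) (sublists xs) ⟨
    filter chain? (filter (All.all? (F ⊆?_)) (sublists xs))
      ≡⟨ ≡.cong (filter chain?) (filter-all-sublists (F ⊆?_) xs) ⟩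
    filter chain? (sublists (filter (F ⊆?_) xs)) ∎
    where
    open ≡.≡-Reasoning

    comparable⇒⊆ : ∀ {ys} → All (λ G → ¬ G ⊆ F) ys → All (Comparable F) ys → All (F ⊆_) ys
    comparable⇒⊆ []           []                = []
    comparable⇒⊆ (_   ∷ F≺ys) (inj₁ F⊆G ∷ F~ys) = F⊆G ∷ comparable⇒⊆ F≺ys F~ys
    comparable⇒⊆ (G⊈F ∷ _)    (inj₂ G⊆F ∷ _)    = ⊥-elim (G⊈F G⊆F)

  chainLists-∷ : ∀ i → chainLists (F ∷ xs) i ≡
    map (F ∷_) (filter (λ ys → suc (length ys) ℕ.≟ i) (filter chain? (sublists (filter (F ⊆?_) xs))))
    ++ chainLists xs i
  chainLists-∷ i = begin
    filter len? (filter chain? (map (F ∷_) (sublists xs) ++ sublists xs))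
      ≡⟨ ≡.cong (filter len?) (List.filter-++ chain? (map (F ∷_) (sublists xs)) (sublists xs)) ⟩
    filter len? (filter chain? (map (F ∷_) (sublists xs)) ++ filter chain? (sublists xs))
      ≡⟨ List.filter-++ len? (filter chain? (map (F ∷_) (sublists xs))) _ ⟩
    filter len? (filter chain? (map (F ∷_) (sublists xs))) ++ chainLists xs i
      ≡⟨ ≡.cong (λ yss → filter len? yss ++ chainLists xs i)
           (≡.trans (filter-map chain? (F ∷_) (sublists xs)) (≡.cong (map (F ∷_)) chains-from)) ⟩
    filter len? (map (F ∷_) (filter chain? (sublists (filter (F ⊆?_) xs)))) ++ chainLists xs i
      ≡⟨ ≡.cong (_++ chainLists xs i) (filter-map len? (F ∷_) (filter chain? (sublists (filter (F ⊆?_) xs)))) ⟩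
    map (F ∷_) (filter (len? ∘ (F ∷_)) (filter chain? (sublists (filter (F ⊆?_) xs)))) ++ chainLists xs i ∎
    where
    open ≡.≡-Reasoning

    len? : ∀ (ys : List (Subset n)) → Dec (length ys ≡ i)
    len? ys = length ys ℕ.≟ i

length-chainLists : (xs : List (Subset n)) → Ascending xs → ∀ i → length (chainLists xs i) ≡ chains xs i
length-chainLists []       []                zero    = ≡.refl
length-chainLists []       []                (suc i) = ≡.refl
length-chainLists (F ∷ xs) (F≺xs ∷ xs-asc) zero    = begin
  length (chainLists (F ∷ xs) 0)
    ≡⟨ ≡.cong length (chainLists-∷ F xs F≺xs 0) ⟩
  length (map (F ∷_) (filter (λ ys → suc (length ys) ℕ.≟ 0) (above)) ++ chainLists xs 0)
    ≡⟨ ≡.cong (λ yss → length (map (F ∷_) yss ++ chainLists xs 0))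
         (List.filter-none (λ ys → suc (length ys) ℕ.≟ 0) (All.universal (λ _ ()) above)) ⟩
  length (chainLists xs 0)
    ≡⟨ length-chainLists xs xs-asc 0 ⟩
  1 ∎
  where
  open ≡.≡-Reasoning

  above : List (List (Subset _))
  above = filter chain? (sublists (filter (F ⊆?_) xs))
length-chainLists (F ∷ xs) (F≺xs ∷ xs-asc) (suc i) = begin
  length (chainLists (F ∷ xs) (suc i))
    ≡⟨ ≡.cong length (chainLists-∷ F xs F≺xs (suc i)) ⟩
  length (map (F ∷_) (filter (λ ys → suc (length ys) ℕ.≟ suc i) above) ++ chainLists xs (suc i))
    ≡⟨ List.length-++ (map (F ∷_) (filter (λ ys → suc (length ys) ℕ.≟ suc i) above)) ⟩
  length (map (F ∷_) (filter (λ ys → suc (length ys) ℕ.≟ suc i) above)) ℕ.+ length (chainLists xs (suc i))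
    ≡⟨ ≡.cong₂ ℕ._+_ (≡.trans (List.length-map (F ∷_) (filter (λ ys → suc (length ys) ℕ.≟ suc i) above))
         (≡.trans (≡.cong length (filter-cong-∈ (λ ys → suc (length ys) ℕ.≟ suc i) (λ ys → length ys ℕ.≟ i) above
                   (λ _ → ℕ.suc-injective) (λ _ → ≡.cong suc)))
                (length-chainLists (filter (F ⊆?_) xs) (AllPairs.filter⁺ (F ⊆?_) xs-asc) i)))
         (length-chainLists xs xs-asc (suc i)) ⟩
  chains (F ∷ xs) (suc i) ∎
  where
  open ≡.≡-Reasoning

  above : List (List (Subset _))
  above = filter chain? (sublists (filter (F ⊆?_) xs))

-- Unrolls the recursion over the choice of the least member. Filtering the whole list by `F ⊂?_`
-- agrees with filtering the tail after F by `F ⊆?_`, because in an ascending list everything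
-- strictly above F comes later.
chains-suc : (xs : List (Subset n)) → Ascending xs → ∀ i →
             chains xs (suc i) ≡ ∑ℕ xs (λ F → chains (filter (F ⊂?_) xs) i)
chains-suc []       []              i = ≡.refl
chains-suc (F ∷ xs) (F≺xs ∷ xs-asc) i = ≡.cong₂ ℕ._+_
  (≡.cong (λ ys → chains ys i) (≡.sym (≡.trans (List.filter-reject (F ⊂?_) λ { (_ , _ , x∈F , x∉F) → x∉F x∈F })
    (filter-cong-∈ (F ⊂?_) (F ⊆?_) xs (λ _ → proj₁) λ {G} G∈ F⊆G → ⊆∧⊉⇒⊂ F⊆G (All.lookup F≺xs G∈)))))
  (≡.trans (chains-suc xs xs-asc i) (ℕ∑.∑-cong-∈ xs λ {G} G∈ →
    ≡.cong (λ ys → chains ys i) (≡.sym (List.filter-reject (G ⊂?_) λ { (G⊆F , _) → All.lookup F≺xs G∈ G⊆F }))))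
  where
  ⊆∧⊉⇒⊂ : ∀ {n} {F G : Subset n} → F ⊆ G → ¬ G ⊆ F → F ⊂ G
  ⊆∧⊉⇒⊂ {n = zero}  {[]}          {[]}          F⊆G G⊈F = ⊥-elim (G⊈F λ ())
  ⊆∧⊉⇒⊂ {n = suc n} {outside ∷ F} {outside ∷ G} F⊆G G⊈F = out⊂ (⊆∧⊉⇒⊂ (drop-∷-⊆ F⊆G) (G⊈F ∘ out⊆))
  ⊆∧⊉⇒⊂ {n = suc n} {outside ∷ F} {inside  ∷ G} F⊆G G⊈F = out⊂in (drop-∷-⊆ F⊆G)
  ⊆∧⊉⇒⊂ {n = suc n} {inside  ∷ F} {outside ∷ G} F⊆G G⊈F = contradiction (F⊆G Vec.here) λ ()
  ⊆∧⊉⇒⊂ {n = suc n} {inside  ∷ F} {inside  ∷ G} F⊆G G⊈F = in⊂in (⊆∧⊉⇒⊂ (drop-∷-⊆ F⊆G) (G⊈F ∘ in⊆in))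

subsets-ascending : ∀ n → Ascending (subsets n)
subsets-ascending zero    = [] ∷ []
subsets-ascending (suc n) = AllPairs.++⁺
  (AllPairs.map⁺ (AllPairs.map (_∘ drop-∷-⊆) (subsets-ascending n)))
  (AllPairs.++⁺ (AllPairs.map⁺ (AllPairs.map (_∘ drop-∷-⊆) (subsets-ascending n))) []
    (All.universal (λ _ → []) _))
  (All.map⁺ (All.universal (λ F → All.++⁺
    (All.map⁺ (All.universal (λ G in⊆out → contradiction (in⊆out Vec.here) λ ()) (subsets n))) [])
    (subsets n)))

closed? : (G F X : Subset n) → Dec (G ⊆ X × X ⊆ F)
closed? G F X = (G ⊆? X) ×-dec (X ⊆? F)

halfOpen? : (G F X : Subset n) → Dec (G ⊂ X × X ⊆ F)
halfOpen? G F X = (G ⊂? X) ×-dec (X ⊆? F)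

-- Open at G, so that G = ⊥ gives the nonempty subsets of F and a least member X can serve as the
-- next lower end.
interval : Subset n → Subset n → List (Subset n)
interval {n} G F = filter (halfOpen? G F) (subsets n)

interval-ascending : (G F : Subset n) → Ascending (interval G F)
interval-ascending {n} G F = AllPairs.filter⁺ _ (subsets-ascending n)

⊂-⊂-trans : {F G H : Subset n} → F ⊂ G → G ⊂ H → F ⊂ H
⊂-⊂-trans (F⊆G , _) (G⊆H , x , x∈H , x∉G) = ⊆-trans F⊆G G⊆H , x , x∈H , x∉G ∘ F⊆G

filter-interval : (G F X : Subset n) → G ⊂ X → filter (X ⊂?_) (interval G F) ≡ interval X F
filter-interval {n} G F X G⊂X = ≡.trans (filter-filter (X ⊂?_) _ (subsets n))
  (filter-cong-∈ _ _ (subsets n)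
    (λ { _ ((_ , Y⊆F) , X⊂Y) → X⊂Y , Y⊆F })
    (λ { _ (X⊂Y , Y⊆F) → (⊂-⊂-trans G⊂X X⊂Y , Y⊆F) , X⊂Y }))

-- T⁺ φ k = ∑ (k choose j) φ j over j < k.

T⁺ : (ℕ → ℕ) → ℕ → ℕ
T⁺ φ zero    = 0
T⁺ φ (suc k) = Tℕ 1 φ k ℕ.+ T⁺ (φ ∘ suc) k

T⁺-+ : ∀ φ k → T⁺ φ k ℕ.+ φ k ≡ Tℕ 1 φ k
T⁺-+ φ zero    = ≡.refl
T⁺-+ φ (suc k) = ≡.trans (ℕ.+-assoc (Tℕ 1 φ k) _ _) (≡.cong₂ ℕ._+_ (≡.sym (ℕ.*-identityˡ _)) (T⁺-+ (φ ∘ suc) k))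

∑-subsets-suc : ∀ n (f : Subset (suc n) → ℕ) →
  ∑ℕ (subsets (suc n)) f ≡ ∑ℕ (subsets n) (f ∘ (outside ∷_)) ℕ.+ ∑ℕ (subsets n) (f ∘ (inside ∷_))
∑-subsets-suc n f = ≡.trans (ℕ∑.∑-cartesianProductWith _∷_ (outside ∷ inside ∷ []) (subsets n) f)
  (≡.cong (∑ℕ (subsets n) (f ∘ (outside ∷_)) ℕ.+_) (ℕ.+-identityʳ _))

∑-no : {P : Pred A p} (P? : Decidable P) (xs : List A) (f : A → ℕ) → (∀ x → ¬ P x) →
       ∑ℕ xs (λ x → [ P? x ]ℕ· f x) ≡ 0
∑-no P? xs f ¬P = ≡.trans (ℕ∑.∑-cong xs λ x → ℕ∑.[]·-no (P? x) (¬P x)) (ℕ∑.∑-zero xs)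

suc-∸ : {F G : Subset n} → G ⊆ F → suc ∣ F ∣ ∸ ∣ G ∣ ≡ suc (∣ F ∣ ∸ ∣ G ∣)
suc-∸ G⊆F = ℕ.+-∸-assoc 1 (p⊆q⇒∣p∣≤∣q∣ G⊆F)

-- Where G and F agree, X is forced; where F exceeds G, the two choices for X give the two terms of
-- `Tℕ 1`. The argument of φ is the room left above X for the rest of a chain.
∑-closed : (φ : ℕ → ℕ) (G F : Subset n) → G ⊆ F →
  ∑ℕ (subsets n) (λ X → [ closed? G F X ]ℕ· φ (∣ F ∣ ∸ ∣ X ∣)) ≡ Tℕ 1 φ (∣ F ∣ ∸ ∣ G ∣)
∑-closed φ []            []            G⊆F = ℕ.+-identityʳ (φ 0)
∑-closed {suc n} φ (outside ∷ G) (outside ∷ F) G⊆F = ≡.trans (∑-subsets-suc n _) (≡.trans (≡.cong₂ ℕ._+_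
  (≡.trans (ℕ∑.∑-cong (subsets n) λ X → ℕ∑.[]·-cong
      (closed? (outside ∷ G) (outside ∷ F) (outside ∷ X)) (closed? G F X)
    (λ { (l , u) → drop-∷-⊆ l , drop-∷-⊆ u }) (λ { (l , u) → out⊆ l , out⊆ u }) λ _ → ≡.refl)
    (∑-closed φ G F (drop-∷-⊆ G⊆F)))
  (∑-no (closed? (outside ∷ G) (outside ∷ F) ∘ (inside ∷_)) (subsets n) (λ X → φ (∣ F ∣ ∸ suc ∣ X ∣))
    λ { X (_ , in⊆out) → contradiction (in⊆out Vec.here) λ () }))
  (ℕ.+-identityʳ _))
∑-closed {suc n} φ (inside ∷ G) (outside ∷ F) G⊆F = contradiction (G⊆F Vec.here) λ ()
∑-closed {suc n} φ (inside ∷ G) (inside ∷ F) G⊆F = ≡.trans (∑-subsets-suc n _) (≡.cong₂ ℕ._+_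
  (∑-no (closed? (inside ∷ G) (inside ∷ F) ∘ (outside ∷_)) (subsets n) (λ X → φ (suc ∣ F ∣ ∸ ∣ X ∣))
    λ { X (in⊆out , _) → contradiction (in⊆out Vec.here) λ () })
  (≡.trans (ℕ∑.∑-cong (subsets n) λ X → ℕ∑.[]·-cong
      (closed? (inside ∷ G) (inside ∷ F) (inside ∷ X)) (closed? G F X)
    (λ { (l , u) → drop-∷-⊆ l , drop-∷-⊆ u }) (λ { (l , u) → in⊆in l , in⊆in u }) λ _ → ≡.refl)
    (∑-closed φ G F (drop-∷-⊆ G⊆F))))
∑-closed {suc n} φ (outside ∷ G) (inside ∷ F) G⊆F = ≡.trans (∑-subsets-suc n _)
  -- `subsets` lists `outside` first, but the choice `inside` leaves φ unshifted and so matches the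
  -- first term of `Tℕ`.
  (≡.trans (ℕ.+-comm (∑ℕ (subsets n) _) _) (≡.trans (≡.cong₂ ℕ._+_
    (≡.trans (ℕ∑.∑-cong (subsets n) λ X → ℕ∑.[]·-cong
        (closed? (outside ∷ G) (inside ∷ F) (inside ∷ X)) (closed? G F X)
      (λ { (l , u) → drop-∷-⊆ l , drop-∷-⊆ u }) (λ { (l , u) → out⊆ l , in⊆in u }) λ _ → ≡.refl)
      (≡.trans (∑-closed φ G F G⊆F′) (≡.sym (ℕ.*-identityˡ _))))
    (≡.trans (ℕ∑.∑-cong (subsets n) λ X → ℕ∑.[]·-cong
        (closed? (outside ∷ G) (inside ∷ F) (outside ∷ X)) (closed? G F X)
      (λ { (l , u) → drop-∷-⊆ l , drop-∷-⊆ u }) (λ { (l , u) → out⊆ l , out⊆ u })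
      λ { (_ , u) → ≡.cong φ (suc-∸ (drop-∷-⊆ u)) })
      (∑-closed (φ ∘ suc) G F G⊆F′)))
    (≡.cong (Tℕ 1 φ) (≡.sym (suc-∸ G⊆F′)))))
  where
  G⊆F′ : G ⊆ F
  G⊆F′ = drop-∷-⊆ G⊆F

-- At an element of F outside G, putting it into X already makes the inclusion G ⊂ X strict and
-- leaves a closed interval; omitting it leaves a half-open one. These are the two terms of `T⁺`.
∑-half-open : (φ : ℕ → ℕ) (G F : Subset n) → G ⊆ F →
  ∑ℕ (subsets n) (λ X → [ halfOpen? G F X ]ℕ· φ (∣ F ∣ ∸ ∣ X ∣)) ≡ T⁺ φ (∣ F ∣ ∸ ∣ G ∣)
∑-half-open φ []            []            G⊆F = ≡.refl
∑-half-open {suc n} φ (outside ∷ G) (outside ∷ F) G⊆F = ≡.trans (∑-subsets-suc n _) (≡.trans (≡.cong₂ ℕ._+_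
  (≡.trans (ℕ∑.∑-cong (subsets n) λ X → ℕ∑.[]·-cong
      (halfOpen? (outside ∷ G) (outside ∷ F) (outside ∷ X)) (halfOpen? G F X)
    (λ { (l , u) → drop-∷-⊂ l , drop-∷-⊆ u }) (λ { (l , u) → out⊂ l , out⊆ u }) λ _ → ≡.refl)
    (∑-half-open φ G F (drop-∷-⊆ G⊆F)))
  (∑-no (halfOpen? (outside ∷ G) (outside ∷ F) ∘ (inside ∷_)) (subsets n) (λ X → φ (∣ F ∣ ∸ suc ∣ X ∣))
    λ { X (_ , in⊆out) → contradiction (in⊆out Vec.here) λ () }))
  (ℕ.+-identityʳ _))
∑-half-open {suc n} φ (inside ∷ G) (outside ∷ F) G⊆F = contradiction (G⊆F Vec.here) λ ()
∑-half-open {suc n} φ (inside ∷ G) (inside ∷ F) G⊆F = ≡.trans (∑-subsets-suc n _) (≡.cong₂ ℕ._+_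
  (∑-no (halfOpen? (inside ∷ G) (inside ∷ F) ∘ (outside ∷_)) (subsets n) (λ X → φ (suc ∣ F ∣ ∸ ∣ X ∣))
    λ { X ((in⊆out , _) , _) → contradiction (in⊆out Vec.here) λ () })
  (≡.trans (ℕ∑.∑-cong (subsets n) λ X → ℕ∑.[]·-cong
      (halfOpen? (inside ∷ G) (inside ∷ F) (inside ∷ X)) (halfOpen? G F X)
    (λ { (l , u) → drop-∷-⊂ l , drop-∷-⊆ u }) (λ { (l , u) → in⊂in l , in⊆in u }) λ _ → ≡.refl)
    (∑-half-open φ G F (drop-∷-⊆ G⊆F))))
∑-half-open {suc n} φ (outside ∷ G) (inside ∷ F) G⊆F = ≡.trans (∑-subsets-suc n _)
  (≡.trans (ℕ.+-comm (∑ℕ (subsets n) _) _) (≡.trans (≡.cong₂ ℕ._+_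
    (≡.trans (ℕ∑.∑-cong (subsets n) λ X → ℕ∑.[]·-cong
        (halfOpen? (outside ∷ G) (inside ∷ F) (inside ∷ X)) (closed? G F X)
      (λ { (l , u) → drop-∷-⊆ (proj₁ l) , drop-∷-⊆ u }) (λ { (l , u) → out⊂in l , in⊆in u }) λ _ → ≡.refl)
      (∑-closed φ G F G⊆F′))
    (≡.trans (ℕ∑.∑-cong (subsets n) λ X → ℕ∑.[]·-cong
        (halfOpen? (outside ∷ G) (inside ∷ F) (outside ∷ X)) (halfOpen? G F X)
      (λ { (l , u) → drop-∷-⊂ l , drop-∷-⊆ u }) (λ { (l , u) → out⊂ l , out⊆ u })
      λ { (_ , u) → ≡.cong φ (suc-∸ (drop-∷-⊆ u)) })
      (∑-half-open (φ ∘ suc) G F G⊆F′)))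
    (≡.cong (T⁺ φ) (≡.sym (suc-∸ G⊆F′)))))
  where
  G⊆F′ : G ⊆ F
  G⊆F′ = drop-∷-⊆ G⊆F

-- The number of chains of i nonempty subsets of a k-element set.

chainNumber : ℕ → ℕ → ℕ
chainNumber k zero    = 1
chainNumber k (suc i) = T⁺ (λ m → chainNumber m i) k

chains-interval : ∀ i (G F : Subset n) → G ⊆ F → chains (interval G F) i ≡ chainNumber (∣ F ∣ ∸ ∣ G ∣) i
chains-interval zero    G F G⊆F = ≡.refl
chains-interval {n} (suc i) G F G⊆F = begin
  chains (interval G F) (suc i)
    ≡⟨ chains-suc (interval G F) (interval-ascending G F) i ⟩
  ∑ℕ (interval G F) (λ X → chains (filter (X ⊂?_) (interval G F)) i)
    ≡⟨ ℕ∑.∑-cong-∈ (interval G F) (λ {X} X∈ →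
         let G⊂X , X⊆F = proj₂ (∈-filter⁻ (halfOpen? G F) {xs = subsets n} X∈) in
         ≡.trans (≡.cong (λ xs → chains xs i) (filter-interval G F X G⊂X)) (chains-interval i X F X⊆F)) ⟩
  ∑ℕ (interval G F) (λ X → chainNumber (∣ F ∣ ∸ ∣ X ∣) i)
    ≡⟨ ℕ∑.∑-filter (halfOpen? G F) (subsets n) _ ⟩
  ∑ℕ (subsets n) (λ X → [ halfOpen? G F X ]ℕ· chainNumber (∣ F ∣ ∸ ∣ X ∣) i)
    ≡⟨ ∑-half-open (λ m → chainNumber m i) G F G⊆F ⟩
  chainNumber (∣ F ∣ ∸ ∣ G ∣) (suc i) ∎
  where open ≡.≡-Reasoning

T⁺-zero : ∀ φ k → (∀ m → m ℕ.< k → φ m ≡ 0) → T⁺ φ k ≡ 0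
T⁺-zero φ zero    φ≡0 = ≡.refl
T⁺-zero φ (suc k) φ≡0 = ≡.cong₂ ℕ._+_ (T-zero φ k λ m m≤k → φ≡0 m (s≤s m≤k))
  (T⁺-zero (φ ∘ suc) k λ m m<k → φ≡0 (suc m) (s≤s m<k))
  where
  T-zero : ∀ φ k → (∀ m → m ℕ.≤ k → φ m ≡ 0) → Tℕ 1 φ k ≡ 0
  T-zero φ zero    φ≡0 = φ≡0 0 z≤n
  T-zero φ (suc k) φ≡0 = ≡.cong₂ (λ u v → 1 ℕ.* u ℕ.+ v) (T-zero φ k λ m m≤k → φ≡0 m (ℕ.m≤n⇒m≤1+n m≤k))
    (T-zero (φ ∘ suc) k λ m m≤k → φ≡0 (suc m) (s≤s m≤k))

chainNumber-> : ∀ {k i} → k ℕ.< i → chainNumber k i ≡ 0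
chainNumber-> {k} {suc i} k<1+i = T⁺-zero _ k λ m m<k → chainNumber-> (ℕ.<-≤-trans m<k (ℕ.s≤s⁻¹ k<1+i))

-- These are the full flags. By `T⁺-+`, `chainNumber k k` is a summand of the `Tℕ 1` part of
-- `chainNumber (suc k) (suc k)`.
chainNumber-pos : ∀ k → 0 ℕ.< chainNumber k k
chainNumber-pos zero    = s≤s z≤n
chainNumber-pos (suc k) = ℕ.<-≤-trans (chainNumber-pos k)
  (ℕ.≤-trans (ℕ.m≤n+m _ (T⁺ (λ m → chainNumber m k) k))
    (ℕ.≤-trans (ℕ.≤-reflexive (T⁺-+ (λ m → chainNumber m k) k)) (ℕ.m≤m+n _ _)))

-- The subdivision restricted to a face

module _ (F : Subset n) where

  private
    Ω : Complex (Subset n)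
    Ω = restrict (barycentricSubdivision n) F

  open Complex Ω using (vertices; face?; faces; f; size)

  ∪⊥⊆ : ∀ {X G : Subset n} → X ⊆ G → ⋃ [ X ] ⊆ G
  ∪⊥⊆ {X} X⊆G x∈ with x∈p∪q⁻ X ⊥ x∈
  ... | inj₁ x∈X = X⊆G x∈X
  ... | inj₂ x∈⊥ = contradiction x∈⊥ ∉⊥

  vertices≡interval : vertices ≡ interval ⊥ F
  vertices≡interval = ≡.trans (filter-filter _ nonempty? (subsets n)) (filter-cong-∈ _ _ (subsets n)
    (λ { {X} _ ((x , x∈X) , X⊆F) → (⊥⊆ , x , x∈X , ∉⊥) , ⊆-trans (p⊆p∪q ⊥) X⊆F })
    (λ { {X} _ ((_ , x , x∈X , _) , X⊆F) → (x , x∈X) , ∪⊥⊆ X⊆F }))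

  interval-⊆ : All (_⊆ F) (interval ⊥ F)
  interval-⊆ = All.map proj₂ (All.all-filter (halfOpen? ⊥ F) (subsets n))

  ⋃-⊆ : ∀ {xs : List (Subset n)} → All (_⊆ F) xs → ⋃ xs ⊆ F
  ⋃-⊆ []                   x∈ = contradiction x∈ ∉⊥
  ⋃-⊆ {X ∷ xs} (X⊆F ∷ xs⊆F) x∈ with x∈p∪q⁻ X (⋃ xs) x∈
  ... | inj₁ x∈X  = X⊆F x∈X
  ... | inj₂ x∈xs = ⋃-⊆ xs⊆F x∈xs

  faces≡chains : faces ≡ filter chain? (sublists (interval ⊥ F))
  faces≡chains = ≡.trans (≡.cong (filter face? ∘ sublists) vertices≡interval)
    (filter-cong-∈ face? chain? (sublists (interval ⊥ F)) (λ _ → proj₁)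
      λ xs∈ xs-chain → xs-chain , ⋃-⊆ (All.lookup (sublists-All interval-⊆) xs∈))

  f≡chainNumber : ∀ i → f i ≡ chainNumber ∣ F ∣ i
  f≡chainNumber i = begin
    f i
      ≡⟨ ≡.cong (length ∘ filter (λ xs → length xs ℕ.≟ i)) faces≡chains ⟩
    length (chainLists (interval ⊥ F) i)
      ≡⟨ length-chainLists (interval ⊥ F) (interval-ascending ⊥ F) i ⟩
    chains (interval ⊥ F) i
      ≡⟨ chains-interval i ⊥ F ⊥⊆ ⟩
    chainNumber (∣ F ∣ ∸ ∣ ⊥ {n} ∣) i
      ≡⟨ ≡.cong (λ k → chainNumber (∣ F ∣ ∸ k) i) (∣⊥∣≡0 n) ⟩
    chainNumber ∣ F ∣ i ∎
    where open ≡.≡-Reasoning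

  -- Read off from the face numbers: they vanish beyond ∣ F ∣ and are positive there, so no maximal
  -- chain has to be constructed.
  size≡∣F∣ : size ≡ ∣ F ∣
  size≡∣F∣ = ℕ.≤-antisym
    (max≤v⁺ {xs = map length faces} z≤n (All.map⁺ (All.tabulate {xs = faces} bounded)))
    (All.lookup (xs≤max 0 (map length faces)) maximal)
    where
    nonempty⇒∃ : ∀ {A : Set} {P : Pred A _} (P? : Decidable P) (xs : List A) →
                 0 ℕ.< length (filter P? xs) → ∃ λ x → x ∈ xs × P x
    nonempty⇒∃ P? xs 0<l with filter P? xs in eq
    ... | x ∷ _ = x , ∈-filter⁻ P? {xs = xs} (≡.subst (x ∈_) (≡.sym eq) (here ≡.refl))

    bounded : ∀ {xs} → xs ∈ faces → length xs ℕ.≤ ∣ F ∣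
    bounded {xs} xs∈ = ℕ.≮⇒≥ λ ∣F∣<∣xs∣ → ℕ.<⇒≢
      (List.filter-some (λ ys → length ys ℕ.≟ length xs) (lose xs∈ ≡.refl))
      (≡.sym (≡.trans (f≡chainNumber (length xs)) (chainNumber-> ∣F∣<∣xs∣)))

    maximal : ∣ F ∣ ∈ map length faces
    maximal with nonempty⇒∃ (λ xs → length xs ℕ.≟ ∣ F ∣) faces
      (≡.subst (0 ℕ.<_) (≡.sym (f≡chainNumber ∣ F ∣)) (chainNumber-pos ∣ F ∣))
    ... | xs , xs∈ , ∣xs∣≡∣F∣ = ≡.subst (_∈ map length faces) ∣xs∣≡∣F∣ (∈-map⁺ length xs∈)

-- The three polynomials as values of `w` over ℤ[z]

private
  module ℤ[z] = CommutativeRing Poly-commutativeRing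
  open ListSum ℤ[z].commutativeSemiring
  open BinomialTransform ℤ[z].commutativeSemiring
  open BinomialSums ℤ[z].commutativeSemiring using (∑-subsets)
  open LocalEulerian Poly-commutativeRing z 1-z 1-z+z≋1 using (w; T[-1]-Eulerian)
  open Algebra.Properties.Semiring.Exp ℤ[z].semiring using (_^_)
  open Relation.Binary.Reasoning.Setoid ℤ[z].setoid

^ₚ≡^ : ∀ p k → p ^ₚ k ≡ p ^ k
^ₚ≡^ p zero    = ≡.refl
^ₚ≡^ p (suc k) = ≡.cong (p *ₚ_) (^ₚ≡^ p k)

constₚ-T : ∀ (φ : ℕ → ℕ) k → constₚ (+ Tℕ 1 φ k) ≋ T (constₚ (+ 1)) (λ m → constₚ (+ φ m)) k
constₚ-T φ zero    = ≋-refl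
constₚ-T φ (suc k) = ≋-trans
  (≋-reflexive (≡.cong (λ x → constₚ (+ (x ℕ.+ Tℕ 1 (φ ∘ suc) k))) (ℕ.*-identityˡ _)))
  (+ₚ-cong (≋-trans (constₚ-T φ k) (≋-sym (*ₚ-identityˡ _))) (constₚ-T (φ ∘ suc) k))

chainPoly : ℕ → ℕ → Poly
chainPoly k i = constₚ (+ chainNumber k i)

chainPoly-> : ∀ {k i} → k ℕ.< i → chainPoly k i ≋ []
chainPoly-> k<i = ≋-trans (≋-reflexive (≡.cong (λ x → constₚ (+ x)) (chainNumber-> k<i))) shift-[]

chainPoly-suc : ∀ k i → chainPoly k (suc i) +ₚ chainPoly k i ≋ T (constₚ (+ 1)) (λ m → chainPoly m i) k
chainPoly-suc k i = ≋-trans (≋-reflexive (≡.cong (λ x → constₚ (+ x)) (T⁺-+ (λ m → chainNumber m i) k)))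
  (constₚ-T (λ m → chainNumber m i) k)

open ChainPolynomial Poly-commutativeRing z 1-z 1-z+z≋1 using (H; H-isEulerian)

eulerianPoly : ℕ → Poly
eulerianPoly = H chainPoly (λ _ → ≋-refl) chainPoly-> chainPoly-suc

h-barycentric : ∀ n (F : Subset n) → h (restrict (barycentricSubdivision n) F) ≋ eulerianPoly ∣ F ∣
h-barycentric n F = begin
  ∑ (upTo (suc size)) (λ i → constₚ (+ f i) *ₚ z ^ₚ i *ₚ 1-z ^ₚ (size ∸ i))
    ≈⟨ ≋-reflexive (≡.cong
         (λ d → ∑ (upTo (suc d)) λ i → constₚ (+ f i) *ₚ z ^ₚ i *ₚ 1-z ^ₚ (d ∸ i)) (size≡∣F∣ F)) ⟩
  ∑ (upTo (suc ∣ F ∣)) (λ i → constₚ (+ f i) *ₚ z ^ₚ i *ₚ 1-z ^ₚ (∣ F ∣ ∸ i))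
    ≈⟨ ∑-cong (upTo (suc ∣ F ∣)) (λ i → ≋-reflexive (≡.cong₂ _*ₚ_
         (≡.cong₂ _*ₚ_ (≡.cong (λ x → constₚ (+ x)) (f≡chainNumber F i)) (^ₚ≡^ z i)) (^ₚ≡^ 1-z (∣ F ∣ ∸ i)))) ⟩
  eulerianPoly ∣ F ∣ ∎
  where open Complex (restrict (barycentricSubdivision n) F) using (f; size)

constₚ-^ : ∀ a k → constₚ (a ℤ.^ k) ≋ constₚ a ^ k
constₚ-^ a zero    = ≋-refl
constₚ-^ a (suc k) = ≋-trans (≋-sym (constₚ-*ₚ a (constₚ (a ℤ.^ k)))) (*ₚ-congˡ (constₚ a) (constₚ-^ a k))

localH-barycentric : ∀ n → localH (barycentricSubdivision n) ≋ w n
localH-barycentric n = begin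
  ∑ (subsets n) (λ F → constₚ (-1ℤ ℤ.^ (n ∸ ∣ F ∣)) *ₚ h (restrict (barycentricSubdivision n) F))
    ≈⟨ ∑-cong (subsets n) (λ F → *ₚ-cong (constₚ-^ -1ℤ (n ∸ ∣ F ∣)) (h-barycentric n F)) ⟩
  ∑ (subsets n) (λ F → constₚ -1ℤ ^ (n ∸ ∣ F ∣) *ₚ eulerianPoly ∣ F ∣)
    ≈⟨ ∑-subsets (constₚ -1ℤ) n eulerianPoly ⟩
  T (constₚ -1ℤ) eulerianPoly n
    ≈⟨ T[-1]-Eulerian 1-z-cancelˡ (H-isEulerian chainPoly (λ _ → ≋-refl) chainPoly-> chainPoly-suc) n ⟩
  w n ∎

derangementPoly≋w : ∀ n → derangementPoly n ≋ w n
derangementPoly≋w n = ≋-trans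
  (∑-cong (derangements n) λ π → ≋-reflexive (^ₚ≡^ z (exc π)))
  (DerangementMatrix.∑-derangements ℤ[z].commutativeSemiring z n)

module _ {c ℓ₁ ℓ₂ : Level} (K : OrderedField c ℓ₁ ℓ₂) where

  -- Two duplicate-free lists with the same members are permutations of each other; this replaces
  -- the bounding box by the stepwise enumeration.
  latticePoints-↭ : ∀ m → latticePoints K (lectureHallSimplex K (2⋯ suc m) (2⋯-nonZero (suc m))) ↭ points 1 0 m
  latticePoints-↭ m = ∼bag⇒↭ (unique∧set⇒bag (latticePoints-unique K Δ) (points-unique 1 0 m)
    λ {x} → ⇔-sym (∈-points 1 0 m _ _) ⇔-∘ (LectureHallPoints.inΠ°⇔Steps K m _ _ ⇔-∘ ∈-latticePoints K Δ x))
    where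
    Δ : LatticeSimplex K m m
    Δ = lectureHallSimplex K (2⋯ suc m) (2⋯-nonZero (suc m))

  ℓ*-lectureHall : ∀ m → ℓ* K (lectureHallSimplex K (2⋯ suc m) (2⋯-nonZero (suc m))) ≋ w (suc m)
  ℓ*-lectureHall m = ≋-trans (∑-↭ _ (latticePoints-↭ m))
    (≋-trans (∑-cong (points 1 0 m) λ x → ≋-reflexive (^ₚ≡^ z ℤ.∣ proj₂ x ∣))
      (LatticeSum.∑points≈W ℤ[z].commutativeSemiring z m))

open import Data.Nat.Base using (_≤_)

theorem4p1 : ∀ {c ℓ₁ ℓ₂ : Level} (K : OrderedField c ℓ₁ ℓ₂) (n : ℕ) → 2 ≤ n →
    sDerangementPoly K (2⋯ n) (2⋯-nonZero n) ≈ₚ derangementPoly n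
    × localH (barycentricSubdivision n) ≈ₚ ℓ* K (lectureHallSimplex K (2⋯ n) (2⋯-nonZero n))
theorem4p1 K (suc m) _ =
    at (≋-trans (ℓ*-lectureHall K m) (≋-sym (derangementPoly≋w (suc m))))
  , at (≋-trans (localH-barycentric (suc m)) (≋-sym (ℓ*-lectureHall K m)))
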